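{- Let $b\ge 2$ be an integer and $d\in\{0,1,\dots,b-1\}$. For $i\ge1$ put $\gamma_i=\sum_{0\le a<b,\ a\ne d}a^i$. Define $u_{0;0}=b$ and, for $m\ge1$, define $u_{0;m}$ recursively by $$(b^{m+1}-b+1)\,u_{0;m}=\sum_{i=1}^{m}\binom{m}{i}\gamma_i\,u_{0;m-i}.$$ For $j\ge1$ and $m\ge0$ define $u_{j;m}$ recursively by $$(b^{m+1}-b+1)\,u_{j;m}=\sum_{i=1}^{m}\binom{m}{i}\gamma_i\,u_{j;m-i}+\sum_{i=0}^{m}\binom{m}{i}d^i\,u_{j-1;m-i}$$ (with the convention $0^0=1$). In particular $u_{j;0}=b$ for all $j\ge0$. Then for every $k\ge0$ and every $l\ge1$, $$H^{(k)}=\sum_{\substack{0<n<b^{l-1}\\ k(n)=k}}\frac1n\;+\;b\sum_{\substack{b^{l-1}\le n<b^{l}\\ k(n)\le k}}\frac1n\;+\;\sum_{m=1}^{\infty}(-1)^m\sum_{\substack{b^{l-1}\le n<b^{l}\\ k(n)\le k}}\frac{u_{k-k(n);m}}{n^{m+1}}.$$ Moreover, the numbers $u_{j;m}$ ($j\ge0$, $m\ge1$) satisfy: (i) $u_{j;m}\ge0$, with $u_{j;m}=0$ only if $j=0$, $b=2$ and $d=1$; (ii) for all $j\ge 0$, $m\ge0$: $u_{j;m+1}\le u_{j;m}$, with strict inequality unless both are $0$; (iii) for each fixed $m\ge1$, the sequence $(u_{j;m})_{j\ge0}$ is strictly increasing and converges to $b/(m+1)$.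
   Context: For an integer $n\ge0$, its (minimal) base-$b$ representation is the string of base-$b$ digits of $n$ without leading zeros (the empty string for $n=0$); $k(n)$ denotes the number of occurrences of the digit $d$ in this representation. For $k\ge0$, the Irwin sum is $H^{(k)}=\sum_{n\ge1,\ k(n)=k}1/n$ (a convergent series of positive terms; it equals $0$ when $b=2$, $d=1$, $k=0$, the series being empty). -}

module Defs where

open import Data.Digit using (Expansion; fromDigits)
open import Data.Bool using (if_then_else_)
open import Data.Fin as Fin using (Fin; toℕ)
open import Data.Integer as ℤ using (+_; 1ℤ)
import Data.Integer.Properties as ℤ
open import Data.List using (List; []; _∷_; length; map; foldr; filter; upTo; applyUpTo; last)
open import Data.List.Relation.Unary.Any using (here; there)
open import Data.List.Membership.Propositional using (_∈_)
import Data.List.Membership.Propositional.Properties as ∈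
open import Data.Maybe using (just)
open import Data.Nat as ℕ using (ℕ; zero; suc; _∸_; _^_; NonZero; NonTrivial; _%_; nonTrivial⇒nonZero)
open import Data.Nat.ListAction using (sum)
open import Data.Nat.Combinatorics using (_C_)
open import Data.Nat.DivMod using (_mod_; _div_; m≡m%n+[m/n]*n; m/n<m; m<n⇒m%n≡m; m/n≡0⇒m<n; m%n<n)
open import Data.Nat.Induction using (Acc; acc; <-wellFounded)
import Data.Nat.Properties as ℕ
import Data.Fin.Properties as Fin
open import Data.Product using (∃; _,_)
open import Data.Rational as ℚ using (ℚ; 0ℚ; 1ℚ; ½; _+_; _-_; _*_; -_; ∣_∣; _/_; _<_)
import Data.Rational.Properties as ℚ
import Data.Rational.Unnormalised as ℚᵘ
import Data.Rational.Unnormalised.Properties as ℚᵘ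
open import Relation.Nullary using (does)
open import Relation.Nullary.Decidable using (¬?)
open import Relation.Binary.PropositionalEquality
open import Algebra.Definitions.RawSemiring ℚ.+-*-rawSemiring using () renaming (_^_ to _^ℚ_) public

------------------------------------------------------------------------
-- Real numbers, as Cauchy sequences of rationals modulo _≃_

IsCauchy : (ℕ → ℚ) → Set
IsCauchy x = ∀ ε → 0ℚ < ε → ∃ λ N → ∀ m n → N ℕ.≤ m → N ℕ.≤ n → ∣ x m - x n ∣ < ε

record ℝ : Set where
  constructor lim
  field
    seq      : ℕ → ℚ
    isCauchy : IsCauchy seq

open ℝ public

infix 4 _≃_

_≃_ : ℝ → ℝ → Set
x ≃ y = ∀ ε → 0ℚ < ε → ∃ λ N → ∀ n → N ℕ.≤ n → ∣ seq x n - seq y n ∣ < ε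

infix 4 _⟶_

_⟶_ : (ℕ → ℚ) → ℚ → Set
x ⟶ y = ∀ ε → 0ℚ < ε → ∃ λ N → ∀ n → N ℕ.≤ n → ∣ x n - y ∣ < ε

private
  |p-p|<ε : ∀ p {ε} → 0ℚ < ε → ∣ p - p ∣ < ε
  |p-p|<ε p {ε} 0<ε = subst (λ z → ∣ z ∣ < ε) (sym (ℚ.+-inverseʳ p)) 0<ε

fromℚ : ℚ → ℝ
fromℚ q = lim (λ _ → q) λ ε 0<ε → 0 , λ _ _ _ _ → |p-p|<ε q 0<ε

private
  diff-+ : ∀ a b c d → (a + b) - (c + d) ≡ (a - c) + (b - d)
  diff-+ = solve 4 (λ a b c d → (a :+ b) :- (c :+ d) := (a :- c) :+ (b :- d)) refl
    where open import Data.Rational.Solver; open +-*-Solver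

  halves : ∀ ε → ½ * ε + ½ * ε ≡ ε
  halves ε = trans (sym (ℚ.*-distribʳ-+ ε ½ ½)) (ℚ.*-identityˡ ε)

  half-pos : ∀ {ε} → 0ℚ < ε → 0ℚ < ½ * ε
  half-pos {ε} 0<ε = subst (_< ½ * ε) (ℚ.*-zeroʳ ½) (ℚ.*-monoʳ-<-pos ½ 0<ε)

infixl 6 _+ᴿ_

_+ᴿ_ : ℝ → ℝ → ℝ
x +ᴿ y = lim (λ n → seq x n + seq y n) cauchy
  where
  cauchy : IsCauchy (λ n → seq x n + seq y n)
  cauchy ε 0<ε with isCauchy x (½ * ε) (half-pos 0<ε) | isCauchy y (½ * ε) (half-pos 0<ε)
  ... | M , p | N , q = M ℕ.+ N , λ m n M+N≤m M+N≤n →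
    subst (_< ε) (cong ∣_∣ (sym (diff-+ (seq x m) (seq y m) (seq x n) (seq y n))))
      (ℚ.≤-<-trans (ℚ.∣p+q∣≤∣p∣+∣q∣ (seq x m - seq x n) (seq y m - seq y n))
        (subst (∣ seq x m - seq x n ∣ + ∣ seq y m - seq y n ∣ <_) (halves ε)
          (ℚ.+-mono-<
            (p m n (ℕ.≤-trans (ℕ.m≤m+n M N) M+N≤m) (ℕ.≤-trans (ℕ.m≤m+n M N) M+N≤n))
            (q m n (ℕ.≤-trans (ℕ.m≤n+m N M) M+N≤m) (ℕ.≤-trans (ℕ.m≤n+m N M) M+N≤n)))))

------------------------------------------------------------------------
-- Finite sums and series

∑ : List ℕ → (ℕ → ℚ) → ℚ
∑ ns f = foldr (λ n s → f n + s) 0ℚ ns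

-- lo, lo + 1, …, hi - 1
[_⋯_⟩ : ℕ → ℕ → List ℕ
[ lo ⋯ hi ⟩ = applyUpTo (lo ℕ.+_) (hi ∸ lo)

-- Series are indexed from 1: the N-th partial sum is f 1 + ⋯ + f N.
partialSum : (ℕ → ℚ) → ℕ → ℚ
partialSum f N = ∑ [ 1 ⋯ suc N ⟩ f

Converges : (ℕ → ℚ) → Set
Converges f = IsCauchy (partialSum f)

∑∞ : (f : ℕ → ℚ) → Converges f → ℝ
∑∞ f = lim (partialSum f)

fromℕ : ℕ → ℚ
fromℕ n = + n / 1

-- The value at 0 is never used: every sum below runs over positive n.
1/_ : ℕ → ℚ
1/ zero  = 0ℚ
1/ suc n = 1ℤ / suc n

------------------------------------------------------------------------

module Irwin (b : ℕ) .{{b≥2 : NonTrivial b}} (d : Fin b) where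

  private instance
    b≢0 : NonZero b
    b≢0 = nonTrivial⇒nonZero b

  private
    digitsAcc : ∀ n → Acc ℕ._<_ n → Expansion b
    digitsAcc zero      _        = []
    digitsAcc n@(suc _) (acc rs) =
      n mod b ∷ digitsAcc (n div b) (rs (m/n<m n b (ℕ.nonTrivial⇒n>1 b)))

    digitsAcc-irrelevant : ∀ n (a a′ : Acc ℕ._<_ n) → digitsAcc n a ≡ digitsAcc n a′
    digitsAcc-irrelevant zero      _        _         = refl
    digitsAcc-irrelevant n@(suc _) (acc rs) (acc rs′) =
      cong (n mod b ∷_) (digitsAcc-irrelevant (n div b) _ _)

  -- The minimal representation, least significant digit first as in
  -- Data.Digit.  Data.Digit.toDigits is not used because it represents
  -- 0 by the digit 0 rather than by the empty string.
  digits : ℕ → Expansion b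
  digits n = digitsAcc n (<-wellFounded n)

  digits-zero : digits 0 ≡ []
  digits-zero = refl

  digits-suc : ∀ n → digits (suc n) ≡ suc n mod b ∷ digits (suc n div b)
  digits-suc n with <-wellFounded (suc n)
  ... | acc rs = cong (suc n mod b ∷_) (digitsAcc-irrelevant (suc n div b) _ _)

  fromDigits-digits : ∀ n → fromDigits (digits n) ≡ n
  fromDigits-digits n = go n (<-wellFounded n)
    where
    go : ∀ n (a : Acc ℕ._<_ n) → fromDigits (digitsAcc n a) ≡ n
    go zero      _        = refl
    go n@(suc _) (acc rs) =
      trans (cong₂ (λ r q → r ℕ.+ q ℕ.* b) (Fin.toℕ-fromℕ< (m%n<n n b)) (go (n div b) _))
            (sym (m≡m%n+[m/n]*n n b))

  leadingDigit≢0 : ∀ n x → last (digits n) ≡ just x → toℕ x ≢ 0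
  leadingDigit≢0 n = go n (<-wellFounded n)
    where
    go : ∀ n (a : Acc ℕ._<_ n) x → last (digitsAcc n a) ≡ just x → toℕ x ≢ 0
    step : ∀ n .{{_ : NonZero n}} q (a : Acc ℕ._<_ q) → n div b ≡ q →
           ∀ x → last (n mod b ∷ digitsAcc q a) ≡ just x → toℕ x ≢ 0
    go zero      _        x ()
    go n@(suc _) (acc rs) = step n (n div b) (rs (m/n<m n b (ℕ.nonTrivial⇒n>1 b))) refl
    step n zero      a        eq x refl x≡0 = ℕ.≢-nonZero⁻¹ n
      (trans (sym (m<n⇒m%n≡m (m/n≡0⇒m<n {n} {b} eq)))
             (trans (sym (Fin.toℕ-fromℕ< (m%n<n n b))) x≡0))
    step n q@(suc _) (acc rs) eq x h = go q (acc rs) x h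

  -- k(n): the number of occurrences of the digit d in n
  #d : ℕ → ℕ
  #d n = length (filter (Fin._≟ d) (digits n))

  γ : ℕ → ℕ
  γ i = sum (map (_^ i) (filter (λ a → ¬? (a ℕ.≟ toℕ d)) (upTo b)))

  -- The term of index n of the Irwin series
  irwinTerm : ℕ → ℕ → ℚ
  irwinTerm k n = if does (#d n ℕ.≟ k) then 1/ n else 0ℚ

  private
    -- solves (b^(m+1) - b + 1) x m = Σ_{i=1}^m (m C i) γ i x (m-i) + c m  for x m
    solve : (ℕ → ℚ) → (ℕ → ℚ) → ℕ → ℚ
    solve c x m = (1ℤ / suc (b ^ suc m ∸ b)) *
      (∑ [ 1 ⋯ suc m ⟩ (λ i → fromℕ ((m C i) ℕ.* γ i) * x (m ∸ i)) + c m)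

    iter : (ℕ → ℚ) → ℕ → ℕ → ℚ
    iter c zero    = λ _ → 0ℚ
    iter c (suc s) = solve c (iter c s)

    row : (ℕ → ℚ) → ℕ → ℚ
    row c m = iter c (suc m) m

    c₀ : ℕ → ℚ
    c₀ zero    = fromℕ b
    c₀ (suc _) = 0ℚ

  -- u j m is the u_{j;m} of the recursion; see u-zero-zero, u-zero and u-suc,
  -- which characterise u.  The recursive equation is iterated m + 1 times,
  -- after which its value at m no longer depends on the starting sequence.
  u : ℕ → ℕ → ℚ
  u zero    = row c₀
  u (suc j) = row (λ m → ∑ [ 0 ⋯ suc m ⟩ (λ i → fromℕ ((m C i) ℕ.* toℕ d ^ i) * u j (m ∸ i)))

  private
    ∑-cong : ∀ ns {f g : ℕ → ℚ} → (∀ {n} → n ∈ ns → f n ≡ g n) → ∑ ns f ≡ ∑ ns g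
    ∑-cong []       _ = refl
    ∑-cong (n ∷ ns) h = cong₂ _+_ (h (here refl)) (∑-cong ns (λ p → h (there p)))

    ∈-range : ∀ {m i} → i ∈ [ 1 ⋯ suc m ⟩ → m ∸ i ℕ.< m
    ∈-range {m} p with ∈.∈-applyUpTo⁻ suc p
    ... | i , i<m , refl = ℕ.∸-monoʳ-< {m} {suc i} {0} (ℕ.s≤s ℕ.z≤n) i<m

    iter-stable : ∀ c s t m → m ℕ.< s → m ℕ.< t → iter c s m ≡ iter c t m
    iter-stable c (suc s) (suc t) m (ℕ.s≤s m≤s) (ℕ.s≤s m≤t) =
      cong (λ z → (1ℤ / suc (b ^ suc m ∸ b)) * (z + c m))
        (∑-cong [ 1 ⋯ suc m ⟩ λ {i} p → cong (fromℕ ((m C i) ℕ.* γ i) *_)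
          (iter-stable c s t (m ∸ i) (ℕ.≤-trans (∈-range p) m≤s) (ℕ.≤-trans (∈-range p) m≤t)))

    suc-inverse : ∀ n → (+ suc n / 1) * (1ℤ / suc n) ≡ 1ℚ
    suc-inverse n = ℚ.toℚᵘ-injective (begin-equality
      ℚ.toℚᵘ ((+ suc n / 1) * (1ℤ / suc n))               ≃⟨ ℚ.toℚᵘ-homo-* (+ suc n / 1) (1ℤ / suc n) ⟩
      ℚ.toℚᵘ (+ suc n / 1) ℚᵘ.* ℚ.toℚᵘ (1ℤ / suc n)      ≃⟨ ℚᵘ.*-cong (ℚ.toℚᵘ-fromℚᵘ (+ suc n ℚᵘ./ 1)) (ℚ.toℚᵘ-fromℚᵘ (1ℤ ℚᵘ./ suc n)) ⟩
      (+ suc n ℚᵘ./ 1) ℚᵘ.* (1ℤ ℚᵘ./ suc n)               ≃⟨ ℚᵘ.*≡* (cong +_ (cong suc (trans (ℕ.*-identityʳ _) (trans (ℕ.*-identityʳ n) (sym (trans (ℕ.+-identityʳ _) (ℕ.+-identityʳ n))))))) ⟩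
      ℚᵘ.1ℚᵘ ∎)
      where open ℚᵘ.≤-Reasoning

  -- b^(m+1) - b + 1
  coeff : ℕ → ℚ
  coeff m = (+ (b ^ suc m) ℤ.- + b ℤ.+ 1ℤ) / 1

  private
    b≤b^ : ∀ m → b ℕ.≤ b ^ suc m
    b≤b^ m = ℕ.m≤m*n b (b ^ m) {{ℕ.m^n≢0 b m}}

    coeff≡ : ∀ m → coeff m ≡ + suc (b ^ suc m ∸ b) / 1
    coeff≡ m = cong (_/ 1) (trans
      (cong (ℤ._+ 1ℤ) (trans (ℤ.m-n≡m⊖n (b ^ suc m) b) (ℤ.⊖-≥ (b≤b^ m))))
      (cong +_ (ℕ.+-comm (b ^ suc m ∸ b) 1)))

    row-eq : ∀ c m → coeff m * row c m ≡
      ∑ [ 1 ⋯ suc m ⟩ (λ i → fromℕ ((m C i) ℕ.* γ i) * row c (m ∸ i)) + c m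
    row-eq c m = begin
      coeff m * row c m   ≡⟨ cong (_* row c m) (coeff≡ m) ⟩
      p * (q * r)         ≡⟨ sym (ℚ.*-assoc p q r) ⟩
      (p * q) * r         ≡⟨ cong (_* r) (suc-inverse (b ^ suc m ∸ b)) ⟩
      1ℚ * r              ≡⟨ ℚ.*-identityˡ r ⟩
      r                   ≡⟨ cong (_+ c m) (∑-cong [ 1 ⋯ suc m ⟩ λ {i} i∈ →
                               cong (fromℕ ((m C i) ℕ.* γ i) *_)
                                 (iter-stable c m (suc (m ∸ i)) (m ∸ i) (∈-range i∈) ℕ.≤-refl)) ⟩
      ∑ [ 1 ⋯ suc m ⟩ (λ i → fromℕ ((m C i) ℕ.* γ i) * row c (m ∸ i)) + c m ∎
      where
      open ≡-Reasoning
      p = + suc (b ^ suc m ∸ b) / 1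
      q = 1ℤ / suc (b ^ suc m ∸ b)
      r = ∑ [ 1 ⋯ suc m ⟩ (λ i → fromℕ ((m C i) ℕ.* γ i) * iter c m (m ∸ i)) + c m

  u-zero-zero : u 0 0 ≡ fromℕ b
  u-zero-zero = trans (sym (trans (cong (_* u 0 0) coeff0≡1) (ℚ.*-identityˡ _)))
                      (trans (row-eq c₀ 0) (ℚ.+-identityˡ _))
    where
    coeff0≡1 : coeff 0 ≡ 1ℚ
    coeff0≡1 = trans (coeff≡ 0) (cong (λ z → + suc z / 1)
      (trans (cong (_∸ b) (ℕ.*-identityʳ b)) (ℕ.n∸n≡0 b)))

  u-zero : ∀ m → 1 ℕ.≤ m → coeff m * u 0 m ≡
    ∑ [ 1 ⋯ suc m ⟩ (λ i → fromℕ ((m C i) ℕ.* γ i) * u 0 (m ∸ i))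
  u-zero m@(suc _) _ = trans (row-eq c₀ m) (ℚ.+-identityʳ _)

  u-suc : ∀ j m → coeff m * u (suc j) m ≡
    ∑ [ 1 ⋯ suc m ⟩ (λ i → fromℕ ((m C i) ℕ.* γ i) * u (suc j) (m ∸ i)) +
    ∑ [ 0 ⋯ suc m ⟩ (λ i → fromℕ ((m C i) ℕ.* toℕ d ^ i) * u j (m ∸ i))
  u-suc j m = row-eq _ m

{-# OPTIONS --safe #-}
module Submission where

-- Attach to u_{j;m} the measure on [0, 1) with mass b^-|X| at 0.X for every digit
-- string X (leading zeros allowed) in which d occurs j times.  Splitting off the
-- first digit of X shows that its m-th moment satisfies the recursion of u_{j;m},
-- and splitting n of the Irwin series into its l leading digits and the string X
-- that follows turns the sum of the 1/n into integrals of 1/(n + x), which are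
-- expanded in powers of x.  The remainder after M terms is at most the M-th
-- moment, and this is at most b/(M+1), the moment of b times Lebesgue measure:
-- Lebesgue measure satisfies the same recursion, so that the differences
-- b/(m+1) - u_{j;m} are nonnegative by induction and tend to 0 in j by a
-- contraction argument.  The measures themselves are only used through strings
-- of bounded length.

open import Defs
open import Algebra.Bundles using (CommutativeRing)
import Algebra.Properties.CommutativeSemiring.Binomial
import Algebra.Properties.CommutativeSemiring.Exp
open import Data.Bool using (Bool; true; false; not; if_then_else_)
open import Data.Empty using (⊥-elim)
open import Data.Fin as Fin using (Fin; toℕ)
import Data.Fin.Properties as Fin
open import Data.Integer as ℤ using (+_; 1ℤ)
import Data.Integer.Properties as ℤ
open import Data.Integer.Solver using () renaming (module +-*-Solver to ℤ-Solver)
open import Data.List using (List; []; _∷_; applyUpTo; filter; length; map; upTo)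
open import Data.Nat as ℕ using (ℕ; zero; suc; _∸_; _^_; _!; _≤?_; _≟_; NonZero; NonTrivial; nonTrivial⇒nonZero; nonTrivial⇒n>1)
open import Data.Nat.Combinatorics using (_C_; nCn≡1; nCk≡n!/k![n-k]!; k![n∸k]!∣n!)
open import Data.Nat.Divisibility using (n∣m*n)
open import Data.Nat.DivMod using (_%_; _mod_; m%n<n; m<n⇒m%n≡m; m<n⇒m/n≡0; m*n/n≡m; m/n*n≡m; [m+kn]%n≡m%n; +-distrib-/-∣ʳ)
open import Data.Nat.ListAction using (sum)
import Data.Nat.Properties as ℕ
open import Data.Nat.Solver using () renaming (module +-*-Solver to ℕ-Solver)
open import Data.Product using (Σ-syntax; ∃; _×_; _,_; proj₁; proj₂)
open import Data.Rational as ℚ using (ℚ; 0ℚ; 1ℚ; ½; _+_; _-_; _*_; -_; ∣_∣; _/_; _<_; _≤_; positive; nonNegative)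
import Data.Rational.Properties as ℚ
open import Data.Rational.Solver using () renaming (module +-*-Solver to ℚ-Solver)
import Data.Rational.Unnormalised as ℚᵘ
import Data.Rational.Unnormalised.Properties as ℚᵘ
open import Data.Sum using (_⊎_; inj₁; inj₂)
open import Function using (_∘_; it)
open import Relation.Binary.PropositionalEquality
open import Relation.Nullary using (¬_; Dec; does; yes; no; contradiction)
open import Relation.Nullary.Decidable using (dec-true; dec-false; decidable-stable; _×-dec_)
open import Relation.Unary using (Pred; Decidable)

-- Rational arithmetic

-- The numbers u_{j;m} are rational while the measures have infinitely many atoms, so no integral
-- against them is ever formed. Facts about moments are proved for strings of fewer than L digits,
-- where everything is a finite rational sum, and carried over to u because the difference from u is
-- nonnegative and tends to 0 as L grows. This difference obeys the first-digit equation without its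
-- source term, so one contraction lemma serves both this limit and the limit of u in j.
--
-- The case n = 1 dictates the error estimate: for x near 1 the powers (x/n)^M do not decay
-- geometrically, and only the bound b/(M+1) makes the remainder small for every l.
--
-- Strict decrease in m cannot be obtained as a limit of strict inequalities. It follows instead
-- from convexity of u_{j;m} in m together with its convergence to 0.
--
-- The Irwin series has nonnegative terms, so it is enough to control its partial sums up to P b^L -
-- 1, where P = b^(l-1). Monotonicity covers the remaining ones and yields convergence of the series
-- as well.

p-q+q≡p : ∀ p q → p - q + q ≡ p
p-q+q≡p = solve 2 (λ p q → p :- q :+ q := p) refl
  where open ℚ-Solver

p≤q⇒0≤q-p : ∀ {p q} → p ≤ q → 0ℚ ≤ q - p
p≤q⇒0≤q-p {p} {q} p≤q = subst (_≤ q - p) (ℚ.+-inverseʳ p) (ℚ.+-monoˡ-≤ (- p) p≤q)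

0≤q-p⇒p≤q : ∀ {p q} → 0ℚ ≤ q - p → p ≤ q
0≤q-p⇒p≤q {p} {q} 0≤q-p = subst₂ _≤_ (ℚ.+-identityˡ p) (p-q+q≡p q p) (ℚ.+-monoˡ-≤ p 0≤q-p)

p+q≡r⇒p≡r-q : ∀ {p q r} → p + q ≡ r → p ≡ r - q
p+q≡r⇒p≡r-q {p} {q} refl = eq p q
  where
  open ℚ-Solver
  eq : ∀ p q → p ≡ p + q - q
  eq = solve 2 (λ p q → p := p :+ q :- q) refl

p≡q⇒p-q≡0 : ∀ {p q} → p ≡ q → p - q ≡ 0ℚ
p≡q⇒p-q≡0 {p} refl = ℚ.+-inverseʳ p

p*[q-r]≡p*q-p*r : ∀ p q r → p * (q - r) ≡ p * q - p * r
p*[q-r]≡p*q-p*r = solve 3 (λ p q r → p :* (q :- r) := p :* q :- p :* r) refl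
  where open ℚ-Solver

p≤p+q : ∀ {p q} → 0ℚ ≤ q → p ≤ p + q
p≤p+q {p} {q} 0≤q = subst (_≤ p + q) (ℚ.+-identityʳ p) (ℚ.+-monoʳ-≤ p 0≤q)

p≤q+p : ∀ {p q} → 0ℚ ≤ q → p ≤ q + p
p≤q+p {p} {q} 0≤q = subst (p ≤_) (ℚ.+-comm p q) (p≤p+q 0≤q)

+-nonneg : ∀ {p q} → 0ℚ ≤ p → 0ℚ ≤ q → 0ℚ ≤ p + q
+-nonneg = ℚ.+-mono-≤

*-nonneg : ∀ {p q} → 0ℚ ≤ p → 0ℚ ≤ q → 0ℚ ≤ p * q
*-nonneg {p} {q} 0≤p 0≤q = ℚ.nonNegative⁻¹ (p * q)
  {{ℚ.nonNeg*nonNeg⇒nonNeg p {{nonNegative 0≤p}} q {{nonNegative 0≤q}}}}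

*-pos : ∀ {p q} → 0ℚ < p → 0ℚ < q → 0ℚ < p * q
*-pos {p} {q} 0<p 0<q = ℚ.positive⁻¹ (p * q)
  {{ℚ.pos*pos⇒pos p {{positive 0<p}} q {{positive 0<q}}}}

*-monoʳ-≤ : ∀ {r p q} → 0ℚ ≤ r → p ≤ q → r * p ≤ r * q
*-monoʳ-≤ {r} 0≤r = ℚ.*-monoˡ-≤-nonNeg r {{nonNegative 0≤r}}

*-cancelˡ-≤ : ∀ {r p q} → 0ℚ < r → r * p ≤ r * q → p ≤ q
*-cancelˡ-≤ {r} 0<r = ℚ.*-cancelˡ-≤-pos r {{positive 0<r}}

*-cancelˡ-≡ : ∀ {r p q} → 0ℚ < r → r * p ≡ r * q → p ≡ q
*-cancelˡ-≡ 0<r eq =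
  ℚ.≤-antisym (*-cancelˡ-≤ 0<r (ℚ.≤-reflexive eq)) (*-cancelˡ-≤ 0<r (ℚ.≤-reflexive (sym eq)))

*-cancelˡ-nonneg : ∀ {r p} → 0ℚ < r → 0ℚ ≤ r * p → 0ℚ ≤ p
*-cancelˡ-nonneg {r} {p} 0<r h = *-cancelˡ-≤ 0<r (subst (_≤ r * p) (sym (ℚ.*-zeroʳ r)) h)

*-cancelˡ-pos : ∀ {r p} → 0ℚ < r → 0ℚ < r * p → 0ℚ < p
*-cancelˡ-pos {r} {p} 0<r h = ℚ.*-cancelˡ-<-nonNeg r {{ℚ.pos⇒nonNeg r {{positive 0<r}}}}
  (subst (_< r * p) (sym (ℚ.*-zeroʳ r)) h)

*-inverse-unique : ∀ {p q r} → 0ℚ < p → p * q ≡ 1ℚ → p * r ≡ 1ℚ → q ≡ r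
*-inverse-unique 0<p eq eq′ = *-cancelˡ-≡ 0<p (trans eq (sym eq′))

^ℚ-nonneg : ∀ {p} → 0ℚ ≤ p → ∀ m → 0ℚ ≤ p ^ℚ m
^ℚ-nonneg 0≤p zero    = ℚ.nonNegative⁻¹ 1ℚ
^ℚ-nonneg 0≤p (suc m) = *-nonneg 0≤p (^ℚ-nonneg 0≤p m)

^ℚ-≤1 : ∀ {p} → 0ℚ ≤ p → p ≤ 1ℚ → ∀ m → p ^ℚ m ≤ 1ℚ
^ℚ-≤1         0≤p p≤1 zero    = ℚ.≤-refl
^ℚ-≤1 {p} 0≤p p≤1 (suc m) = ℚ.≤-trans (*-monoʳ-≤ 0≤p (^ℚ-≤1 0≤p p≤1 m)) (subst (_≤ 1ℚ) (sym (ℚ.*-identityʳ p)) p≤1)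

1ℚ^≡1ℚ : ∀ m → 1ℚ ^ℚ m ≡ 1ℚ
1ℚ^≡1ℚ zero    = refl
1ℚ^≡1ℚ (suc m) = trans (ℚ.*-identityˡ (1ℚ ^ℚ m)) (1ℚ^≡1ℚ m)

∣-1^m∣≡1 : ∀ m → ∣ (- 1ℚ) ^ℚ m ∣ ≡ 1ℚ
∣-1^m∣≡1 zero    = refl
∣-1^m∣≡1 (suc m) = trans (ℚ.∣p*q∣≡∣p∣*∣q∣ (- 1ℚ) ((- 1ℚ) ^ℚ m)) (trans (ℚ.*-identityˡ _) (∣-1^m∣≡1 m))

∣p∣<q : ∀ {p q} → p < q → - p < q → ∣ p ∣ < q
∣p∣<q {p} p<q -p<q with ℚ.∣p∣≡p∨∣p∣≡-p p
... | inj₁ eq = subst (_< _) (sym eq) p<q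
... | inj₂ eq = subst (_< _) (sym eq) -p<q

∣p∣≤q : ∀ {p q} → p ≤ q → - p ≤ q → ∣ p ∣ ≤ q
∣p∣≤q {p} p≤q -p≤q with ℚ.∣p∣≡p∨∣p∣≡-p p
... | inj₁ eq = subst (_≤ _) (sym eq) p≤q
... | inj₂ eq = subst (_≤ _) (sym eq) -p≤q

p≤∣p∣ : ∀ p → p ≤ ∣ p ∣
p≤∣p∣ p with ℚ.≤-total 0ℚ p
... | inj₁ 0≤p = ℚ.≤-reflexive (sym (ℚ.0≤p⇒∣p∣≡p 0≤p))
... | inj₂ p≤0 = ℚ.≤-trans p≤0 (ℚ.0≤∣p∣ p)

-p≤∣p∣ : ∀ p → - p ≤ ∣ p ∣
-p≤∣p∣ p = subst (- p ≤_) (ℚ.∣-p∣≡∣p∣ p) (p≤∣p∣ (- p))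

∣p-q∣≡∣q-p∣ : ∀ p q → ∣ p - q ∣ ≡ ∣ q - p ∣
∣p-q∣≡∣q-p∣ p q = trans (cong ∣_∣ (eq p q)) (ℚ.∣-p∣≡∣p∣ (q - p))
  where
  open ℚ-Solver
  eq : ∀ p q → p - q ≡ - (q - p)
  eq = solve 2 (λ p q → p :- q := :- (q :- p)) refl

∣-∣-triangle : ∀ p q r → ∣ p - r ∣ ≤ ∣ p - q ∣ + ∣ q - r ∣
∣-∣-triangle p q r = subst (λ z → ∣ z ∣ ≤ ∣ p - q ∣ + ∣ q - r ∣) (eq p q r)
  (ℚ.∣p+q∣≤∣p∣+∣q∣ (p - q) (q - r))
  where
  open ℚ-Solver
  eq : ∀ p q r → (p - q) + (q - r) ≡ p - r
  eq = solve 3 (λ p q r → (p :- q) :+ (q :- r) := p :- r) refl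

½-pos : ∀ {ε} → 0ℚ < ε → 0ℚ < ½ * ε
½-pos = *-pos (ℚ.positive⁻¹ ½)

½+½ : ∀ ε → ½ * ε + ½ * ε ≡ ε
½+½ ε = trans (sym (ℚ.*-distribʳ-+ ε ½ ½)) (ℚ.*-identityˡ ε)

-- Naturals and their reciprocals in ℚ

/1-homo-+ : ∀ i j → (i ℤ.+ j) / 1 ≡ i / 1 + j / 1
/1-homo-+ i j = ℚ.toℚᵘ-injective (begin-equality
  ℚ.toℚᵘ ((i ℤ.+ j) / 1)               ≃⟨ ℚ.toℚᵘ-fromℚᵘ ((i ℤ.+ j) ℚᵘ./ 1) ⟩
  (i ℤ.+ j) ℚᵘ./ 1                     ≃⟨ ℚᵘ.*≡* (cong (ℤ._* 1ℤ) (cong₂ ℤ._+_ (sym (ℤ.*-identityʳ i)) (sym (ℤ.*-identityʳ j)))) ⟩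
  i ℚᵘ./ 1 ℚᵘ.+ j ℚᵘ./ 1               ≃⟨ ℚᵘ.+-cong (ℚᵘ.≃-sym (ℚ.toℚᵘ-fromℚᵘ (i ℚᵘ./ 1))) (ℚᵘ.≃-sym (ℚ.toℚᵘ-fromℚᵘ (j ℚᵘ./ 1))) ⟩
  ℚ.toℚᵘ (i / 1) ℚᵘ.+ ℚ.toℚᵘ (j / 1)   ≃⟨ ℚᵘ.≃-sym (ℚ.toℚᵘ-homo-+ (i / 1) (j / 1)) ⟩
  ℚ.toℚᵘ (i / 1 + j / 1)               ∎)
  where open ℚᵘ.≤-Reasoning

/1-homo-* : ∀ i j → (i ℤ.* j) / 1 ≡ (i / 1) * (j / 1)
/1-homo-* i j = ℚ.toℚᵘ-injective (begin-equality
  ℚ.toℚᵘ ((i ℤ.* j) / 1)               ≃⟨ ℚ.toℚᵘ-fromℚᵘ ((i ℤ.* j) ℚᵘ./ 1) ⟩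
  (i ℤ.* j) ℚᵘ./ 1                     ≃⟨ ℚᵘ.*≡* refl ⟩
  (i ℚᵘ./ 1) ℚᵘ.* (j ℚᵘ./ 1)             ≃⟨ ℚᵘ.*-cong (ℚᵘ.≃-sym (ℚ.toℚᵘ-fromℚᵘ (i ℚᵘ./ 1))) (ℚᵘ.≃-sym (ℚ.toℚᵘ-fromℚᵘ (j ℚᵘ./ 1))) ⟩
  ℚ.toℚᵘ (i / 1) ℚᵘ.* ℚ.toℚᵘ (j / 1)   ≃⟨ ℚᵘ.≃-sym (ℚ.toℚᵘ-homo-* (i / 1) (j / 1)) ⟩
  ℚ.toℚᵘ ((i / 1) * (j / 1))           ∎)
  where open ℚᵘ.≤-Reasoning

/≡*1/ : ∀ i n → i / suc n ≡ (i / 1) * (1ℤ / suc n)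
/≡*1/ i n = ℚ.toℚᵘ-injective (begin-equality
  ℚ.toℚᵘ (i / suc n)                            ≃⟨ ℚ.toℚᵘ-fromℚᵘ (i ℚᵘ./ suc n) ⟩
  i ℚᵘ./ suc n                                  ≃⟨ ℚᵘ.*≡* (trans (cong (i ℤ.*_) (ℤ.*-identityˡ (+ suc n))) (cong (ℤ._* + suc n) (sym (ℤ.*-identityʳ i)))) ⟩
  (i ℚᵘ./ 1) ℚᵘ.* (1ℤ ℚᵘ./ suc n)               ≃⟨ ℚᵘ.*-cong (ℚᵘ.≃-sym (ℚ.toℚᵘ-fromℚᵘ (i ℚᵘ./ 1))) (ℚᵘ.≃-sym (ℚ.toℚᵘ-fromℚᵘ (1ℤ ℚᵘ./ suc n))) ⟩
  ℚ.toℚᵘ (i / 1) ℚᵘ.* ℚ.toℚᵘ (1ℤ / suc n)       ≃⟨ ℚᵘ.≃-sym (ℚ.toℚᵘ-homo-* (i / 1) (1ℤ / suc n)) ⟩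
  ℚ.toℚᵘ ((i / 1) * (1ℤ / suc n))               ∎)
  where open ℚᵘ.≤-Reasoning

suc-*-1/suc : ∀ n → (+ suc n / 1) * (1ℤ / suc n) ≡ 1ℚ
suc-*-1/suc n = ℚ.toℚᵘ-injective (begin-equality
  ℚ.toℚᵘ ((+ suc n / 1) * (1ℤ / suc n))               ≃⟨ ℚ.toℚᵘ-homo-* (+ suc n / 1) (1ℤ / suc n) ⟩
  ℚ.toℚᵘ (+ suc n / 1) ℚᵘ.* ℚ.toℚᵘ (1ℤ / suc n)       ≃⟨ ℚᵘ.*-cong (ℚ.toℚᵘ-fromℚᵘ (+ suc n ℚᵘ./ 1)) (ℚ.toℚᵘ-fromℚᵘ (1ℤ ℚᵘ./ suc n)) ⟩
  (+ suc n ℚᵘ./ 1) ℚᵘ.* (1ℤ ℚᵘ./ suc n)               ≃⟨ ℚᵘ.*≡* (trans (ℤ.*-identityʳ (+ suc n ℤ.* 1ℤ)) (trans (ℤ.*-identityʳ (+ suc n)) (sym (trans (ℤ.*-identityˡ _) (ℤ.*-identityˡ (+ suc n)))))) ⟩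
  ℚᵘ.1ℚᵘ                                              ∎)
  where open ℚᵘ.≤-Reasoning

-- Opaque, since otherwise unification would normalise the fractions with gcd.
opaque
  ι : ℕ → ℚ
  ι = fromℕ

  ι⁻¹ : ℕ → ℚ
  ι⁻¹ = 1/_

  ι≡fromℕ : ∀ n → ι n ≡ fromℕ n
  ι≡fromℕ n = refl

  ι⁻¹≡1/ : ∀ n → ι⁻¹ n ≡ 1/ n
  ι⁻¹≡1/ n = refl

  ι-zero : ι 0 ≡ 0ℚ
  ι-zero = refl

  ι-one : ι 1 ≡ 1ℚ
  ι-one = refl

  ι⁻¹-one : ι⁻¹ 1 ≡ 1ℚ
  ι⁻¹-one = refl

  ι-+ : ∀ m n → ι (m ℕ.+ n) ≡ ι m + ι n
  ι-+ m n = /1-homo-+ (+ m) (+ n)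

  ι-* : ∀ m n → ι (m ℕ.* n) ≡ ι m * ι n
  ι-* m n = trans (cong (_/ 1) (ℤ.pos-* m n)) (/1-homo-* (+ m) (+ n))

  0≤ι : ∀ n → 0ℚ ≤ ι n
  0≤ι n = ℚ.nonNegative⁻¹ (fromℕ n) {{ℚ.normalize-nonNeg n 1}}

  0<ι : ∀ n .{{_ : NonZero n}} → 0ℚ < ι n
  0<ι n = ℚ.positive⁻¹ (fromℕ n) {{ℚ.normalize-pos n 1}}

  0≤ι⁻¹ : ∀ n → 0ℚ ≤ ι⁻¹ n
  0≤ι⁻¹ zero    = ℚ.≤-refl
  0≤ι⁻¹ (suc n) = ℚ.nonNegative⁻¹ (1/ suc n) {{ℚ.normalize-nonNeg 1 (suc n)}}

  0<ι⁻¹ : ∀ n .{{_ : NonZero n}} → 0ℚ < ι⁻¹ n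
  0<ι⁻¹ (suc n) = ℚ.positive⁻¹ (1/ suc n) {{ℚ.normalize-pos 1 (suc n)}}

  /≡ι*ι⁻¹ : ∀ m n .{{_ : NonZero n}} → + m / n ≡ ι m * ι⁻¹ n
  /≡ι*ι⁻¹ m (suc n) = /≡*1/ (+ m) n

  ι-ι⁻¹ : ∀ n .{{_ : NonZero n}} → ι n * ι⁻¹ n ≡ 1ℚ
  ι-ι⁻¹ (suc n) = suc-*-1/suc n

  archimedean₁ : ∀ q → ∃ λ k → q < ι k
  archimedean₁ q@(ℚ.mkℚ n d-1 _) = suc ℤ.∣ n ∣ , ℚ.toℚᵘ-cancel-< (ℚᵘ.<-respʳ-≃
    (ℚᵘ.≃-sym (ℚ.toℚᵘ-fromℚᵘ (+ suc ℤ.∣ n ∣ ℚᵘ./ 1)))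
    (ℚᵘ.*<* (subst₂ ℤ._<_ (sym (ℤ.*-identityʳ n)) (ℤ.pos-* (suc ℤ.∣ n ∣) (suc d-1))
      (ℤ.≤-<-trans (i≤∣i∣ n) (ℤ.+<+ (ℕ.m≤m*n (suc ℤ.∣ n ∣) (suc d-1)))))))
    where
    i≤∣i∣ : ∀ i → i ℤ.≤ + ℤ.∣ i ∣
    i≤∣i∣ (+ n)      = ℤ.≤-refl
    i≤∣i∣ ℤ.-[1+ n ] = ℤ.-≤+

ι-suc : ∀ n → ι (suc n) ≡ 1ℚ + ι n
ι-suc n = trans (ι-+ 1 n) (cong (_+ ι n) ι-one)

ι-^ : ∀ m n → ι (m ^ n) ≡ ι m ^ℚ n
ι-^ m zero    = ι-one
ι-^ m (suc n) = trans (ι-* m (m ^ n)) (cong (ι m *_) (ι-^ m n))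

ι-mono-≤ : ∀ {m n} → m ℕ.≤ n → ι m ≤ ι n
ι-mono-≤ {m} {n} m≤n = subst (ι m ≤_)
  (trans (sym (ι-+ m (n ∸ m))) (cong ι (ℕ.m+[n∸m]≡n m≤n)))
  (p≤p+q (0≤ι (n ∸ m)))

ι⁻¹-* : ∀ m n .{{_ : NonZero m}} .{{_ : NonZero n}} → ι⁻¹ (m ℕ.* n) ≡ ι⁻¹ m * ι⁻¹ n
ι⁻¹-* m n = *-inverse-unique (0<ι (m ℕ.* n) {{mn}}) (ι-ι⁻¹ (m ℕ.* n) {{mn}}) (begin
  ι (m ℕ.* n) * (ι⁻¹ m * ι⁻¹ n)           ≡⟨ cong (_* (ι⁻¹ m * ι⁻¹ n)) (ι-* m n) ⟩
  ι m * ι n * (ι⁻¹ m * ι⁻¹ n)         ≡⟨ interchange (ι m) (ι n) (ι⁻¹ m) (ι⁻¹ n) ⟩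
  ι m * ι⁻¹ m * (ι n * ι⁻¹ n)         ≡⟨ cong₂ _*_ (ι-ι⁻¹ m) (ι-ι⁻¹ n) ⟩
  1ℚ                                            ∎)
  where
  open ≡-Reasoning
  open ℚ-Solver
  mn = ℕ.m*n≢0 m n
  interchange : ∀ p q r s → p * q * (r * s) ≡ p * r * (q * s)
  interchange = solve 4 (λ p q r s → p :* q :* (r :* s) := p :* r :* (q :* s)) refl

ι⁻¹-^ : ∀ n .{{_ : NonZero n}} m → ι⁻¹ (n ^ m) ≡ ι⁻¹ n ^ℚ m
ι⁻¹-^ n zero    = ι⁻¹-one
ι⁻¹-^ n (suc m) = trans (ι⁻¹-* n (n ^ m) {{it}} {{ℕ.m^n≢0 n m}}) (cong (ι⁻¹ n *_) (ι⁻¹-^ n m))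

ι⁻¹≤1 : ∀ n .{{_ : NonZero n}} → ι⁻¹ n ≤ 1ℚ
ι⁻¹≤1 n = *-cancelˡ-≤ (0<ι n) (subst₂ _≤_ (trans ι-one (sym (ι-ι⁻¹ n))) (sym (ℚ.*-identityʳ (ι n))) (ι-mono-≤ (ℕ.>-nonZero⁻¹ n)))

archimedean : ∀ p {ε} → 0ℚ < ε → ∃ λ k → p < ι k * ε
archimedean p {ε} 0<ε = proj₁ bound , subst (_< ι (proj₁ bound) * ε)
  (trans (ℚ.*-assoc p _ ε) (trans (cong (p *_) (ℚ.*-inverseˡ ε)) (ℚ.*-identityʳ p)))
  (ℚ.*-monoˡ-<-pos ε (proj₂ bound))
  where
  instance
    ε⁺ : ℚ.Positive ε
    ε⁺ = positive 0<ε
    ε≢0 : ℚ.NonZero ε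
    ε≢0 = ℚ.pos⇒nonZero ε
  bound = archimedean₁ (p * ℚ.1/ ε)

n<m^n : ∀ m → 1 ℕ.< m → ∀ n → n ℕ.< m ^ n
n<m^n m 1<m zero    = ℕ.s≤s ℕ.z≤n
n<m^n m 1<m (suc n) = begin-strict
  suc n             ≤⟨ n<m^n m 1<m n ⟩
  m ^ n             <⟨ ℕ.m<m+n (m ^ n) (ℕ.m^n>0 m {{ℕ.>-nonZero (ℕ.<-trans (ℕ.s≤s ℕ.z≤n) 1<m)}} n) ⟩
  m ^ n ℕ.+ m ^ n   ≡⟨ cong (m ^ n ℕ.+_) (ℕ.+-identityʳ (m ^ n)) ⟨
  2 ℕ.* m ^ n       ≤⟨ ℕ.*-monoˡ-≤ (m ^ n) 1<m ⟩
  m ℕ.* m ^ n       ∎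
  where open ℕ.≤-Reasoning

-- Finite sums

∑< : ℕ → (ℕ → ℚ) → ℚ
∑< zero    f = 0ℚ
∑< (suc n) f = f 0 + ∑< n (f ∘ suc)

∑<-cong : ∀ n {f g} → (∀ i → i ℕ.< n → f i ≡ g i) → ∑< n f ≡ ∑< n g
∑<-cong zero    h = refl
∑<-cong (suc n) h = cong₂ _+_ (h 0 (ℕ.s≤s ℕ.z≤n)) (∑<-cong n λ i i<n → h (suc i) (ℕ.s≤s i<n))

∑<-zero : ∀ n → ∑< n (λ _ → 0ℚ) ≡ 0ℚ
∑<-zero zero    = refl
∑<-zero (suc n) = trans (ℚ.+-identityˡ _) (∑<-zero n)

∑<-distrib-+ : ∀ n f g → ∑< n (λ i → f i + g i) ≡ ∑< n f + ∑< n g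
∑<-distrib-+ zero    f g = refl
∑<-distrib-+ (suc n) f g =
  trans (cong (_+_ (f 0 + g 0)) (∑<-distrib-+ n (f ∘ suc) (g ∘ suc))) (interchange (f 0) (g 0) _ _)
  where
  open ℚ-Solver
  interchange : ∀ p q r s → p + q + (r + s) ≡ p + r + (q + s)
  interchange = solve 4 (λ p q r s → p :+ q :+ (r :+ s) := p :+ r :+ (q :+ s)) refl

∑<-distrib-- : ∀ n f g → ∑< n (λ i → f i - g i) ≡ ∑< n f - ∑< n g
∑<-distrib-- zero    f g = refl
∑<-distrib-- (suc n) f g =
  trans (cong (_+_ (f 0 - g 0)) (∑<-distrib-- n (f ∘ suc) (g ∘ suc))) (interchange (f 0) (g 0) _ _)
  where
  open ℚ-Solver
  interchange : ∀ p q r s → p - q + (r - s) ≡ p + r - (q + s)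
  interchange = solve 4 (λ p q r s → p :- q :+ (r :- s) := p :+ r :- (q :+ s)) refl

*-distribˡ-∑< : ∀ n c f → ∑< n (λ i → c * f i) ≡ c * ∑< n f
*-distribˡ-∑< zero    c f = sym (ℚ.*-zeroʳ c)
*-distribˡ-∑< (suc n) c f =
  trans (cong (_+_ (c * f 0)) (*-distribˡ-∑< n c (f ∘ suc))) (sym (ℚ.*-distribˡ-+ c _ _))

∑<-swap : ∀ m n (f : ℕ → ℕ → ℚ) → ∑< m (λ i → ∑< n (f i)) ≡ ∑< n (λ j → ∑< m (λ i → f i j))
∑<-swap zero    n f = sym (∑<-zero n)
∑<-swap (suc m) n f = trans (cong (_+_ (∑< n (f 0))) (∑<-swap m n (f ∘ suc)))
  (sym (∑<-distrib-+ n (f 0) (λ j → ∑< m (λ i → f (suc i) j))))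

∑<-mono-≤ : ∀ n {f g} → (∀ i → i ℕ.< n → f i ≤ g i) → ∑< n f ≤ ∑< n g
∑<-mono-≤ zero    h = ℚ.≤-refl
∑<-mono-≤ (suc n) h = ℚ.+-mono-≤ (h 0 (ℕ.s≤s ℕ.z≤n)) (∑<-mono-≤ n λ i i<n → h (suc i) (ℕ.s≤s i<n))

∑<-nonneg : ∀ n {f} → (∀ i → i ℕ.< n → 0ℚ ≤ f i) → 0ℚ ≤ ∑< n f
∑<-nonneg n {f} h = subst (_≤ ∑< n f) (∑<-zero n) (∑<-mono-≤ n h)

∑<-term : ∀ n {f} → (∀ i → i ℕ.< n → 0ℚ ≤ f i) → ∀ i → i ℕ.< n → f i ≤ ∑< n f
∑<-term (suc n) h zero    _           = p≤p+q (∑<-nonneg n λ i i<n → h (suc i) (ℕ.s≤s i<n))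
∑<-term (suc n) h (suc i) (ℕ.s≤s i<n) =
  ℚ.≤-trans (∑<-term n (λ i i<n → h (suc i) (ℕ.s≤s i<n)) i i<n) (p≤q+p (h 0 (ℕ.s≤s ℕ.z≤n)))

∣∑<∣≤∑<∣∣ : ∀ n f → ∣ ∑< n f ∣ ≤ ∑< n (λ i → ∣ f i ∣)
∣∑<∣≤∑<∣∣ zero    f = ℚ.≤-refl
∣∑<∣≤∑<∣∣ (suc n) f = ℚ.≤-trans (ℚ.∣p+q∣≤∣p∣+∣q∣ (f 0) _) (ℚ.+-monoʳ-≤ ∣ f 0 ∣ (∣∑<∣≤∑<∣∣ n (f ∘ suc)))

∑<-++ : ∀ m n f → ∑< (m ℕ.+ n) f ≡ ∑< m f + ∑< n (λ i → f (m ℕ.+ i))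
∑<-++ zero    n f = sym (ℚ.+-identityˡ _)
∑<-++ (suc m) n f = trans (cong (_+_ (f 0)) (∑<-++ m n (f ∘ suc))) (sym (ℚ.+-assoc (f 0) _ _))

∑<-last : ∀ n f → ∑< (suc n) f ≡ ∑< n f + f n
∑<-last zero    f = ℚ.+-comm (f 0) 0ℚ
∑<-last (suc n) f = trans (cong (_+_ (f 0)) (∑<-last n (f ∘ suc))) (sym (ℚ.+-assoc (f 0) _ _))

∑<-const : ∀ n c → ∑< n (λ _ → c) ≡ ι n * c
∑<-const zero    c = sym (trans (cong (_* c) ι-zero) (ℚ.*-zeroˡ c))
∑<-const (suc n) c = trans (cong (_+_ c) (∑<-const n c)) (sym (trans (cong (_* c) (ι-suc n))
  (trans (ℚ.*-distribʳ-+ c 1ℚ (ι n)) (cong (_+ ι n * c) (ℚ.*-identityˡ c)))))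

∑<-* : ∀ m n f → ∑< (m ℕ.* n) f ≡ ∑< m (λ i → ∑< n (λ j → f (i ℕ.* n ℕ.+ j)))
∑<-* zero    n f = refl
∑<-* (suc m) n f = trans (∑<-++ n (m ℕ.* n) f) (cong (_+_ (∑< n f))
  (trans (∑<-* m n (λ i → f (n ℕ.+ i)))
    (∑<-cong m λ i _ → ∑<-cong n λ j _ → cong f (sym (ℕ.+-assoc n (i ℕ.* n) j)))))

∑<-telescope : ∀ n (f : ℕ → ℚ) → ∑< n (λ i → f (suc i) - f i) ≡ f n - f 0
∑<-telescope zero    f = sym (ℚ.+-inverseʳ (f 0))
∑<-telescope (suc n) f = trans (cong (_+_ (f 1 - f 0)) (∑<-telescope n (f ∘ suc))) (eq (f 1) (f 0) (f (suc n)))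
  where
  open ℚ-Solver
  eq : ∀ p q r → p - q + (r - p) ≡ r - q
  eq = solve 3 (λ p q r → p :- q :+ (r :- p) := r :- q) refl

∑<-if : ∀ n k (f g : ℕ → ℚ) → k ℕ.< n →
  ∑< n (λ i → if does (i ℕ.≟ k) then f i else g i) ≡ f k + ∑< n (λ i → if does (i ℕ.≟ k) then 0ℚ else g i)
∑<-if (suc n) zero    f g _           = cong (_+_ (f 0)) (sym (ℚ.+-identityˡ _))
∑<-if (suc n) (suc k) f g (ℕ.s≤s k<n) = trans (cong (_+_ (g 0)) (∑<-if n k (f ∘ suc) (g ∘ suc) k<n))
  (eq (g 0) (f (suc k)) _)
  where
  open ℚ-Solver
  eq : ∀ p q r → p + (q + r) ≡ q + (p + r)
  eq = solve 3 (λ p q r → p :+ (q :+ r) := q :+ (p :+ r)) refl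

∑-applyUpTo : ∀ (g : ℕ → ℕ) n f → ∑ (applyUpTo g n) f ≡ ∑< n (f ∘ g)
∑-applyUpTo g zero    f = refl
∑-applyUpTo g (suc n) f = cong (_+_ (f (g 0))) (∑-applyUpTo (g ∘ suc) n f)

∑-filter : ∀ {ℓ} {P : Pred ℕ ℓ} (P? : Decidable P) ns f →
  ∑ (filter P? ns) f ≡ ∑ ns (λ n → if does (P? n) then f n else 0ℚ)
∑-filter P? []       f = refl
∑-filter P? (n ∷ ns) f with does (P? n)
... | true  = cong (_+_ (f n)) (∑-filter P? ns f)
... | false = trans (∑-filter P? ns f) (sym (ℚ.+-identityˡ _))

-- Null sequences

Null : (ℕ → ℚ) → Set
Null x = ∀ ε → 0ℚ < ε → ∃ λ N → ∀ n → N ℕ.≤ n → ∣ x n ∣ < ε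

Null-≤ : ∀ {x y} → (∀ n → ∣ x n ∣ ≤ ∣ y n ∣) → Null y → Null x
Null-≤ h y→0 ε 0<ε with y→0 ε 0<ε
... | N , p = N , λ n N≤n → ℚ.≤-<-trans (h n) (p n N≤n)

Null-cong : ∀ {x y} → (∀ n → x n ≡ y n) → Null y → Null x
Null-cong h = Null-≤ (λ n → ℚ.≤-reflexive (cong ∣_∣ (h n)))

Null-zero : Null (λ _ → 0ℚ)
Null-zero ε 0<ε = 0 , λ _ _ → 0<ε

Null-∣∣ : ∀ {x} → Null x → Null (λ n → ∣ x n ∣)
Null-∣∣ {x} = Null-≤ (λ n → ℚ.≤-reflexive (ℚ.∣∣p∣∣≡∣p∣ (x n)))

Null-+ : ∀ {x y} → Null x → Null y → Null (λ n → x n + y n)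
Null-+ {x} {y} x→0 y→0 ε 0<ε with x→0 (½ * ε) (½-pos 0<ε) | y→0 (½ * ε) (½-pos 0<ε)
... | M , p | N , q = M ℕ.+ N , λ n M+N≤n → ℚ.≤-<-trans (ℚ.∣p+q∣≤∣p∣+∣q∣ (x n) (y n))
  (subst (∣ x n ∣ + ∣ y n ∣ <_) (½+½ ε) (ℚ.+-mono-<
    (p n (ℕ.≤-trans (ℕ.m≤m+n M N) M+N≤n)) (q n (ℕ.≤-trans (ℕ.m≤n+m N M) M+N≤n))))

Null-- : ∀ {x y} → Null x → Null y → Null (λ n → x n - y n)
Null-- {x} {y} x→0 y→0 = Null-+ x→0 (Null-≤ (λ n → ℚ.≤-reflexive (ℚ.∣-p∣≡∣p∣ (y n))) y→0)

-- A natural number `K` above `∣ c ∣` is inverted rather than `∣ c ∣` itself, so `c = 0` needs no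
-- separate case.
shrink : ∀ c {ε} → 0ℚ < ε → ∃ λ δ → 0ℚ < δ × ∣ c ∣ * δ ≤ ε
shrink c {ε} 0<ε with archimedean₁ ∣ c ∣
... | k , ∣c∣<k = bounded (suc k)
  (ℚ.≤-trans (ℚ.<⇒≤ ∣c∣<k) (ι-mono-≤ (ℕ.n≤1+n k)))
  where
  bounded : ∀ K .{{_ : NonZero K}} → ∣ c ∣ ≤ ι K → ∃ λ δ → 0ℚ < δ × ∣ c ∣ * δ ≤ ε
  bounded K ∣c∣≤K = ι⁻¹ K * ε , 0<δ , (begin
    ∣ c ∣ * (ι⁻¹ K * ε)      ≤⟨ ℚ.*-monoʳ-≤-nonNeg _ {{nonNegative (ℚ.<⇒≤ 0<δ)}} ∣c∣≤K ⟩
    ι K * (ι⁻¹ K * ε)    ≡⟨ ℚ.*-assoc (ι K) (ι⁻¹ K) ε ⟨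
    ι K * ι⁻¹ K * ε      ≡⟨ cong (_* ε) (ι-ι⁻¹ K) ⟩
    1ℚ * ε                    ≡⟨ ℚ.*-identityˡ ε ⟩
    ε                         ∎)
    where
    open ℚ.≤-Reasoning
    0<δ : 0ℚ < ι⁻¹ K * ε
    0<δ = *-pos (0<ι⁻¹ K) 0<ε

Null-* : ∀ c {x} → Null x → Null (λ n → c * x n)
Null-* c {x} x→0 ε 0<ε with shrink c (½-pos 0<ε)
... | δ , 0<δ , cδ≤ε/2 with x→0 δ 0<δ
... | N , p = N , λ n N≤n → begin-strict
  ∣ c * x n ∣       ≡⟨ ℚ.∣p*q∣≡∣p∣*∣q∣ c (x n) ⟩
  ∣ c ∣ * ∣ x n ∣   ≤⟨ *-monoʳ-≤ (ℚ.0≤∣p∣ c) (ℚ.<⇒≤ (p n N≤n)) ⟩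
  ∣ c ∣ * δ         ≤⟨ cδ≤ε/2 ⟩
  ½ * ε             ≡⟨ ℚ.+-identityʳ (½ * ε) ⟨
  ½ * ε + 0ℚ        <⟨ ℚ.+-monoʳ-< (½ * ε) (½-pos 0<ε) ⟩
  ½ * ε + ½ * ε     ≡⟨ ½+½ ε ⟩
  ε                 ∎
  where open ℚ.≤-Reasoning

Null-∑< : ∀ n {x : ℕ → ℕ → ℚ} → (∀ i → i ℕ.< n → Null (x i)) → Null (λ L → ∑< n (λ i → x i L))
Null-∑< zero    h = Null-zero
Null-∑< (suc n) h = Null-+ (h 0 (ℕ.s≤s ℕ.z≤n)) (Null-∑< n λ i i<n → h (suc i) (ℕ.s≤s i<n))

Null-suc : ∀ {x} → Null x → Null (x ∘ suc)
Null-suc x→0 ε 0<ε with x→0 ε 0<ε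
... | N , p = N , λ n N≤n → p (suc n) (ℕ.m≤n⇒m≤1+n N≤n)

Null-unsuc : ∀ {x} → Null (x ∘ suc) → Null x
Null-unsuc x→0 ε 0<ε with x→0 ε 0<ε
... | N , p = suc N , λ { (suc n) (ℕ.s≤s N≤n) → p n N≤n }

Null-shift : ∀ m {x} → Null x → Null (λ n → x (m ℕ.+ n))
Null-shift m x→0 ε 0<ε with x→0 ε 0<ε
... | N , p = N , λ n N≤n → p (m ℕ.+ n) (ℕ.≤-trans N≤n (ℕ.m≤n+m n m))

Null-ι⁻¹ : Null (λ n → ι⁻¹ (suc n))
Null-ι⁻¹ ε 0<ε with archimedean 1ℚ 0<ε
... | k , 1<kε = k , λ n k≤n → small (suc n) (ℕ.m≤n⇒m≤1+n k≤n)
  where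
  open ℚ.≤-Reasoning
  small : ∀ n .{{_ : NonZero n}} → k ℕ.≤ n → ∣ ι⁻¹ n ∣ < ε
  small n k≤n = subst (_< ε) (sym (ℚ.0≤p⇒∣p∣≡p (0≤ι⁻¹ n)))
    (ℚ.*-cancelˡ-<-nonNeg (ι n) {{nonNegative (0≤ι n)}} (begin-strict
      ι n * ι⁻¹ n  ≡⟨ ι-ι⁻¹ n ⟩
      1ℚ                <⟨ 1<kε ⟩
      ι k * ε       ≤⟨ ℚ.*-monoʳ-≤-nonNeg ε {{nonNegative (ℚ.<⇒≤ 0<ε)}} (ι-mono-≤ k≤n) ⟩
      ι n * ε       ∎))

-- This passes inequalities for truncated sums to their limits: a negative `p` would leave
-- `p + e N < 0` once `∣ e N ∣ < - p`.
0≤x+Null⇒0≤x : ∀ {p e} → Null e → (∀ n → 0ℚ ≤ p + e n) → 0ℚ ≤ p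
0≤x+Null⇒0≤x {p} {e} e→0 h with 0ℚ ℚ.≤? p
... | yes 0≤p = 0≤p
... | no  0≰p with e→0 (- p) (ℚ.neg-antimono-< (ℚ.≰⇒> 0≰p))
...   | N , q = contradiction (ℚ.≤-<-trans (h N) p+e<0) (ℚ.<-irrefl refl)
  where
  p+e<0 : p + e N < 0ℚ
  p+e<0 = subst (p + e N <_) (ℚ.+-inverseʳ p) (ℚ.+-monoʳ-< p (ℚ.≤-<-trans (p≤∣p∣ (e N)) (q N ℕ.≤-refl)))

-- Once ∣ δ ∣ ≤ η from N on, (r + 1 + k) (∣ x (N + k) ∣ - η) is bounded above in k.
contraction : ∀ {r q x δ} → 0ℚ ≤ r → r + 1ℚ ≤ q → (∀ n → q * x (suc n) ≡ r * x n + δ n) → Null δ → Null x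
contraction {r} {q} {x} {δ} 0≤r r+1≤q rec δ→0 ε 0<ε with δ→0 (½ * ε) (½-pos 0<ε)
... | N , ∣δ∣<η with archimedean ((r + 1ℚ) * ∣ x N ∣) (½-pos 0<ε)
... | K , large = N ℕ.+ K , λ n N+K≤n → subst (λ n → ∣ x n ∣ < ε) (ℕ.m+[n∸m]≡n (ℕ.≤-trans (ℕ.m≤m+n N K) N+K≤n))
    (small (n ∸ N) (ℕ.+-cancelˡ-≤ N K (n ∸ N)
      (subst (N ℕ.+ K ℕ.≤_) (sym (ℕ.m+[n∸m]≡n (ℕ.≤-trans (ℕ.m≤m+n N K) N+K≤n))) N+K≤n)))
  where
  open ℚ.≤-Reasoning
  open ℚ-Solver
  η = ½ * ε
  B = (r + 1ℚ) * ∣ x N ∣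

  0<r+1 : 0ℚ < r + 1ℚ
  0<r+1 = ℚ.+-mono-≤-< 0≤r (ℚ.positive⁻¹ 1ℚ)

  y : ℕ → ℚ
  y k = ∣ x (N ℕ.+ k) ∣ - η

  -- Linear weights instead of powers of `(r + 1)/r`: by the Archimedean property they already force
  -- decay, and they make sense for `r = 0`.
  w : ℕ → ℚ
  w k = r + 1ℚ + ι k

  0<w : ∀ k → 0ℚ < w k
  0<w k = ℚ.+-mono-<-≤ 0<r+1 (0≤ι k)

  -- Since `(r + 1) * η = r * η + η`, subtracting `η` from `∣ x n ∣` absorbs the inhomogeneous term.
  step : ∀ n → N ℕ.≤ n → (r + 1ℚ) * (∣ x (suc n) ∣ - η) ≤ r * (∣ x n ∣ - η)
  step n N≤n = begin
    (r + 1ℚ) * (∣ x (suc n) ∣ - η)              ≡⟨ eq₁ r ∣ x (suc n) ∣ η ⟩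
    (r + 1ℚ) * ∣ x (suc n) ∣ - (r * η + η)      ≤⟨ ℚ.+-monoˡ-≤ _ bound ⟩
    r * ∣ x n ∣ + η - (r * η + η)               ≡⟨ eq₂ r ∣ x n ∣ η ⟩
    r * (∣ x n ∣ - η)                           ∎
    where
    eq₁ : ∀ r p η → (r + 1ℚ) * (p - η) ≡ (r + 1ℚ) * p - (r * η + η)
    eq₁ = solve 3 (λ r p η → (r :+ con 1ℚ) :* (p :- η) := (r :+ con 1ℚ) :* p :- (r :* η :+ η)) refl
    eq₂ : ∀ r p η → r * p + η - (r * η + η) ≡ r * (p - η)
    eq₂ = solve 3 (λ r p η → r :* p :+ η :- (r :* η :+ η) := r :* (p :- η)) refl
    bound : (r + 1ℚ) * ∣ x (suc n) ∣ ≤ r * ∣ x n ∣ + η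
    bound = begin
      (r + 1ℚ) * ∣ x (suc n) ∣   ≤⟨ ℚ.*-monoʳ-≤-nonNeg ∣ x (suc n) ∣ {{ℚ.∣-∣-nonNeg (x (suc n))}} r+1≤q ⟩
      q * ∣ x (suc n) ∣          ≡⟨ cong (_* ∣ x (suc n) ∣) (ℚ.0≤p⇒∣p∣≡p (ℚ.≤-trans (ℚ.<⇒≤ 0<r+1) r+1≤q)) ⟨
      ∣ q ∣ * ∣ x (suc n) ∣      ≡⟨ ℚ.∣p*q∣≡∣p∣*∣q∣ q (x (suc n)) ⟨
      ∣ q * x (suc n) ∣          ≡⟨ cong ∣_∣ (rec n) ⟩
      ∣ r * x n + δ n ∣          ≤⟨ ℚ.∣p+q∣≤∣p∣+∣q∣ (r * x n) (δ n) ⟩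
      ∣ r * x n ∣ + ∣ δ n ∣      ≤⟨ ℚ.+-monoʳ-≤ ∣ r * x n ∣ (ℚ.<⇒≤ (∣δ∣<η n N≤n)) ⟩
      ∣ r * x n ∣ + η            ≡⟨ cong (_+ η) (trans (ℚ.∣p*q∣≡∣p∣*∣q∣ r (x n)) (cong (_* ∣ x n ∣) (ℚ.0≤p⇒∣p∣≡p 0≤r))) ⟩
      r * ∣ x n ∣ + η            ∎

  w*y≤B : ∀ k → w k * y k ≤ B
  w*y≤B zero = begin
    w 0 * y 0                        ≡⟨ cong₂ (λ z n → (r + 1ℚ + z) * (∣ x n ∣ - η)) ι-zero (ℕ.+-identityʳ N) ⟩
    (r + 1ℚ + 0ℚ) * (∣ x N ∣ - η)    ≡⟨ eq r ∣ x N ∣ η ⟩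
    B - (r + 1ℚ) * η                 ≤⟨ ℚ.+-monoʳ-≤ B (ℚ.neg-antimono-≤ (*-nonneg (ℚ.<⇒≤ 0<r+1) (ℚ.<⇒≤ (½-pos 0<ε)))) ⟩
    B + 0ℚ                           ≡⟨ ℚ.+-identityʳ B ⟩
    B                                ∎
    where
    eq : ∀ r p η → (r + 1ℚ + 0ℚ) * (p - η) ≡ (r + 1ℚ) * p - (r + 1ℚ) * η
    eq = solve 3 (λ r p η → (r :+ con 1ℚ :+ con 0ℚ) :* (p :- η) := (r :+ con 1ℚ) :* p :- (r :+ con 1ℚ) :* η) refl
  -- The factor `(r + 1) * w k` avoids divisions. Inequalities are multiplied by nonnegative factors
  -- only, so `y k` may have either sign.
  w*y≤B (suc k) = *-cancelˡ-≤ (*-pos 0<r+1 (0<w k)) (begin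
    (r + 1ℚ) * w k * (w (suc k) * y (suc k))    ≡⟨ eq₁ (r + 1ℚ) (w k) (w (suc k)) (y (suc k)) ⟩
    w (suc k) * w k * ((r + 1ℚ) * y (suc k))    ≤⟨ *-monoʳ-≤ (ℚ.<⇒≤ (*-pos (0<w (suc k)) (0<w k)))
                                                      (subst (λ n → (r + 1ℚ) * (∣ x n ∣ - η) ≤ r * y k) (sym (ℕ.+-suc N k))
                                                        (step (N ℕ.+ k) (ℕ.m≤m+n N k))) ⟩
    w (suc k) * w k * (r * y k)                 ≡⟨ eq₂ (w (suc k)) (w k) r (y k) ⟩
    r * w (suc k) * (w k * y k)                 ≤⟨ *-monoʳ-≤ (*-nonneg 0≤r (ℚ.<⇒≤ (0<w (suc k)))) (w*y≤B k) ⟩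
    r * w (suc k) * B                           ≤⟨ ℚ.*-monoʳ-≤-nonNeg B {{nonNegative (*-nonneg (ℚ.<⇒≤ 0<r+1) (ℚ.0≤∣p∣ (x N)))}} weights ⟩
    (r + 1ℚ) * w k * B                          ∎)
    where
    eq₁ : ∀ p q r s → p * q * (r * s) ≡ r * q * (p * s)
    eq₁ = solve 4 (λ p q r s → p :* q :* (r :* s) := r :* q :* (p :* s)) refl
    eq₂ : ∀ p q r s → p * q * (r * s) ≡ r * p * (q * s)
    eq₂ = solve 4 (λ p q r s → p :* q :* (r :* s) := r :* p :* (q :* s)) refl
    eq₃ : ∀ r z → (r + 1ℚ) * (r + 1ℚ + z) ≡ r * (r + 1ℚ + (1ℚ + z)) + (1ℚ + z)
    eq₃ = solve 2 (λ r z → (r :+ con 1ℚ) :* (r :+ con 1ℚ :+ z)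
      := r :* (r :+ con 1ℚ :+ (con 1ℚ :+ z)) :+ (con 1ℚ :+ z)) refl
    weights : r * w (suc k) ≤ (r + 1ℚ) * w k
    weights = subst₂ _≤_ (cong (λ z → r * (r + 1ℚ + z)) (sym (ι-suc k))) (sym (eq₃ r (ι k)))
      (p≤p+q (+-nonneg (ℚ.nonNegative⁻¹ 1ℚ) (0≤ι k)))

  small : ∀ k → K ℕ.≤ k → ∣ x (N ℕ.+ k) ∣ < ε
  small k K≤k = subst₂ _<_ (p-q+q≡p _ η) (½+½ ε) (ℚ.+-monoˡ-< η
    (ℚ.*-cancelˡ-<-nonNeg (w k) {{nonNegative (ℚ.<⇒≤ (0<w k))}} (begin-strict
      w k * y k   ≤⟨ w*y≤B k ⟩
      B           <⟨ large ⟩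
      ι K * η     ≤⟨ ℚ.*-monoʳ-≤-nonNeg η {{nonNegative (ℚ.<⇒≤ (½-pos 0<ε))}}
                       (ℚ.≤-trans (ι-mono-≤ K≤k) (p≤q+p (ℚ.<⇒≤ 0<r+1))) ⟩
      w k * η     ∎)))

-- Convergence of a monotone sequence from a subsequence

-- Monotonicity traps `H n` between `H (ν L₀)` and `H (ν n)`, both close to `T M`. The error `E M`
-- is small for large `M`, whereas `e` depends on `M`; hence the threshold for `n` is chosen after
-- `M`.
squeeze : ∀ {H T E : ℕ → ℚ} (ν : ℕ → ℕ) →
  (∀ {m n} → m ℕ.≤ n → H m ≤ H n) →
  (∀ n → n ℕ.≤ ν n) →
  Null E →
  (∀ M → ∃ λ (e : ℕ → ℚ) → Null e × ∀ L → ∣ H (ν L) - T M ∣ ≤ E M + ∣ e L ∣) →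
  ∀ ε → 0ℚ < ε → ∃ λ M₀ → ∀ M → M₀ ℕ.≤ M → ∃ λ N → ∀ n → N ℕ.≤ n → ∣ H n - T M ∣ < ε
squeeze {H} {T} {E} ν mono ν≥ E→0 approx ε 0<ε with E→0 (½ * ε) (½-pos 0<ε)
... | M₀ , E<ε/2 = M₀ , λ M M₀≤M → close M (E<ε/2 M M₀≤M)
  where
  open ℚ-Solver
  neg-diff : ∀ p q → - (p - q) ≡ q - p
  neg-diff = solve 2 (λ p q → :- (p :- q) := q :- p) refl
  close : ∀ M → ∣ E M ∣ < ½ * ε → ∃ λ N → ∀ n → N ℕ.≤ n → ∣ H n - T M ∣ < ε
  close M E<ε/2 with approx M
  ... | e , e→0 , bound with e→0 (½ * ε) (½-pos 0<ε)
  ... | L₀ , e<ε/2 = ν L₀ , λ n νL₀≤n → ∣p∣<q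
    (ℚ.≤-<-trans (ℚ.+-monoˡ-≤ (- T M) (mono (ν≥ n)))
      (ℚ.≤-<-trans (p≤∣p∣ _) (near n (ℕ.≤-trans (ν≥ L₀) νL₀≤n))))
    (ℚ.≤-<-trans (subst₂ _≤_ (sym (neg-diff (H n) (T M))) (sym (neg-diff (H (ν L₀)) (T M)))
        (ℚ.+-monoʳ-≤ (T M) (ℚ.neg-antimono-≤ (mono νL₀≤n))))
      (ℚ.≤-<-trans (-p≤∣p∣ _) (near L₀ ℕ.≤-refl)))
    where
    near : ∀ L → L₀ ℕ.≤ L → ∣ H (ν L) - T M ∣ < ε
    near L L₀≤L = ℚ.≤-<-trans (bound L) (subst (E M + ∣ e L ∣ <_) (½+½ ε)
      (ℚ.+-mono-< (ℚ.≤-<-trans (p≤∣p∣ (E M)) E<ε/2) (e<ε/2 L L₀≤L)))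

module _ {H T : ℕ → ℚ}
  (close : ∀ ε → 0ℚ < ε → ∃ λ M₀ → ∀ M → M₀ ℕ.≤ M → ∃ λ N → ∀ n → N ℕ.≤ n → ∣ H n - T M ∣ < ε)
  where

  private
    via : ∀ {ε} p r q → ∣ p - r ∣ < ½ * ε → ∣ r - q ∣ < ½ * ε → ∣ p - q ∣ < ε
    via {ε} p r q h h′ = ℚ.≤-<-trans (∣-∣-triangle p r q)
      (subst (∣ p - r ∣ + ∣ r - q ∣ <_) (½+½ ε) (ℚ.+-mono-< h h′))

    flip-∣-∣ : ∀ {ε} p q → ∣ p - q ∣ < ε → ∣ q - p ∣ < ε
    flip-∣-∣ {ε} p q = subst (_< ε) (∣p-q∣≡∣q-p∣ p q)

  -- `T M₀` for one large `M₀` is a common neighbour of all late `H n`; no limit of either sequence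
  -- is presupposed.
  close⇒cauchyˡ : IsCauchy H
  close⇒cauchyˡ ε 0<ε with close (½ * ε) (½-pos 0<ε)
  ... | M₀ , c with c M₀ ℕ.≤-refl
  ... | N , h = N , λ m n N≤m N≤n →
    via (H m) (T M₀) (H n) (h m N≤m) (flip-∣-∣ (H n) (T M₀) (h n N≤n))

  -- `T m` and `T n` are compared with one and the same `H i`, with `i` beyond both thresholds,
  -- which depend on `m` and `n`.
  close⇒cauchyʳ : IsCauchy T
  close⇒cauchyʳ ε 0<ε with close (½ * ε) (½-pos 0<ε)
  ... | M₀ , c = M₀ , λ m n M₀≤m M₀≤n → pair m n (c m M₀≤m) (c n M₀≤n)
    where
    pair : ∀ m n → (∃ λ N → ∀ i → N ℕ.≤ i → ∣ H i - T m ∣ < ½ * ε) →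
      (∃ λ N → ∀ i → N ℕ.≤ i → ∣ H i - T n ∣ < ½ * ε) → ∣ T m - T n ∣ < ε
    pair m n (N , h) (N′ , h′) = via (T m) (H (N ℕ.+ N′)) (T n)
      (flip-∣-∣ (H (N ℕ.+ N′)) (T m) (h _ (ℕ.m≤m+n N N′))) (h′ _ (ℕ.m≤n+m N′ N))

  close⇒≃ : ∀ ε → 0ℚ < ε → ∃ λ N → ∀ n → N ℕ.≤ n → ∣ H n - T n ∣ < ε
  close⇒≃ ε 0<ε = combine (close (½ * ε) (½-pos 0<ε)) (close⇒cauchyʳ (½ * ε) (½-pos 0<ε))
    where
    combine : (∃ λ M₀ → ∀ M → M₀ ℕ.≤ M → ∃ λ N → ∀ n → N ℕ.≤ n → ∣ H n - T M ∣ < ½ * ε) →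
      (∃ λ M₁ → ∀ m n → M₁ ℕ.≤ m → M₁ ℕ.≤ n → ∣ T m - T n ∣ < ½ * ε) →
      ∃ λ N → ∀ n → N ℕ.≤ n → ∣ H n - T n ∣ < ε
    combine (M₀ , c) (M₁ , c′) = N ℕ.+ M , λ n N+M≤n → via (H n) (T M) (T n)
      (h n (ℕ.≤-trans (ℕ.m≤m+n N M) N+M≤n))
      (c′ M n M₁≤M (ℕ.≤-trans M₁≤M (ℕ.≤-trans (ℕ.m≤n+m M N) N+M≤n)))
      where
      M = M₀ ℕ.+ M₁
      M₁≤M = ℕ.m≤n+m M₁ M₀
      N = proj₁ (c M (ℕ.m≤m+n M₀ M₁))
      h = proj₂ (c M (ℕ.m≤m+n M₀ M₁))

cauchy-cancel-+ : ∀ c {x} → IsCauchy (λ n → c + x n) → IsCauchy x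
cauchy-cancel-+ c {x} cauchy ε 0<ε with cauchy ε 0<ε
... | N , p = N , λ m n N≤m N≤n → subst (λ z → ∣ z ∣ < ε) (eq c (x m) (x n)) (p m n N≤m N≤n)
  where
  open ℚ-Solver
  eq : ∀ c p q → (c + p) - (c + q) ≡ p - q
  eq = solve 3 (λ c p q → (c :+ p) :- (c :+ q) := p :- q) refl

-- Binomial sums

private
  ℚ-commutativeSemiring = CommutativeRing.commutativeSemiring ℚ.+-*-commutativeRing

module Binomial = Algebra.Properties.CommutativeSemiring.Binomial ℚ-commutativeSemiring
module Exp = Algebra.Properties.CommutativeSemiring.Exp ℚ-commutativeSemiring

open import Algebra.Definitions.RawMonoid ℚ.+-0-rawMonoid using () renaming (sum to sumFin; _×_ to _·_)

-- Multiplied by `i ! * (m ∸ i) !`, both sides become (m+1)!.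
[m+1]*mCi≡[m+1-i]*[m+1]Ci : ∀ {m i} → i ℕ.≤ m → suc m ℕ.* (m C i) ≡ suc (m ∸ i) ℕ.* (suc m C i)
[m+1]*mCi≡[m+1-i]*[m+1]Ci {m} {i} i≤m =
  ℕ.*-cancelʳ-≡ _ _ (i ! ℕ.* (m ∸ i) !) {{ℕ.m*n≢0 (i !) ((m ∸ i) !) {{i ℕ.!≢0}} {{(m ∸ i) ℕ.!≢0}}}} (begin
    suc m ℕ.* (m C i) ℕ.* (i ! ℕ.* (m ∸ i) !)                   ≡⟨ ℕ.*-assoc (suc m) (m C i) _ ⟩
    suc m ℕ.* ((m C i) ℕ.* (i ! ℕ.* (m ∸ i) !))                 ≡⟨ cong (suc m ℕ.*_) (nCk*k![n-k]! i≤m) ⟩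
    suc m !                                                     ≡⟨ nCk*k![n-k]! (ℕ.m≤n⇒m≤1+n i≤m) ⟨
    (suc m C i) ℕ.* (i ! ℕ.* (suc m ∸ i) !)                     ≡⟨ cong (λ z → (suc m C i) ℕ.* (i ! ℕ.* z !)) (ℕ.+-∸-assoc 1 i≤m) ⟩
    (suc m C i) ℕ.* (i ! ℕ.* (suc (m ∸ i) ℕ.* (m ∸ i) !))       ≡⟨ rearrange (suc m C i) (i !) (suc (m ∸ i)) ((m ∸ i) !) ⟩
    suc (m ∸ i) ℕ.* (suc m C i) ℕ.* (i ! ℕ.* (m ∸ i) !)         ∎)
  where
  open ≡-Reasoning
  nCk*k![n-k]! : ∀ {n k} → k ℕ.≤ n → (n C k) ℕ.* (k ! ℕ.* (n ∸ k) !) ≡ n !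
  nCk*k![n-k]! {n} {k} k≤n =
    trans (cong (ℕ._* (k ! ℕ.* (n ∸ k) !)) (nCk≡n!/k![n-k]! k≤n)) (m/n*n≡m (k![n∸k]!∣n! k≤n))
    where instance _ = ℕ.m*n≢0 (k !) ((n ∸ k) !) {{k ℕ.!≢0}} {{(n ∸ k) ℕ.!≢0}}
  rearrange : ∀ p q r s → p ℕ.* (q ℕ.* (r ℕ.* s)) ≡ r ℕ.* p ℕ.* (q ℕ.* s)
  rearrange = solve 4 (λ p q r s → p :* (q :* (r :* s)) := r :* p :* (q :* s)) refl
    where open ℕ-Solver

-- The form needed to integrate `(a + x)^m` over [0, 1] term by term, where `x^(m-i)` contributes
-- `1/(m-i+1)`.
[m+1-i]⁻¹*mCi : ∀ {m i} → i ℕ.≤ m → ι (m C i) * ι⁻¹ (suc (m ∸ i)) ≡ ι⁻¹ (suc m) * ι (suc m C i)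
[m+1-i]⁻¹*mCi {m} {i} i≤m = cross (ι (suc m)) (ι⁻¹ (suc m)) (ι (m C i)) (ι (suc (m ∸ i))) (ι⁻¹ (suc (m ∸ i))) (ι (suc m C i))
  (ι-ι⁻¹ (suc m)) (ι-ι⁻¹ (suc (m ∸ i)))
  (trans (sym (ι-* (suc m) (m C i))) (trans (cong ι ([m+1]*mCi≡[m+1-i]*[m+1]Ci i≤m)) (ι-* (suc (m ∸ i)) (suc m C i))))
  where
  open ℚ-Solver
  cross : ∀ p p′ q r r′ s → p * p′ ≡ 1ℚ → r * r′ ≡ 1ℚ → p * q ≡ r * s → q * r′ ≡ p′ * s
  cross p p′ q r r′ s pp′ rr′ eq = begin
    q * r′                ≡⟨ ℚ.*-identityˡ (q * r′) ⟨
    1ℚ * (q * r′)         ≡⟨ cong (_* (q * r′)) pp′ ⟨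
    p * p′ * (q * r′)     ≡⟨ eq₁ p p′ q r′ ⟩
    p * q * (p′ * r′)     ≡⟨ cong (_* (p′ * r′)) eq ⟩
    r * s * (p′ * r′)     ≡⟨ eq₂ r s p′ r′ ⟩
    r * r′ * (p′ * s)     ≡⟨ cong (_* (p′ * s)) rr′ ⟩
    1ℚ * (p′ * s)         ≡⟨ ℚ.*-identityˡ (p′ * s) ⟩
    p′ * s                ∎
    where
    open ≡-Reasoning
    eq₁ : ∀ p q r s → p * q * (r * s) ≡ p * r * (q * s)
    eq₁ = solve 4 (λ p q r s → p :* q :* (r :* s) := p :* r :* (q :* s)) refl
    eq₂ : ∀ p q r s → p * q * (r * s) ≡ p * s * (r * q)
    eq₂ = solve 4 (λ p q r s → p :* q :* (r :* s) := p :* s :* (r :* q)) refl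

sumFin≡∑< : ∀ n f → sumFin {n} (f ∘ toℕ) ≡ ∑< n f
sumFin≡∑< zero    f = refl
sumFin≡∑< (suc n) f = cong (_+_ (f 0)) (sumFin≡∑< n (f ∘ suc))

·≡ι* : ∀ n p → n · p ≡ ι n * p
·≡ι* zero    p = sym (trans (cong (_* p) ι-zero) (ℚ.*-zeroˡ p))
·≡ι* (suc n) p = trans (cong (_+_ p) (·≡ι* n p)) (sym (trans (cong (_* p) (ι-suc n))
  (trans (ℚ.*-distribʳ-+ p 1ℚ (ι n)) (cong (_+ ι n * p) (ℚ.*-identityˡ p)))))

-- If x is the moment sequence of a measure, then moments a x is the
-- moment sequence of its translate by a.
moments : ℕ → (ℕ → ℚ) → ℕ → ℚ
moments a x m = ∑< (suc m) (λ i → ι ((m C i) ℕ.* a ^ i) * x (m ∸ i))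

binomial : ∀ a p m → (ι a + p) ^ℚ m ≡ moments a (p ^ℚ_) m
binomial a p m = begin
  (ι a + p) ^ℚ m                                                       ≡⟨ Binomial.theorem m (ι a) p ⟩
  sumFin {suc m} (λ i → (m C toℕ i) · (ι a ^ℚ toℕ i * p ^ℚ (m ∸ toℕ i))) ≡⟨ sumFin≡∑< (suc m) (λ i → (m C i) · (ι a ^ℚ i * p ^ℚ (m ∸ i))) ⟩
  ∑< (suc m) (λ i → (m C i) · (ι a ^ℚ i * p ^ℚ (m ∸ i)))               ≡⟨ ∑<-cong (suc m) (λ i _ → term i) ⟩
  moments a (p ^ℚ_) m                                                  ∎
  where
  open ≡-Reasoning
  term : ∀ i → (m C i) · (ι a ^ℚ i * p ^ℚ (m ∸ i)) ≡ ι ((m C i) ℕ.* a ^ i) * p ^ℚ (m ∸ i)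
  term i = trans (·≡ι* (m C i) _) (trans (sym (ℚ.*-assoc (ι (m C i)) _ _))
    (cong (_* p ^ℚ (m ∸ i)) (sym (trans (ι-* (m C i) (a ^ i)) (cong (ι (m C i) *_) (ι-^ a i))))))

moments-cong : ∀ a {x y} m → (∀ i → i ℕ.≤ m → x i ≡ y i) → moments a x m ≡ moments a y m
moments-cong a m h = ∑<-cong (suc m) λ i _ → cong (ι ((m C i) ℕ.* a ^ i) *_) (h (m ∸ i) (ℕ.m∸n≤m m i))

moments-zero : ∀ a m → moments a (λ _ → 0ℚ) m ≡ 0ℚ
moments-zero a m = trans (∑<-cong (suc m) λ i _ → ℚ.*-zeroʳ (ι ((m C i) ℕ.* a ^ i))) (∑<-zero (suc m))

moments-- : ∀ a x y m → moments a (λ i → x i - y i) m ≡ moments a x m - moments a y m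
moments-- a x y m = trans (∑<-cong (suc m) λ i _ → p*[q-r]≡p*q-p*r (ι ((m C i) ℕ.* a ^ i)) (x (m ∸ i)) (y (m ∸ i)))
  (∑<-distrib-- (suc m) (λ i → ι ((m C i) ℕ.* a ^ i) * x (m ∸ i)) (λ i → ι ((m C i) ℕ.* a ^ i) * y (m ∸ i)))

moments-nonneg : ∀ a {x} m → (∀ i → i ℕ.≤ m → 0ℚ ≤ x i) → 0ℚ ≤ moments a x m
moments-nonneg a m h = ∑<-nonneg (suc m) λ i _ → *-nonneg (0≤ι ((m C i) ℕ.* a ^ i)) (h (m ∸ i) (ℕ.m∸n≤m m i))

moments-term : ∀ a {x} m → (∀ i → i ℕ.≤ m → 0ℚ ≤ x i) → ∀ i → i ℕ.≤ m →
  ι ((m C i) ℕ.* a ^ i) * x (m ∸ i) ≤ moments a x m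
moments-term a m h i i≤m = ∑<-term (suc m)
  (λ i _ → *-nonneg (0≤ι ((m C i) ℕ.* a ^ i)) (h (m ∸ i) (ℕ.m∸n≤m m i))) i (ℕ.s≤s i≤m)

-- The binomial theorem for `(a + 1)^(m+1)`, with its last term moved across.
∑<-C : ∀ a m → ∑< (suc m) (λ i → ι ((suc m C i) ℕ.* a ^ i)) ≡ ι (suc a ^ suc m) - ι (a ^ suc m)
∑<-C a m = p+q≡r⇒p≡r-q (begin
  ∑< (suc m) (λ i → ι ((suc m C i) ℕ.* a ^ i)) + ι (a ^ suc m)             ≡⟨ cong (λ z → ∑< (suc m) (λ i → ι ((suc m C i) ℕ.* a ^ i)) + ι z) last-term ⟨
  ∑< (suc m) (λ i → ι ((suc m C i) ℕ.* a ^ i)) + ι ((suc m C suc m) ℕ.* a ^ suc m) ≡⟨ ∑<-last (suc m) (λ i → ι ((suc m C i) ℕ.* a ^ i)) ⟨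
  ∑< (suc (suc m)) (λ i → ι ((suc m C i) ℕ.* a ^ i))                       ≡⟨ ∑<-cong (suc (suc m)) (λ i _ → sym (trans (cong (ι ((suc m C i) ℕ.* a ^ i) *_) (1ℚ^≡1ℚ (suc m ∸ i))) (ℚ.*-identityʳ (ι ((suc m C i) ℕ.* a ^ i))))) ⟩
  moments a (1ℚ ^ℚ_) (suc m)                                               ≡⟨ binomial a 1ℚ (suc m) ⟨
  (ι a + 1ℚ) ^ℚ suc m                                                      ≡⟨ cong (_^ℚ suc m) (trans (ℚ.+-comm (ι a) 1ℚ) (sym (ι-suc a))) ⟩
  ι (suc a) ^ℚ suc m                                                       ≡⟨ ι-^ (suc a) (suc m) ⟨
  ι (suc a ^ suc m)                                                        ∎)
  where
  open ≡-Reasoning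
  last-term : (suc m C suc m) ℕ.* a ^ suc m ≡ a ^ suc m
  last-term = trans (cong (ℕ._* a ^ suc m) (nCn≡1 (suc m))) (ℕ.*-identityˡ _)

-- The recursion and its coefficients

module Rows (b : ℕ) .{{_ : NonTrivial b}} (d : Fin b) where

  open Irwin b d

  1<b : 1 ℕ.< b
  1<b = nonTrivial⇒n>1 b

  instance
    b≢0 : NonZero b
    b≢0 = nonTrivial⇒nonZero b

  0<bᵐ : ∀ m → 0ℚ < ι (b ^ m)
  0<bᵐ m = 0<ι (b ^ m) {{ℕ.m^n≢0 b m}}

  d<b : toℕ d ℕ.< b
  d<b = Fin.toℕ<n d

  -- The row to which the rest of a string belongs once its first digit `a` is split off. `pred`
  -- makes row 0 absorbing.
  _⊖_ : ℕ → ℕ → ℕ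
  p ⊖ a = if does (a ℕ.≟ toℕ d) then ℕ.pred p else p

  coeff+b : ∀ m → coeff m + ι b ≡ ι (b ^ suc m) + 1ℚ
  coeff+b m = begin
    coeff m + ι b                                 ≡⟨ cong (_+_ (coeff m)) (ι≡fromℕ b) ⟩
    coeff m + (+ b / 1)                           ≡⟨ /1-homo-+ (+ (b ^ suc m) ℤ.- + b ℤ.+ 1ℤ) (+ b) ⟨
    (+ (b ^ suc m) ℤ.- + b ℤ.+ 1ℤ ℤ.+ + b) / 1    ≡⟨ cong (_/ 1) (eq (+ (b ^ suc m)) (+ b)) ⟩
    (+ (b ^ suc m) ℤ.+ 1ℤ) / 1                    ≡⟨ /1-homo-+ (+ (b ^ suc m)) 1ℤ ⟩
    fromℕ (b ^ suc m) + 1ℚ                        ≡⟨ cong (_+ 1ℚ) (ι≡fromℕ (b ^ suc m)) ⟨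
    ι (b ^ suc m) + 1ℚ                            ∎
    where
    open ≡-Reasoning
    eq : ∀ i j → i ℤ.- j ℤ.+ 1ℤ ℤ.+ j ≡ i ℤ.+ 1ℤ
    eq = solve 2 (λ i j → i :- j :+ con 1ℤ :+ j := i :+ con 1ℤ) refl
      where open ℤ-Solver

  -- Besides positivity, this gives the margin that `contraction` requires with `r = 1`. It rests on
  -- `b^(m+2) ≥ 2b ≥ b + 1`.
  coeff-suc≥2 : ∀ m → 1ℚ + 1ℚ ≤ coeff (suc m)
  coeff-suc≥2 m = 0≤q-p⇒p≤q (subst (0ℚ ≤_) eq (p≤q⇒0≤q-p b+1≤bᵐ))
    where
    open ℚ-Solver
    b+1≤bᵐ : ι (suc b) ≤ ι (b ^ suc (suc m))
    b+1≤bᵐ = ι-mono-≤ (begin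
      suc b             ≤⟨ ℕ.+-monoˡ-≤ b (ℕ.<⇒≤ 1<b) ⟩
      b ℕ.+ b           ≡⟨ cong (b ℕ.+_) (ℕ.+-identityʳ b) ⟨
      2 ℕ.* b           ≤⟨ ℕ.*-monoˡ-≤ b 1<b ⟩
      b ℕ.* b           ≤⟨ ℕ.*-monoʳ-≤ b (ℕ.m≤m*n b (b ^ m) {{ℕ.m^n≢0 b m}}) ⟩
      b ^ suc (suc m)   ∎)
      where open ℕ.≤-Reasoning
    shift : ∀ β z → z - (1ℚ + β) ≡ (z + 1ℚ) - β - (1ℚ + 1ℚ)
    shift = solve 2 (λ β z → z :- (con 1ℚ :+ β) := (z :+ con 1ℚ) :- β :- (con 1ℚ :+ con 1ℚ)) refl
    unshift : ∀ c β → c + β - β - (1ℚ + 1ℚ) ≡ c - (1ℚ + 1ℚ)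
    unshift = solve 2 (λ c β → c :+ β :- β :- (con 1ℚ :+ con 1ℚ) := c :- (con 1ℚ :+ con 1ℚ)) refl
    eq : ι (b ^ suc (suc m)) - ι (suc b) ≡ coeff (suc m) - (1ℚ + 1ℚ)
    eq = trans (cong (λ z → ι (b ^ suc (suc m)) - z) (ι-suc b))
      (trans (shift (ι b) (ι (b ^ suc (suc m))))
        (trans (cong (λ z → z - ι b - (1ℚ + 1ℚ)) (sym (coeff+b (suc m)))) (unshift (coeff (suc m)) (ι b))))

  0<coeff : ∀ m → 0ℚ < coeff (suc m)
  0<coeff m = ℚ.<-≤-trans (ℚ.positive⁻¹ (1ℚ + 1ℚ)) (coeff-suc≥2 m)

  -- The part of the sum over first digits other than `d` that involves lower moments only. The
  -- `i = 0` term, `γ 0 * x m`, is kept apart because it belongs to the left side of the recursion.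
  others : (ℕ → ℚ) → ℕ → ℚ
  others x m = ∑< m (λ i → ι ((m C suc i) ℕ.* γ (suc i)) * x (m ∸ suc i))

  ι-γ : ∀ i → ι (γ i) ≡ ∑< b (λ a → if does (a ℕ.≟ toℕ d) then 0ℚ else ι (a ^ i))
  ι-γ i = begin
    ι (γ i)                                                               ≡⟨ ι-sum (filter _ (upTo b)) ⟩
    ∑ (filter _ (upTo b)) (λ a → ι (a ^ i))                               ≡⟨ ∑-filter _ (upTo b) _ ⟩
    ∑ (upTo b) (λ a → if not (does (a ℕ.≟ toℕ d)) then ι (a ^ i) else 0ℚ) ≡⟨ ∑-applyUpTo (λ a → a) b _ ⟩
    ∑< b (λ a → if not (does (a ℕ.≟ toℕ d)) then ι (a ^ i) else 0ℚ)       ≡⟨ ∑<-cong b (λ a _ → if-not (does (a ℕ.≟ toℕ d)) (ι (a ^ i)) 0ℚ) ⟩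
    ∑< b (λ a → if does (a ℕ.≟ toℕ d) then 0ℚ else ι (a ^ i))             ∎
    where
    open ≡-Reasoning
    ι-sum : ∀ ns → ι (sum (map (_^ i) ns)) ≡ ∑ ns (λ a → ι (a ^ i))
    ι-sum []       = ι-zero
    ι-sum (n ∷ ns) = trans (ι-+ (n ^ i) _) (cong (_+_ (ι (n ^ i))) (ι-sum ns))
    if-not : ∀ c (p q : ℚ) → (if not c then p else q) ≡ (if c then q else p)
    if-not true  p q = refl
    if-not false p q = refl

  -- Zeroth powers are 1, also for the digit 0, so `γ 0` counts the digits other than `d`.
  1+ι-γ₀ : 1ℚ + ι (γ 0) ≡ ι b
  1+ι-γ₀ = begin
    1ℚ + ι (γ 0)                                                       ≡⟨ cong (_+_ 1ℚ) (trans (ι-γ 0) (∑<-cong b λ a _ → cong (if does (a ℕ.≟ toℕ d) then 0ℚ else_) ι-one)) ⟩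
    1ℚ + ∑< b (λ a → if does (a ℕ.≟ toℕ d) then 0ℚ else 1ℚ)            ≡⟨ ∑<-if b (toℕ d) (λ _ → 1ℚ) (λ _ → 1ℚ) d<b ⟨
    ∑< b (λ a → if does (a ℕ.≟ toℕ d) then 1ℚ else 1ℚ)                 ≡⟨ ∑<-cong b (λ a _ → if-const (does (a ℕ.≟ toℕ d))) ⟩
    ∑< b (λ _ → 1ℚ)                                                    ≡⟨ trans (∑<-const b 1ℚ) (ℚ.*-identityʳ (ι b)) ⟩
    ι b                                                                ∎
    where
    open ≡-Reasoning
    if-const : ∀ c → (if c then 1ℚ else 1ℚ) ≡ 1ℚ
    if-const true  = refl
    if-const false = refl

  ∑-moments-≢d : ∀ x m → ∑< b (λ a → if does (a ℕ.≟ toℕ d) then 0ℚ else moments a x m) ≡ ι (γ 0) * x m + others x m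
  ∑-moments-≢d x m = begin
    ∑< b (λ a → if c a then 0ℚ else moments a x m)                                        ≡⟨ ∑<-cong b (λ a _ → if-∑< (c a) (suc m) (λ i → ι ((m C i) ℕ.* a ^ i) * x (m ∸ i))) ⟩
    ∑< b (λ a → ∑< (suc m) (λ i → if c a then 0ℚ else ι ((m C i) ℕ.* a ^ i) * x (m ∸ i))) ≡⟨ ∑<-swap b (suc m) (λ a i → if c a then 0ℚ else ι ((m C i) ℕ.* a ^ i) * x (m ∸ i)) ⟩
    ∑< (suc m) (λ i → ∑< b (λ a → if c a then 0ℚ else ι ((m C i) ℕ.* a ^ i) * x (m ∸ i))) ≡⟨ ∑<-cong (suc m) (λ i _ → inner i) ⟩
    ι ((m C 0) ℕ.* γ 0) * x m + others x m                                                ≡⟨ cong (λ z → ι z * x m + others x m) (ℕ.*-identityˡ (γ 0)) ⟩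
    ι (γ 0) * x m + others x m                                                            ∎
    where
    open ≡-Reasoning
    c : ℕ → Bool
    c a = does (a ℕ.≟ toℕ d)
    if-∑< : ∀ c n f → (if c then 0ℚ else ∑< n f) ≡ ∑< n (λ i → if c then 0ℚ else f i)
    if-∑< true  n f = sym (∑<-zero n)
    if-∑< false n f = refl
    pull : ∀ c k a y → (if c then 0ℚ else ι (k ℕ.* a) * y) ≡ ι k * y * (if c then 0ℚ else ι a)
    pull true  k a y = sym (ℚ.*-zeroʳ (ι k * y))
    pull false k a y = trans (cong (_* y) (ι-* k a)) (eq (ι k) (ι a) y)
      where
      open ℚ-Solver
      eq : ∀ p q r → p * q * r ≡ p * r * q
      eq = solve 3 (λ p q r → p :* q :* r := p :* r :* q) refl
    inner : ∀ i → ∑< b (λ a → if c a then 0ℚ else ι ((m C i) ℕ.* a ^ i) * x (m ∸ i)) ≡ ι ((m C i) ℕ.* γ i) * x (m ∸ i)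
    inner i = begin
      ∑< b (λ a → if c a then 0ℚ else ι ((m C i) ℕ.* a ^ i) * x (m ∸ i))  ≡⟨ ∑<-cong b (λ a _ → pull (c a) (m C i) (a ^ i) (x (m ∸ i))) ⟩
      ∑< b (λ a → ι (m C i) * x (m ∸ i) * (if c a then 0ℚ else ι (a ^ i)))  ≡⟨ *-distribˡ-∑< b (ι (m C i) * x (m ∸ i)) _ ⟩
      ι (m C i) * x (m ∸ i) * ∑< b (λ a → if c a then 0ℚ else ι (a ^ i))    ≡⟨ cong (ι (m C i) * x (m ∸ i) *_) (ι-γ i) ⟨
      ι (m C i) * x (m ∸ i) * ι (γ i)                                       ≡⟨ pull false (m C i) (γ i) (x (m ∸ i)) ⟨
      ι ((m C i) ℕ.* γ i) * x (m ∸ i)                                       ∎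

  -- The sum in every first-digit equation: the digit `d` leads to row `p`, every other digit stays
  -- in row `suc p`. Splitting off `γ 0 * z (suc p) m` exposes the right side of the recursion.
  ∑-moments : ∀ (z : ℕ → ℕ → ℚ) p m →
    ∑< b (λ a → moments a (z (suc p ⊖ a)) m) ≡ ι (γ 0) * z (suc p) m + (others (z (suc p)) m + moments (toℕ d) (z p) m)
  ∑-moments z p m = begin
    ∑< b (λ a → moments a (z (suc p ⊖ a)) m)                              ≡⟨ ∑<-cong b (λ a _ → float (does (a ℕ.≟ toℕ d)) a) ⟩
    ∑< b (λ a → if does (a ℕ.≟ toℕ d) then moments a (z p) m else moments a (z (suc p)) m)
                                                                          ≡⟨ ∑<-if b (toℕ d) _ _ d<b ⟩
    moments (toℕ d) (z p) m + ∑< b (λ a → if does (a ℕ.≟ toℕ d) then 0ℚ else moments a (z (suc p)) m)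
                                                                          ≡⟨ cong (_+_ (moments (toℕ d) (z p) m)) (∑-moments-≢d (z (suc p)) m) ⟩
    moments (toℕ d) (z p) m + (ι (γ 0) * z (suc p) m + others (z (suc p)) m)  ≡⟨ eq (moments (toℕ d) (z p) m) (ι (γ 0) * z (suc p) m) _ ⟩
    ι (γ 0) * z (suc p) m + (others (z (suc p)) m + moments (toℕ d) (z p) m)  ∎
    where
    open ≡-Reasoning
    open ℚ-Solver
    eq : ∀ p q r → p + (q + r) ≡ q + (r + p)
    eq = solve 3 (λ p q r → p :+ (q :+ r) := q :+ (r :+ p)) refl
    float : ∀ c a → moments a (z (if c then p else suc p)) m ≡ (if c then moments a (z p) m else moments a (z (suc p)) m)
    float true  a = refl
    float false a = refl

  -- The origin of the coefficient: `b^(m+1)` comes from shifting the radix point, `γ 0 = b - 1`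
  -- from the `i = 0` terms moved to the left.
  coeff≡ : ∀ m → coeff m ≡ ι (b ^ suc m) - ι (γ 0)
  coeff≡ m = trans (sym (unshift (coeff m) (ι (γ 0)))) (trans (cong (λ z → coeff m + z - (1ℚ + ι (γ 0))) (1+ι-γ₀))
    (trans (cong₂ (λ y z → y - z) (coeff+b m) refl) (shift (ι (b ^ suc m)) (ι (γ 0)))))
    where
    open ℚ-Solver
    unshift : ∀ c g → c + (1ℚ + g) - (1ℚ + g) ≡ c
    unshift = solve 2 (λ c g → c :+ (con 1ℚ :+ g) :- (con 1ℚ :+ g) := c) refl
    shift : ∀ c g → c + 1ℚ - (1ℚ + g) ≡ c - g
    shift = solve 2 (λ c g → c :+ con 1ℚ :- (con 1ℚ :+ g) := c :- g) refl

  -- The moments of b times Lebesgue measure on [0, 1]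
  lebesgue : ℕ → ℚ
  lebesgue m = ι b * ι⁻¹ (suc m)

  -- Both sides are `b` times the integral of `y^m` over [a, a+1].
  moments-lebesgue : ∀ a m → moments a lebesgue m ≡ lebesgue m * (ι (suc a ^ suc m) - ι (a ^ suc m))
  moments-lebesgue a m = begin
    moments a lebesgue m                                                   ≡⟨ ∑<-cong (suc m) (λ i i<m → term i (ℕ.≤-pred i<m)) ⟩
    ∑< (suc m) (λ i → lebesgue m * ι ((suc m C i) ℕ.* a ^ i))              ≡⟨ *-distribˡ-∑< (suc m) (lebesgue m) (λ i → ι ((suc m C i) ℕ.* a ^ i)) ⟩
    lebesgue m * ∑< (suc m) (λ i → ι ((suc m C i) ℕ.* a ^ i))              ≡⟨ cong (lebesgue m *_) (∑<-C a m) ⟩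
    lebesgue m * (ι (suc a ^ suc m) - ι (a ^ suc m))                       ∎
    where
    open ≡-Reasoning
    open ℚ-Solver
    eq₁ : ∀ p q r s → p * q * (r * s) ≡ r * q * (p * s)
    eq₁ = solve 4 (λ p q r s → p :* q :* (r :* s) := r :* q :* (p :* s)) refl
    eq₂ : ∀ p q r s → p * q * (r * s) ≡ p * r * (s * q)
    eq₂ = solve 4 (λ p q r s → p :* q :* (r :* s) := p :* r :* (s :* q)) refl
    term : ∀ i → i ℕ.≤ m → ι ((m C i) ℕ.* a ^ i) * lebesgue (m ∸ i) ≡ lebesgue m * ι ((suc m C i) ℕ.* a ^ i)
    term i i≤m = begin
      ι ((m C i) ℕ.* a ^ i) * (ι b * ι⁻¹ (suc (m ∸ i)))      ≡⟨ cong (_* (ι b * ι⁻¹ (suc (m ∸ i)))) (ι-* (m C i) (a ^ i)) ⟩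
      ι (m C i) * ι (a ^ i) * (ι b * ι⁻¹ (suc (m ∸ i)))      ≡⟨ eq₁ (ι (m C i)) (ι (a ^ i)) (ι b) _ ⟩
      ι b * ι (a ^ i) * (ι (m C i) * ι⁻¹ (suc (m ∸ i)))      ≡⟨ cong (ι b * ι (a ^ i) *_) ([m+1-i]⁻¹*mCi i≤m) ⟩
      ι b * ι (a ^ i) * (ι⁻¹ (suc m) * ι (suc m C i))        ≡⟨ eq₂ (ι b) (ι (a ^ i)) (ι⁻¹ (suc m)) (ι (suc m C i)) ⟩
      lebesgue m * (ι (suc m C i) * ι (a ^ i))               ≡⟨ cong (lebesgue m *_) (ι-* (suc m C i) (a ^ i)) ⟨
      lebesgue m * ι ((suc m C i) ℕ.* a ^ i)                 ∎

  -- The intervals [a, a+1] with `a < b` tile [0, b], so the integrals telescope.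
  ∑-moments-lebesgue : ∀ m → ∑< b (λ a → moments a lebesgue m) ≡ ι (b ^ suc m) * lebesgue m
  ∑-moments-lebesgue m = begin
    ∑< b (λ a → moments a lebesgue m)                                     ≡⟨ ∑<-cong b (λ a _ → moments-lebesgue a m) ⟩
    ∑< b (λ a → lebesgue m * (ι (suc a ^ suc m) - ι (a ^ suc m)))         ≡⟨ *-distribˡ-∑< b (lebesgue m) _ ⟩
    lebesgue m * ∑< b (λ a → ι (suc a ^ suc m) - ι (a ^ suc m))           ≡⟨ cong (lebesgue m *_) (∑<-telescope b (λ a → ι (a ^ suc m))) ⟩
    lebesgue m * (ι (b ^ suc m) - ι 0)                                    ≡⟨ cong (λ z → lebesgue m * (ι (b ^ suc m) - z)) ι-zero ⟩
    lebesgue m * (ι (b ^ suc m) - 0ℚ)                                     ≡⟨ eq (lebesgue m) (ι (b ^ suc m)) ⟩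
    ι (b ^ suc m) * lebesgue m                                            ∎
    where
    open ≡-Reasoning
    open ℚ-Solver
    eq : ∀ p q → p * (q - 0ℚ) ≡ q * p
    eq = solve 2 (λ p q → p :* (q :- con 0ℚ) := q :* p) refl

  others-- : ∀ x y m → others (λ i → x i - y i) m ≡ others x m - others y m
  others-- x y m = trans
    (∑<-cong m λ i _ → p*[q-r]≡p*q-p*r (ι ((m C suc i) ℕ.* γ (suc i))) (x (m ∸ suc i)) (y (m ∸ suc i)))
    (∑<-distrib-- m (λ i → ι ((m C suc i) ℕ.* γ (suc i)) * x (m ∸ suc i)) (λ i → ι ((m C suc i) ℕ.* γ (suc i)) * y (m ∸ suc i)))

  others-nonneg : ∀ {x} m → (∀ i → i ℕ.< m → 0ℚ ≤ x i) → 0ℚ ≤ others x m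
  others-nonneg m h = ∑<-nonneg m λ i i<m → *-nonneg (0≤ι ((m C suc i) ℕ.* γ (suc i)))
    (h (m ∸ suc i) (ℕ.∸-monoʳ-< (ℕ.s≤s ℕ.z≤n) i<m))

  -- The recursion of the u_{j;m} away from m = 0, with x and y in place of
  -- consecutive rows
  record Consecutive (x y : ℕ → ℚ) : Set where
    constructor consecutive
    field
      recursion : ∀ m → coeff (suc m) * x (suc m) ≡ others x (suc m) + moments (toℕ d) y (suc m)

  open Consecutive

  -- Lebesgue measure restricted to any first digit is again Lebesgue measure up to scaling, so a
  -- constant family of rows solves the first-digit equation.
  consecutive-lebesgue : Consecutive lebesgue lebesgue
  consecutive-lebesgue .recursion m = begin
    coeff (suc m) * lebesgue (suc m)                                             ≡⟨ cong (_* lebesgue (suc m)) (coeff≡ (suc m)) ⟩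
    (ι (b ^ suc (suc m)) - ι (γ 0)) * lebesgue (suc m)                           ≡⟨ eq₁ (ι (b ^ suc (suc m))) (ι (γ 0)) (lebesgue (suc m)) ⟩
    ι (b ^ suc (suc m)) * lebesgue (suc m) - ι (γ 0) * lebesgue (suc m)          ≡⟨ cong (_- ι (γ 0) * lebesgue (suc m)) (trans (sym (∑-moments-lebesgue (suc m))) (∑-moments (λ _ → lebesgue) 0 (suc m))) ⟩
    ι (γ 0) * lebesgue (suc m) + (others lebesgue (suc m) + moments (toℕ d) lebesgue (suc m)) - ι (γ 0) * lebesgue (suc m)
                                                                                 ≡⟨ eq₂ (ι (γ 0) * lebesgue (suc m)) _ ⟩
    others lebesgue (suc m) + moments (toℕ d) lebesgue (suc m)                   ∎
    where
    open ≡-Reasoning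
    open ℚ-Solver
    eq₁ : ∀ p q r → (p - q) * r ≡ p * r - q * r
    eq₁ = solve 3 (λ p q r → (p :- q) :* r := p :* r :- q :* r) refl
    eq₂ : ∀ p q → p + q - p ≡ q
    eq₂ = solve 2 (λ p q → p :+ q :- p := q) refl

  -- Linearity turns a comparison of two solutions into a question about the sign of one.
  consecutive-- : ∀ {x y x′ y′} → Consecutive x y → Consecutive x′ y′ →
    Consecutive (λ m → x m - x′ m) (λ m → y m - y′ m)
  consecutive-- {x} {y} {x′} {y′} c c′ .recursion m = begin
    coeff (suc m) * (x (suc m) - x′ (suc m))                       ≡⟨ p*[q-r]≡p*q-p*r (coeff (suc m)) _ _ ⟩
    coeff (suc m) * x (suc m) - coeff (suc m) * x′ (suc m)         ≡⟨ cong₂ _-_ (recursion c m) (recursion c′ m) ⟩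
    (others x (suc m) + moments (toℕ d) y (suc m)) - (others x′ (suc m) + moments (toℕ d) y′ (suc m))
      ≡⟨ eq (others x (suc m)) (moments (toℕ d) y (suc m)) (others x′ (suc m)) _ ⟩
    (others x (suc m) - others x′ (suc m)) + (moments (toℕ d) y (suc m) - moments (toℕ d) y′ (suc m))
      ≡⟨ cong₂ _+_ (others-- x x′ (suc m)) (moments-- (toℕ d) y y′ (suc m)) ⟨
    others (λ m → x m - x′ m) (suc m) + moments (toℕ d) (λ m → y m - y′ m) (suc m) ∎
    where
    open ≡-Reasoning
    open ℚ-Solver
    eq : ∀ p q r s → (p + q) - (r + s) ≡ (p - r) + (q - s)
    eq = solve 4 (λ p q r s → (p :+ q) :- (r :+ s) := (p :- r) :+ (q :- s)) refl

  -- Signs of solutions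

  module _ {x y : ℕ → ℚ} (c : Consecutive x y) (0≤x₀ : 0ℚ ≤ x 0) (0≤y : ∀ m → 0ℚ ≤ y m) where

    -- Up to the positive `coeff (suc m)`, the term `x (suc m)` combines lower terms of `x` and
    -- terms of `y` with nonnegative coefficients. The bound `n` in `below` provides strong
    -- induction.
    consecutive-nonneg : ∀ m → 0ℚ ≤ x m
    consecutive-nonneg m = below m m ℕ.≤-refl
      where
      below : ∀ n m → m ℕ.≤ n → 0ℚ ≤ x m
      below n       zero    _           = 0≤x₀
      below (suc n) (suc m) (ℕ.s≤s m≤n) = *-cancelˡ-nonneg (0<coeff m) (subst (0ℚ ≤_) (sym (recursion c m))
        (+-nonneg (others-nonneg (suc m) λ i i<m → below n i (ℕ.≤-trans (ℕ.≤-pred i<m) m≤n))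
                  (moments-nonneg (toℕ d) (suc m) λ i _ → 0≤y i)))

    -- The last term of `others` is `γ (suc m) * x 0`, and nothing else on the right is negative.
    consecutive-pos-γ : 0ℚ < x 0 → ∀ m → 0ℚ < ι (γ (suc m)) → 0ℚ < x (suc m)
    consecutive-pos-γ 0<x₀ m 0<γ = *-cancelˡ-pos (0<coeff m) (begin-strict
      0ℚ                                                            <⟨ *-pos 0<γ 0<x₀ ⟩
      ι (γ (suc m)) * x 0                                           ≡⟨ cong₂ (λ k i → ι k * x i) (sym (trans (cong (ℕ._* γ (suc m)) (nCn≡1 (suc m))) (ℕ.*-identityˡ _))) (sym (ℕ.n∸n≡0 m)) ⟩
      ι ((suc m C suc m) ℕ.* γ (suc m)) * x (m ∸ m)                 ≤⟨ ∑<-term (suc m) {λ i → ι ((suc m C suc i) ℕ.* γ (suc i)) * x (m ∸ i)} (λ i _ → *-nonneg (0≤ι ((suc m C suc i) ℕ.* γ (suc i))) (consecutive-nonneg (m ∸ i))) m ℕ.≤-refl ⟩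
      others x (suc m)                                              ≤⟨ p≤p+q (moments-nonneg (toℕ d) (suc m) λ i _ → 0≤y i) ⟩
      others x (suc m) + moments (toℕ d) y (suc m)                  ≡⟨ recursion c m ⟨
      coeff (suc m) * x (suc m)                                     ∎)
      where open ℚ.≤-Reasoning

    private
      pos-moment : ∀ m i → i ℕ.≤ suc m → 0ℚ < ι ((suc m C i) ℕ.* toℕ d ^ i) * y (suc m ∸ i) → 0ℚ < x (suc m)
      pos-moment m i i≤m 0<term = *-cancelˡ-pos (0<coeff m) (begin-strict
        0ℚ                                                 <⟨ 0<term ⟩
        ι ((suc m C i) ℕ.* toℕ d ^ i) * y (suc m ∸ i)      ≤⟨ moments-term (toℕ d) (suc m) (λ i _ → 0≤y i) i i≤m ⟩
        moments (toℕ d) y (suc m)                          ≤⟨ p≤q+p (others-nonneg (suc m) λ i _ → consecutive-nonneg i) ⟩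
        others x (suc m) + moments (toℕ d) y (suc m)       ≡⟨ recursion c m ⟨
        coeff (suc m) * x (suc m)                          ∎)
        where open ℚ.≤-Reasoning

    -- Uses the term `i = 0` of `moments`, whose factor `d^0` is 1 even for `d = 0`.
    consecutive-pos-y : ∀ m → 0ℚ < y (suc m) → 0ℚ < x (suc m)
    consecutive-pos-y m 0<y = pos-moment m 0 ℕ.z≤n (*-pos (0<ι 1) 0<y)

    -- Uses the term `i = suc m` of `moments`, whose factor `d^(m+1)` is positive only for nonzero
    -- `d`.
    consecutive-pos-y₀ : .{{NonZero (toℕ d)}} → 0ℚ < y 0 → ∀ m → 0ℚ < x (suc m)
    consecutive-pos-y₀ 0<y₀ m = pos-moment m (suc m) ℕ.≤-refl
      (subst₂ (λ k i → 0ℚ < ι k * y i) (sym (trans (cong (ℕ._* toℕ d ^ suc m) (nCn≡1 (suc m))) (ℕ.*-identityˡ _)))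
        (sym (ℕ.n∸n≡0 m)) (*-pos (0<ι (toℕ d ^ suc m) {{ℕ.m^n≢0 (toℕ d) (suc m)}}) 0<y₀))

  a^m≤γ : ∀ {a} m → a ℕ.< b → a ≢ toℕ d → ι (a ^ m) ≤ ι (γ m)
  a^m≤γ {a} m a<b a≢d = subst₂ _≤_
    (cong (if_then 0ℚ else ι (a ^ m)) (dec-false (a ℕ.≟ toℕ d) a≢d)) (sym (ι-γ m))
    (∑<-term b (λ i _ → 0≤if (does (i ℕ.≟ toℕ d)) i) a a<b)
    where
    0≤if : ∀ c i → 0ℚ ≤ (if c then 0ℚ else ι (i ^ m))
    0≤if true  i = ℚ.≤-refl
    0≤if false i = 0≤ι (i ^ m)

  -- A nonzero digit other than `d` bounds `γ m` below: 1 unless `d = 1`, and otherwise 2, which is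
  -- a digit once `b` exceeds 2.
  0<ι-γ : ¬ (b ≡ 2 × toℕ d ≡ 1) → ∀ m → 0ℚ < ι (γ m)
  0<ι-γ ordinary m with toℕ d ℕ.≟ 1
  ... | no d≢1  = ℚ.<-≤-trans (0<ι (1 ^ m) {{ℕ.m^n≢0 1 m}}) (a^m≤γ m 1<b (d≢1 ∘ sym))
  ... | yes d≡1 = ℚ.<-≤-trans (0<ι (2 ^ m) {{ℕ.m^n≢0 2 m}})
    (a^m≤γ m (ℕ.≤∧≢⇒< 1<b λ 2≡b → ordinary (sym 2≡b , d≡1)) λ 2≡d → contradiction (trans 2≡d d≡1) λ ())

  -- Row p + 1 is u_p and row 0 vanishes, so that p ⊖ a needs no special case when
  -- all the digits d are used up.
  opaque
    v : ℕ → ℕ → ℚ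
    v zero    = λ _ → 0ℚ
    v (suc j) = u j

    v-zero : ∀ m → v 0 m ≡ 0ℚ
    v-zero m = refl

    v-suc : ∀ j m → v (suc j) m ≡ u j m
    v-suc j m = refl

  private
    ∑-others : ∀ j m → ∑ [ 1 ⋯ suc m ⟩ (λ i → fromℕ ((m C i) ℕ.* γ i) * u j (m ∸ i)) ≡ others (u j) m
    ∑-others j m = trans (∑-applyUpTo (1 ℕ.+_) m (λ i → fromℕ ((m C i) ℕ.* γ i) * u j (m ∸ i)))
      (∑<-cong m λ i _ → cong (_* u j (m ∸ suc i)) (sym (ι≡fromℕ ((m C suc i) ℕ.* γ (suc i)))))

    ∑-moments-u : ∀ j m → ∑ [ 0 ⋯ suc m ⟩ (λ i → fromℕ ((m C i) ℕ.* toℕ d ^ i) * u j (m ∸ i)) ≡ moments (toℕ d) (u j) m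
    ∑-moments-u j m = trans (∑-applyUpTo (0 ℕ.+_) (suc m) (λ i → fromℕ ((m C i) ℕ.* toℕ d ^ i) * u j (m ∸ i)))
      (∑<-cong (suc m) λ i _ → cong (_* u j (m ∸ i)) (sym (ι≡fromℕ ((m C i) ℕ.* toℕ d ^ i))))

  u-suc′ : ∀ j m → coeff m * u (suc j) m ≡ others (u (suc j)) m + moments (toℕ d) (u j) m
  u-suc′ j m = trans (u-suc j m) (cong₂ _+_ (∑-others (suc j) m) (∑-moments-u j m))

  opaque
    unfolding v

    -- With row 0 equal to zero, the equation of u_{0;m} becomes an instance of that of u_{j;m}.
    -- This is true for `m ≥ 1` only: the initial value `b` in row 1 does not come from row 0.
    consecutive-v : ∀ p → Consecutive (v (suc p)) (v p)
    consecutive-v zero .recursion m = trans (u-zero (suc m) (ℕ.s≤s ℕ.z≤n)) (trans (∑-others 0 (suc m))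
      (sym (trans (cong (_+_ (others (u 0) (suc m))) (moments-zero (toℕ d) (suc m))) (ℚ.+-identityʳ _))))
    consecutive-v (suc j) .recursion m = u-suc′ j (suc m)

  coeff-zero : coeff 0 ≡ 1ℚ
  coeff-zero = begin
    coeff 0                  ≡⟨ eq₁ (coeff 0) (ι b) ⟩
    coeff 0 + ι b - ι b      ≡⟨ cong (_- ι b) (coeff+b 0) ⟩
    ι (b ^ 1) + 1ℚ - ι b     ≡⟨ cong (λ z → ι z + 1ℚ - ι b) (ℕ.*-identityʳ b) ⟩
    ι b + 1ℚ - ι b           ≡⟨ eq₂ (ι b) ⟩
    1ℚ                       ∎
    where
    open ≡-Reasoning
    open ℚ-Solver
    eq₁ : ∀ p q → p ≡ p + q - q
    eq₁ = solve 2 (λ p q → p := p :+ q :- q) refl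
    eq₂ : ∀ p → p + 1ℚ - p ≡ 1ℚ
    eq₂ = solve 1 (λ p → p :+ con 1ℚ :- p := con 1ℚ) refl

  moments-0 : ∀ a x → moments a x 0 ≡ x 0
  moments-0 a x = trans (ℚ.+-identityʳ _) (trans (cong (_* x 0) ι-one) (ℚ.*-identityˡ (x 0)))

  u-0 : ∀ j → u j 0 ≡ ι b
  u-0 zero    = trans u-zero-zero (sym (ι≡fromℕ b))
  u-0 (suc j) = begin
    u (suc j) 0                    ≡⟨ ℚ.*-identityˡ _ ⟨
    1ℚ * u (suc j) 0               ≡⟨ cong (_* u (suc j) 0) coeff-zero ⟨
    coeff 0 * u (suc j) 0          ≡⟨ u-suc′ j 0 ⟩
    0ℚ + moments (toℕ d) (u j) 0   ≡⟨ ℚ.+-identityˡ _ ⟩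
    moments (toℕ d) (u j) 0        ≡⟨ moments-0 (toℕ d) (u j) ⟩
    u j 0                          ≡⟨ u-0 j ⟩
    ι b                            ∎
    where open ≡-Reasoning

  v-0 : ∀ p → v (suc p) 0 ≡ ι b
  v-0 p = trans (v-suc p 0) (u-0 p)

  0<v-0 : ∀ j → 0ℚ < v (suc j) 0
  0<v-0 j = subst (0ℚ <_) (sym (v-0 j)) (0<ι b)

  0≤v : ∀ p m → 0ℚ ≤ v p m
  0≤v zero    m = ℚ.≤-reflexive (sym (v-zero m))
  0≤v (suc p) m = consecutive-nonneg (consecutive-v p) (ℚ.<⇒≤ (0<v-0 p)) (0≤v p) m

  d≡0⊎d≢0 : toℕ d ≡ 0 ⊎ NonZero (toℕ d)
  d≡0⊎d≢0 with toℕ d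
  ... | zero  = inj₁ refl
  ... | suc _ = inj₂ _

  d≡0⇒ordinary : toℕ d ≡ 0 → ¬ (b ≡ 2 × toℕ d ≡ 1)
  d≡0⇒ordinary d≡0 (_ , d≡1) = contradiction (trans (sym d≡0) d≡1) λ ()

  0<v-ordinary : ¬ (b ≡ 2 × toℕ d ≡ 1) → ∀ j m → 0ℚ < v (suc j) (suc m)
  0<v-ordinary ordinary j m =
    consecutive-pos-γ (consecutive-v j) (ℚ.<⇒≤ (0<v-0 j)) (0≤v j) (0<v-0 j) m (0<ι-γ ordinary (suc m))

  -- For `d = 0` the digit 1 contributes through `γ`. For `d ≠ 0` the mass `b` of the previous row
  -- contributes through `d^(m+1)`, which covers the exceptional case `b = 2`, `d = 1`.
  0<v-suc : ∀ j m → 0ℚ < v (suc (suc j)) (suc m)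
  0<v-suc j m with d≡0⊎d≢0
  ... | inj₁ d≡0 = 0<v-ordinary (d≡0⇒ordinary d≡0) (suc j) m
  ... | inj₂ d≢0 = consecutive-pos-y₀ (consecutive-v (suc j)) (ℚ.<⇒≤ (0<v-0 (suc j))) (0≤v (suc j)) {{d≢0}} (0<v-0 j) m

  v≡0⇒exceptional : ∀ j m → v (suc j) (suc m) ≡ 0ℚ → j ≡ 0 × b ≡ 2 × toℕ d ≡ 1
  v≡0⇒exceptional (suc j) m u≡0 = ⊥-elim (ℚ.<-irrefl (sym u≡0) (0<v-suc j m))
  v≡0⇒exceptional zero    m u≡0 = refl , decidable-stable (b ℕ.≟ 2 ×-dec toℕ d ℕ.≟ 1)
    λ ordinary → ℚ.<-irrefl (sym u≡0) (0<v-ordinary ordinary 0 m)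

  -- Strict increase in j

  Δ : ℕ → ℕ → ℚ
  Δ p m = v (suc p) m - v p m

  consecutive-Δ : ∀ p → Consecutive (Δ (suc p)) (Δ p)
  consecutive-Δ p = consecutive-- (consecutive-v (suc p)) (consecutive-v p)

  0≤Δ₀ : ∀ p → 0ℚ ≤ Δ (suc p) 0
  0≤Δ₀ p = ℚ.≤-reflexive (sym (p≡q⇒p-q≡0 (trans (v-0 (suc p)) (sym (v-0 p)))))

  Δ-zero : ∀ m → Δ 0 m ≡ v 1 m
  Δ-zero m = trans (cong (λ z → v 1 m - z) (v-zero m)) (ℚ.+-identityʳ (v 1 m))

  0≤Δ : ∀ p m → 0ℚ ≤ Δ p m
  0≤Δ zero    m = subst (0ℚ ≤_) (sym (Δ-zero m)) (0≤v 1 m)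
  0≤Δ (suc p) m = consecutive-nonneg (consecutive-Δ p) (0≤Δ₀ p) (0≤Δ p) m

  -- `Δ (suc p) 0` is 0, so positivity has to come from the row below. It starts in `Δ 0`, which is
  -- `v 1`: for `d = 0` from its entry at `suc m`, for `d ≠ 0` from its entry `b` at 0.
  0<Δ : ∀ p m → 0ℚ < Δ (suc p) (suc m)
  0<Δ (suc p) m = consecutive-pos-y (consecutive-Δ (suc p)) (0≤Δ₀ (suc p)) (0≤Δ (suc p)) m (0<Δ p m)
  0<Δ zero    m with d≡0⊎d≢0
  ... | inj₁ d≡0 = consecutive-pos-y (consecutive-Δ 0) (0≤Δ₀ 0) (0≤Δ 0) m
    (subst (0ℚ <_) (sym (Δ-zero (suc m))) (0<v-ordinary (d≡0⇒ordinary d≡0) 0 m))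
  ... | inj₂ d≢0 = consecutive-pos-y₀ (consecutive-Δ 0) (0≤Δ₀ 0) (0≤Δ 0) {{d≢0}}
    (subst (0ℚ <_) (sym (Δ-zero 0)) (0<v-0 0)) m

  v-mono-suc : ∀ j m → v (suc j) (suc m) < v (suc (suc j)) (suc m)
  v-mono-suc j m = subst₂ _<_ (ℚ.+-identityʳ _) (eq (v (suc j) (suc m)) (v (suc (suc j)) (suc m)))
    (ℚ.+-monoʳ-< (v (suc j) (suc m)) (0<Δ j m))
    where
    open ℚ-Solver
    eq : ∀ p q → p + (q - p) ≡ q
    eq = solve 2 (λ p q → p :+ (q :- p) := q) refl

  v-mono-< : ∀ m {i j} → i ℕ.< j → v (suc i) (suc m) < v (suc j) (suc m)
  v-mono-< m {i} i<j = go (ℕ.≤⇒≤′ i<j)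
    where
    go : ∀ {j} → suc i ℕ.≤′ j → v (suc i) (suc m) < v (suc j) (suc m)
    go ℕ.≤′-refl           = v-mono-suc i m
    go (ℕ.≤′-step {j} i<j) = ℚ.<-trans (go i<j) (v-mono-suc j m)

  -- Comparison with Lebesgue measure and the limit in j

  w : ℕ → ℕ → ℚ
  w p m = lebesgue m - v p m

  consecutive-w : ∀ p → Consecutive (w (suc p)) (w p)
  consecutive-w p = consecutive-- consecutive-lebesgue (consecutive-v p)

  w-0 : ∀ p → w (suc p) 0 ≡ 0ℚ
  w-0 p = p≡q⇒p-q≡0 (trans (trans (cong (ι b *_) ι⁻¹-one) (ℚ.*-identityʳ (ι b))) (sym (v-0 p)))

  0≤w : ∀ p m → 0ℚ ≤ w p m
  0≤w zero    m = subst (0ℚ ≤_) (sym (trans (cong (λ z → lebesgue m - z) (v-zero m)) (ℚ.+-identityʳ (lebesgue m)))) (*-nonneg (0≤ι b) (0≤ι⁻¹ (suc m)))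
  0≤w (suc p) m = consecutive-nonneg (consecutive-w p) (ℚ.≤-reflexive (sym (w-0 p))) (0≤w p) m

  v≤lebesgue : ∀ p m → v p m ≤ lebesgue m
  v≤lebesgue p m = 0≤q-p⇒p≤q (0≤w p m)

  -- Induction on `m`: as a recursion in `p`, the equation has coefficient 1 at `w p (suc m)` (the
  -- `i = 0` term of `moments`) against at least 2 on the left, and the other terms are null by
  -- induction. At `m = 0` only row 0 is nonzero.
  Null-w : ∀ m → Null (λ p → w p m)
  Null-w m = below m m ℕ.≤-refl
    where
    below : ∀ n m → m ℕ.≤ n → Null (λ p → w p m)
    below n       zero    _           = Null-unsuc (Null-cong w-0 Null-zero)
    below (suc n) (suc m) (ℕ.s≤s m≤n) = contraction (ℚ.nonNegative⁻¹ 1ℚ) (coeff-suc≥2 m) step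
      (Null-+ (Null-∑< (suc m) λ i _ → Null-* (ι ((suc m C suc i) ℕ.* γ (suc i)))
                (Null-suc (below n (m ∸ i) (ℕ.≤-trans (ℕ.m∸n≤m m i) m≤n))))
              (Null-∑< (suc m) λ i _ → Null-* (ι ((suc m C suc i) ℕ.* toℕ d ^ suc i))
                (below n (m ∸ i) (ℕ.≤-trans (ℕ.m∸n≤m m i) m≤n))))
      where
      open ℚ-Solver
      eq : ∀ p q r → p + (q + r) ≡ q + (p + r)
      eq = solve 3 (λ p q r → p :+ (q :+ r) := q :+ (p :+ r)) refl
      rest : ℕ → ℚ
      rest p = ∑< (suc m) (λ i → ι ((suc m C suc i) ℕ.* toℕ d ^ suc i) * w p (m ∸ i))
      step : ∀ p → coeff (suc m) * w (suc p) (suc m) ≡ 1ℚ * w p (suc m) + (others (w (suc p)) (suc m) + rest p)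
      step p = trans (recursion (consecutive-w p) m)
        (trans (cong (λ z → others (w (suc p)) (suc m) + (z * w p (suc m) + rest p)) ι-one)
          (eq (others (w (suc p)) (suc m)) (1ℚ * w p (suc m)) (rest p)))

  -- Sums over digit strings of bounded length

  e : ℕ → ℚ
  e 1 = 1ℚ
  e _ = 0ℚ

  0≤e : ∀ p → 0ℚ ≤ e p
  0≤e 0             = ℚ.≤-refl
  0≤e 1             = ℚ.nonNegative⁻¹ 1ℚ
  0≤e (suc (suc _)) = ℚ.≤-refl

  -- x with the digit a inserted after the radix point
  _◂_ : ℕ → ℚ → ℚ
  a ◂ x = (ι a + x) * ι⁻¹ b

  0≤◂ : ∀ a {x} → 0ℚ ≤ x → 0ℚ ≤ a ◂ x
  0≤◂ a 0≤x = *-nonneg (+-nonneg (0≤ι a) 0≤x) (0≤ι⁻¹ b)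

  ◂≤1 : ∀ {a x} → a ℕ.< b → x ≤ 1ℚ → a ◂ x ≤ 1ℚ
  ◂≤1 {a} {x} a<b x≤1 = begin
    (ι a + x) * ι⁻¹ b     ≤⟨ ℚ.*-monoʳ-≤-nonNeg (ι⁻¹ b) {{nonNegative (0≤ι⁻¹ b)}} a+x≤b ⟩
    ι b * ι⁻¹ b           ≡⟨ ι-ι⁻¹ b ⟩
    1ℚ                    ∎
    where
    open ℚ.≤-Reasoning
    a+x≤b : ι a + x ≤ ι b
    a+x≤b = begin
      ι a + x      ≤⟨ ℚ.+-monoʳ-≤ (ι a) x≤1 ⟩
      ι a + 1ℚ     ≡⟨ trans (ℚ.+-comm (ι a) 1ℚ) (sym (ι-suc a)) ⟩
      ι (suc a)    ≤⟨ ι-mono-≤ a<b ⟩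
      ι b          ∎

  -- The sum of b^-|X| f (0.X) over the strings X of fewer than L digits in
  -- which d occurs p - 1 times
  A : ℕ → ℕ → (ℚ → ℚ) → ℚ
  A zero    p f = 0ℚ
  A (suc L) p f = e p * f 0ℚ + ι⁻¹ b * ∑< b (λ a → A L (p ⊖ a) (λ x → f (a ◂ x)))

  -- Prepending digits below `b` keeps points in [0, 1], so pointwise bounds are needed only there.
  A-mono : ∀ L p {f g} → (∀ x → 0ℚ ≤ x → x ≤ 1ℚ → f x ≤ g x) → A L p f ≤ A L p g
  A-mono zero    p h = ℚ.≤-refl
  A-mono (suc L) p h = ℚ.+-mono-≤ (*-monoʳ-≤ (0≤e p) (h 0ℚ ℚ.≤-refl (ℚ.nonNegative⁻¹ 1ℚ)))
    (*-monoʳ-≤ (0≤ι⁻¹ b) (∑<-mono-≤ b λ a a<b → A-mono L (p ⊖ a) λ x 0≤x x≤1 →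
      h (a ◂ x) (0≤◂ a 0≤x) (◂≤1 a<b x≤1)))

  A-cong : ∀ L p {f g} → (∀ x → f x ≡ g x) → A L p f ≡ A L p g
  A-cong L p h = ℚ.≤-antisym (A-mono L p λ x _ _ → ℚ.≤-reflexive (h x)) (A-mono L p λ x _ _ → ℚ.≤-reflexive (sym (h x)))

  A-zero : ∀ L p → A L p (λ _ → 0ℚ) ≡ 0ℚ
  A-zero zero    p = refl
  A-zero (suc L) p = trans (cong₂ _+_ (ℚ.*-zeroʳ (e p))
    (trans (cong (ι⁻¹ b *_) (trans (∑<-cong b λ a _ → A-zero L (p ⊖ a)) (∑<-zero b))) (ℚ.*-zeroʳ (ι⁻¹ b)))) (ℚ.+-identityʳ 0ℚ)

  A-+ : ∀ L p f g → A L p (λ x → f x + g x) ≡ A L p f + A L p g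
  A-+ zero    p f g = refl
  A-+ (suc L) p f g = begin
    e p * (f 0ℚ + g 0ℚ) + ι⁻¹ b * ∑< b (λ a → A L (p ⊖ a) (λ x → f (a ◂ x) + g (a ◂ x)))
      ≡⟨ cong (λ z → e p * (f 0ℚ + g 0ℚ) + ι⁻¹ b * z)
           (trans (∑<-cong b λ a _ → A-+ L (p ⊖ a) (λ x → f (a ◂ x)) (λ x → g (a ◂ x)))
             (∑<-distrib-+ b (λ a → A L (p ⊖ a) (λ x → f (a ◂ x))) (λ a → A L (p ⊖ a) (λ x → g (a ◂ x))))) ⟩
    e p * (f 0ℚ + g 0ℚ) + ι⁻¹ b * (∑< b (λ a → A L (p ⊖ a) (λ x → f (a ◂ x))) + ∑< b (λ a → A L (p ⊖ a) (λ x → g (a ◂ x))))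
      ≡⟨ eq (e p) (f 0ℚ) (g 0ℚ) (ι⁻¹ b) _ _ ⟩
    A (suc L) p f + A (suc L) p g ∎
    where
    open ≡-Reasoning
    open ℚ-Solver
    eq : ∀ p f g t F G → p * (f + g) + t * (F + G) ≡ (p * f + t * F) + (p * g + t * G)
    eq = solve 6 (λ p f g t F G → p :* (f :+ g) :+ t :* (F :+ G) := (p :* f :+ t :* F) :+ (p :* g :+ t :* G)) refl

  A-* : ∀ L p c f → A L p (λ x → c * f x) ≡ c * A L p f
  A-* zero    p c f = sym (ℚ.*-zeroʳ c)
  A-* (suc L) p c f = begin
    e p * (c * f 0ℚ) + ι⁻¹ b * ∑< b (λ a → A L (p ⊖ a) (λ x → c * f (a ◂ x)))
      ≡⟨ cong (λ z → e p * (c * f 0ℚ) + ι⁻¹ b * z)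
           (trans (∑<-cong b λ a _ → A-* L (p ⊖ a) c (λ x → f (a ◂ x)))
             (*-distribˡ-∑< b c (λ a → A L (p ⊖ a) (λ x → f (a ◂ x))))) ⟩
    e p * (c * f 0ℚ) + ι⁻¹ b * (c * ∑< b (λ a → A L (p ⊖ a) (λ x → f (a ◂ x))))
      ≡⟨ eq (e p) (f 0ℚ) c (ι⁻¹ b) _ ⟩
    c * A (suc L) p f ∎
    where
    open ≡-Reasoning
    open ℚ-Solver
    eq : ∀ p f c t F → p * (c * f) + t * (c * F) ≡ c * (p * f + t * F)
    eq = solve 5 (λ p f c t F → p :* (c :* f) :+ t :* (c :* F) := c :* (p :* f :+ t :* F)) refl

  A-- : ∀ L p f g → A L p (λ x → f x - g x) ≡ A L p f - A L p g
  A-- L p f g = begin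
    A L p (λ x → f x - g x)                       ≡⟨ A-cong L p (λ x → neg (f x) (g x)) ⟩
    A L p (λ x → f x + (- 1ℚ) * g x)              ≡⟨ A-+ L p f (λ x → (- 1ℚ) * g x) ⟩
    A L p f + A L p (λ x → (- 1ℚ) * g x)          ≡⟨ cong (_+_ (A L p f)) (A-* L p (- 1ℚ) g) ⟩
    A L p f + (- 1ℚ) * A L p g                    ≡⟨ neg (A L p f) (A L p g) ⟨
    A L p f - A L p g                             ∎
    where
    open ≡-Reasoning
    open ℚ-Solver
    neg : ∀ p q → p - q ≡ p + (- 1ℚ) * q
    neg = solve 2 (λ p q → p :- q := p :+ con (- 1ℚ) :* q) refl

  A-∑< : ∀ L p n (c : ℕ → ℚ) (f : ℕ → ℚ → ℚ) →
    A L p (λ x → ∑< n (λ i → c i * f i x)) ≡ ∑< n (λ i → c i * A L p (f i))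
  A-∑< L p zero    c f = A-zero L p
  A-∑< L p (suc n) c f = trans (A-+ L p (λ x → c 0 * f 0 x) (λ x → ∑< n (λ i → c (suc i) * f (suc i) x)))
    (cong₂ _+_ (A-* L p (c 0) (f 0)) (A-∑< L p n (c ∘ suc) (f ∘ suc)))

  -- Moments of the truncated measure in row `p`; they approximate `v p m` from below.
  U : ℕ → ℕ → ℕ → ℚ
  U L p m = A L p (_^ℚ m)

  -- The contribution of the empty string, a unit mass at 0 in row 1, scaled by `b^(m+1)`. It is
  -- nonzero only for `p = 1` and `m = 0`.
  source : ℕ → ℕ → ℚ
  source p m = ι (b ^ suc m) * (e p * 0ℚ ^ℚ m)

  A-◂^ : ∀ L p a m → A L p (λ x → (a ◂ x) ^ℚ m) ≡ ι⁻¹ b ^ℚ m * moments a (U L p) m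
  A-◂^ L p a m = begin
    A L p (λ x → (a ◂ x) ^ℚ m)                                   ≡⟨ A-cong L p (λ x → trans (Exp.^-distrib-* (ι a + x) (ι⁻¹ b) m)
                                                                      (trans (ℚ.*-comm ((ι a + x) ^ℚ m) (ι⁻¹ b ^ℚ m)) (cong (ι⁻¹ b ^ℚ m *_) (binomial a x m)))) ⟩
    A L p (λ x → ι⁻¹ b ^ℚ m * moments a (x ^ℚ_) m)               ≡⟨ A-* L p (ι⁻¹ b ^ℚ m) (λ x → moments a (x ^ℚ_) m) ⟩
    ι⁻¹ b ^ℚ m * A L p (λ x → moments a (x ^ℚ_) m)               ≡⟨ cong (ι⁻¹ b ^ℚ m *_) (A-∑< L p (suc m) (λ i → ι ((m C i) ℕ.* a ^ i)) (λ i x → x ^ℚ (m ∸ i))) ⟩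
    ι⁻¹ b ^ℚ m * moments a (U L p) m                             ∎
    where open ≡-Reasoning

  bᵐ*b⁻ᵐ : ∀ m → ι (b ^ suc m) * (ι⁻¹ b * ι⁻¹ b ^ℚ m) ≡ 1ℚ
  bᵐ*b⁻ᵐ m = trans (cong (ι (b ^ suc m) *_) (sym (ι⁻¹-^ b (suc m)))) (ι-ι⁻¹ (b ^ suc m) {{ℕ.m^n≢0 b (suc m)}})

  -- A first digit costs a factor `1/b` of mass and scales `m`-th powers by `b^-m`; the factor
  -- `b^(m+1)` removes both.
  U-suc : ∀ L p m → ι (b ^ suc m) * U (suc L) p m ≡ source p m + ∑< b (λ a → moments a (U L (p ⊖ a)) m)
  U-suc L p m = begin
    ι (b ^ suc m) * (e p * 0ℚ ^ℚ m + ι⁻¹ b * ∑< b (λ a → A L (p ⊖ a) (λ x → (a ◂ x) ^ℚ m)))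
      ≡⟨ cong (λ z → ι (b ^ suc m) * (e p * 0ℚ ^ℚ m + ι⁻¹ b * z))
           (trans (∑<-cong b λ a _ → A-◂^ L (p ⊖ a) a m) (*-distribˡ-∑< b (ι⁻¹ b ^ℚ m) (λ a → moments a (U L (p ⊖ a)) m))) ⟩
    ι (b ^ suc m) * (e p * 0ℚ ^ℚ m + ι⁻¹ b * (ι⁻¹ b ^ℚ m * ∑< b (λ a → moments a (U L (p ⊖ a)) m)))
      ≡⟨ eq (ι (b ^ suc m)) (e p * 0ℚ ^ℚ m) (ι⁻¹ b) (ι⁻¹ b ^ℚ m) _ ⟩
    source p m + ι (b ^ suc m) * (ι⁻¹ b * ι⁻¹ b ^ℚ m) * ∑< b (λ a → moments a (U L (p ⊖ a)) m)
      ≡⟨ cong (_+_ (source p m)) (trans (cong (_* ∑< b (λ a → moments a (U L (p ⊖ a)) m)) (bᵐ*b⁻ᵐ m)) (ℚ.*-identityˡ _)) ⟩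
    source p m + ∑< b (λ a → moments a (U L (p ⊖ a)) m) ∎
    where
    open ≡-Reasoning
    open ℚ-Solver
    eq : ∀ B s t q F → B * (s + t * (q * F)) ≡ B * s + B * (t * q) * F
    eq = solve 5 (λ B s t q F → B :* (s :+ t :* (q :* F)) := B :* s :+ B :* (t :* q) :* F) refl

  0⊖ : ∀ a → 0 ⊖ a ≡ 0
  0⊖ a = float (does (a ℕ.≟ toℕ d))
    where
    float : ∀ c → (if c then 0 else 0) ≡ 0
    float true  = refl
    float false = refl

  source-suc : ∀ p m → source p (suc m) ≡ 0ℚ
  source-suc p m = eq (ι (b ^ suc (suc m))) (e p) (0ℚ ^ℚ m)
    where
    open ℚ-Solver
    eq : ∀ p q r → p * (q * (0ℚ * r)) ≡ 0ℚ
    eq = solve 3 (λ p q r → p :* (q :* (con 0ℚ :* r)) := con 0ℚ) refl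

  source-zero : ∀ m → source 0 m ≡ 0ℚ
  source-zero m = eq (ι (b ^ suc m)) (0ℚ ^ℚ m)
    where
    open ℚ-Solver
    eq : ∀ p q → p * (0ℚ * q) ≡ 0ℚ
    eq = solve 2 (λ p q → p :* (con 0ℚ :* q) := con 0ℚ) refl

  -- In row 1 the empty string supplies the mass that row 0 lacks.
  source+v₀ : ∀ p → source (suc p) 0 + v p 0 ≡ ι b
  source+v₀ zero    = trans (cong₂ _+_ (trans (ℚ.*-identityʳ _) (cong ι (ℕ.*-identityʳ b))) (v-zero 0)) (ℚ.+-identityʳ (ι b))
  source+v₀ (suc p) = trans (cong₂ _+_ (ℚ.*-zeroʳ (ι (b ^ 1))) (v-0 p)) (ℚ.+-identityˡ (ι b))

  -- The limit form of `U-suc`: `v` is a fixed point of the first-digit equation, now including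
  -- `m = 0` and row 0.
  v-step : ∀ p m → ι (b ^ suc m) * v p m ≡ source p m + ∑< b (λ a → moments a (v (p ⊖ a)) m)
  v-step zero m = trans (trans (cong (ι (b ^ suc m) *_) (v-zero m)) (ℚ.*-zeroʳ (ι (b ^ suc m))))
    (sym (trans (cong₂ _+_ (source-zero m) (trans (∑<-cong b λ a _ →
      trans (cong (λ p → moments a (v p) m) (0⊖ a)) (trans (moments-cong a m λ i _ → v-zero i) (moments-zero a m))) (∑<-zero b)))
      (ℚ.+-identityˡ 0ℚ)))
  v-step (suc p) zero = begin
    ι (b ^ 1) * v (suc p) 0                                           ≡⟨ cong₂ _*_ (cong ι (ℕ.*-identityʳ b)) (v-0 p) ⟩
    ι b * ι b                                                         ≡⟨ cong (_* ι b) 1+ι-γ₀ ⟨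
    (1ℚ + ι (γ 0)) * ι b                                              ≡⟨ eq₁ (ι (γ 0)) (ι b) ⟩
    ι (γ 0) * ι b + ι b                                               ≡⟨ cong₂ (λ y z → ι (γ 0) * y + z) (v-0 p) (source+v₀ p) ⟨
    ι (γ 0) * v (suc p) 0 + (source (suc p) 0 + v p 0)                ≡⟨ eq₂ (ι (γ 0) * v (suc p) 0) (source (suc p) 0) (v p 0) ⟩
    source (suc p) 0 + (ι (γ 0) * v (suc p) 0 + (0ℚ + v p 0))         ≡⟨ cong (λ z → source (suc p) 0 + (ι (γ 0) * v (suc p) 0 + (0ℚ + z))) (moments-0 (toℕ d) (v p)) ⟨
    source (suc p) 0 + (ι (γ 0) * v (suc p) 0 + (others (v (suc p)) 0 + moments (toℕ d) (v p) 0)) ≡⟨ cong (_+_ (source (suc p) 0)) (∑-moments v p 0) ⟨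
    source (suc p) 0 + ∑< b (λ a → moments a (v (suc p ⊖ a)) 0)       ∎
    where
    open ≡-Reasoning
    open ℚ-Solver
    eq₁ : ∀ g β → (1ℚ + g) * β ≡ g * β + β
    eq₁ = solve 2 (λ g β → (con 1ℚ :+ g) :* β := g :* β :+ β) refl
    eq₂ : ∀ p q r → p + (q + r) ≡ q + (p + (0ℚ + r))
    eq₂ = solve 3 (λ p q r → p :+ (q :+ r) := q :+ (p :+ (con 0ℚ :+ r))) refl
  v-step (suc p) (suc m) = begin
    B * y                                                             ≡⟨ eq B (ι (γ 0)) y ⟩
    ι (γ 0) * y + (B - ι (γ 0)) * y                                   ≡⟨ cong (λ z → ι (γ 0) * y + z * y) (coeff≡ (suc m)) ⟨
    ι (γ 0) * y + coeff (suc m) * y                                   ≡⟨ cong (_+_ (ι (γ 0) * y)) (Consecutive.recursion (consecutive-v p) m) ⟩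
    ι (γ 0) * y + (others (v (suc p)) (suc m) + moments (toℕ d) (v p) (suc m)) ≡⟨ ∑-moments v p (suc m) ⟨
    ∑< b (λ a → moments a (v (suc p ⊖ a)) (suc m))                    ≡⟨ ℚ.+-identityˡ _ ⟨
    0ℚ + ∑< b (λ a → moments a (v (suc p ⊖ a)) (suc m))               ≡⟨ cong (_+ ∑< b (λ a → moments a (v (suc p ⊖ a)) (suc m))) (source-suc (suc p) m) ⟨
    source (suc p) (suc m) + ∑< b (λ a → moments a (v (suc p ⊖ a)) (suc m)) ∎
    where
    open ≡-Reasoning
    open ℚ-Solver
    B = ι (b ^ suc (suc m))
    y = v (suc p) (suc m)
    eq : ∀ B g y → B * y ≡ g * y + (B - g) * y
    eq = solve 3 (λ B g y → B :* y := g :* y :+ (B :- g) :* y) refl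

  -- Convergence of the truncated moments

  err : ℕ → ℕ → ℕ → ℚ
  err L p m = v p m - U L p m

  -- The source terms cancel, leaving a homogeneous equation.
  err-suc : ∀ L p m → ι (b ^ suc m) * err (suc L) p m ≡ ∑< b (λ a → moments a (err L (p ⊖ a)) m)
  err-suc L p m = begin
    ι (b ^ suc m) * (v p m - U (suc L) p m)                               ≡⟨ p*[q-r]≡p*q-p*r (ι (b ^ suc m)) _ _ ⟩
    ι (b ^ suc m) * v p m - ι (b ^ suc m) * U (suc L) p m                 ≡⟨ cong₂ _-_ (v-step p m) (U-suc L p m) ⟩
    (source p m + ∑< b (λ a → moments a (v (p ⊖ a)) m)) - (source p m + ∑< b (λ a → moments a (U L (p ⊖ a)) m))
                                                                          ≡⟨ eq (source p m) _ _ ⟩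
    ∑< b (λ a → moments a (v (p ⊖ a)) m) - ∑< b (λ a → moments a (U L (p ⊖ a)) m)
                                                                          ≡⟨ ∑<-distrib-- b (λ a → moments a (v (p ⊖ a)) m) (λ a → moments a (U L (p ⊖ a)) m) ⟨
    ∑< b (λ a → moments a (v (p ⊖ a)) m - moments a (U L (p ⊖ a)) m)      ≡⟨ ∑<-cong b (λ a _ → moments-- a (v (p ⊖ a)) (U L (p ⊖ a)) m) ⟨
    ∑< b (λ a → moments a (err L (p ⊖ a)) m)                              ∎
    where
    open ≡-Reasoning
    open ℚ-Solver
    eq : ∀ s p q → (s + p) - (s + q) ≡ p - q
    eq = solve 3 (λ s p q → (s :+ p) :- (s :+ q) := p :- q) refl

  0≤err : ∀ L p m → 0ℚ ≤ err L p m
  0≤err zero    p m = subst (0ℚ ≤_) (sym (ℚ.+-identityʳ (v p m))) (0≤v p m)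
  0≤err (suc L) p m = *-cancelˡ-nonneg (0<bᵐ (suc m)) (subst (0ℚ ≤_) (sym (err-suc L p m))
    (∑<-nonneg b λ a _ → moments-nonneg a m λ i _ → 0≤err L (p ⊖ a) i))

  A-row-zero : ∀ L f → A L 0 f ≡ 0ℚ
  A-row-zero zero    f = refl
  A-row-zero (suc L) f = trans (cong₂ _+_ (ℚ.*-zeroˡ (f 0ℚ)) (trans (cong (ι⁻¹ b *_)
    (trans (∑<-cong b λ a _ → trans (cong (λ p → A L p (λ x → f (a ◂ x))) (0⊖ a)) (A-row-zero L (λ x → f (a ◂ x)))) (∑<-zero b)))
    (ℚ.*-zeroʳ (ι⁻¹ b)))) (ℚ.+-identityˡ 0ℚ)

  -- Induction on the row and, within it, on `m`. By `∑-moments` the equation is a contraction in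
  -- `L` with `r = γ 0` and `q = b^(m+1)`. Its inhomogeneous part contains lower moments of the same
  -- row and moments of the previous row. For `m = 0` the margin `q = r + 1` is attained exactly.
  Null-err : ∀ p m → Null (λ L → err L p m)
  Null-err zero    m = Null-cong (λ L → cong₂ _-_ (v-zero m) (A-row-zero L (_^ℚ m))) Null-zero
  Null-err (suc p) m = below (suc m) m ℕ.≤-refl
    where
    γ₀+1≤bᵐ : ∀ m → ι (γ 0) + 1ℚ ≤ ι (b ^ suc m)
    γ₀+1≤bᵐ m = subst (_≤ ι (b ^ suc m)) (trans (sym 1+ι-γ₀) (ℚ.+-comm 1ℚ (ι (γ 0))))
      (ι-mono-≤ (ℕ.m≤m*n b (b ^ m) {{ℕ.m^n≢0 b m}}))
    below : ∀ n m → m ℕ.< n → Null (λ L → err L (suc p) m)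
    below (suc n) m (ℕ.s≤s m≤n) = contraction (0≤ι (γ 0)) (γ₀+1≤bᵐ m)
      (λ L → trans (err-suc L (suc p) m) (∑-moments (err L) p m))
      (Null-+ (Null-∑< m λ i i<m → Null-* (ι ((m C suc i) ℕ.* γ (suc i)))
                (below n (m ∸ suc i) (ℕ.<-≤-trans (ℕ.∸-monoʳ-< (ℕ.s≤s ℕ.z≤n) i<m) m≤n)))
              (Null-∑< (suc m) λ i _ → Null-* (ι ((m C i) ℕ.* toℕ d ^ i)) (Null-err p (m ∸ i))))

  -- This bounds the remainder of the expansions uniformly in `L` and in the row, by a quantity
  -- tending to 0 in `m`.
  U≤lebesgue : ∀ L p m → U L p m ≤ lebesgue m
  U≤lebesgue L p m = ℚ.≤-trans (0≤q-p⇒p≤q (0≤err L p m)) (v≤lebesgue p m)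

  -- Decrease in m

  0≤drop : ∀ p m → 0ℚ ≤ v p m - v p (suc m)
  0≤drop p m = 0≤x+Null⇒0≤x (Null-- (Null-err p (suc m)) (Null-err p m)) λ L →
    subst (0ℚ ≤_) (eq (v p m) (v p (suc m)) (U L p m) (U L p (suc m))) (p≤q⇒0≤q-p
      -- The integrand `x^m (1 - x)` is nonnegative on [0, 1].
      (A-mono L p λ x 0≤x x≤1 → 0≤q-p⇒p≤q (subst (0ℚ ≤_) (factor x (x ^ℚ m)) (*-nonneg (^ℚ-nonneg 0≤x m) (p≤q⇒0≤q-p x≤1)))))
    where
    open ℚ-Solver
    eq : ∀ v v′ u u′ → u - u′ ≡ v - v′ + ((v′ - u′) - (v - u))
    eq = solve 4 (λ v v′ u u′ → u :- u′ := v :- v′ :+ ((v′ :- u′) :- (v :- u))) refl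
    factor : ∀ x y → y * (1ℚ - x) ≡ y - x * y
    factor = solve 2 (λ x y → y :* (con 1ℚ :- x) := y :- x :* y) refl

  -- ∫ xᵐ (1 - x)² ≥ 0
  drop-antitone : ∀ p m → v p (suc m) - v p (suc (suc m)) ≤ v p m - v p (suc m)
  drop-antitone p m = 0≤q-p⇒p≤q (0≤x+Null⇒0≤x
    (Null-- (Null-- (Null-err p (suc m)) (Null-err p (suc (suc m)))) (Null-- (Null-err p m) (Null-err p (suc m)))) λ L →
    subst (0ℚ ≤_) (eq (v p m) (v p (suc m)) (v p (suc (suc m))) (U L p m) (U L p (suc m)) (U L p (suc (suc m))))
      (p≤q⇒0≤q-p (subst₂ _≤_ (A-- L p (_^ℚ suc m) (_^ℚ suc (suc m))) (A-- L p (_^ℚ m) (_^ℚ suc m))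
        (A-mono L p λ x 0≤x x≤1 → 0≤q-p⇒p≤q (subst (0ℚ ≤_) (factor x (x ^ℚ m))
          (*-nonneg (^ℚ-nonneg 0≤x m) (*-nonneg (p≤q⇒0≤q-p x≤1) (p≤q⇒0≤q-p x≤1))))))))
    where
    open ℚ-Solver
    eq : ∀ v v′ v″ u u′ u″ → (u - u′) - (u′ - u″) ≡ (v - v′) - (v′ - v″) + (((v′ - u′) - (v″ - u″)) - ((v - u) - (v′ - u′)))
    eq = solve 6 (λ v v′ v″ u u′ u″ → (u :- u′) :- (u′ :- u″)
      := (v :- v′) :- (v′ :- v″) :+ (((v′ :- u′) :- (v″ :- u″)) :- ((v :- u) :- (v′ :- u′)))) refl
    factor : ∀ x y → y * ((1ℚ - x) * (1ℚ - x)) ≡ (y - x * y) - (x * y - x * (x * y))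
    factor = solve 2 (λ x y → y :* ((con 1ℚ :- x) :* (con 1ℚ :- x)) := (y :- x :* y) :- (x :* y :- x :* (x :* y))) refl

  Null-lebesgue : Null lebesgue
  Null-lebesgue = Null-* (ι b) Null-ι⁻¹

  -- If the sequence does not drop at m then, being convex, it never drops again,
  -- but it tends to 0.
  no-drop⇒≤0 : ∀ p m → v p m ≤ v p (suc m) → v p m ≤ 0ℚ
  no-drop⇒≤0 p m h = subst (_≤ 0ℚ) (neg-involutive (v p m)) (ℚ.neg-antimono-≤
    -- `v p m ≤ v p (m + k) ≤ b/(m + k + 1)` for every `k`.
    (0≤x+Null⇒0≤x (Null-shift m Null-lebesgue) λ k → subst (0ℚ ≤_) (ℚ.+-comm (lebesgue (m ℕ.+ k)) (- v p m))
      (p≤q⇒0≤q-p (ℚ.≤-trans (constant k) (v≤lebesgue p (m ℕ.+ k))))))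
    where
    open ℚ-Solver
    neg-involutive : ∀ p → - (- p) ≡ p
    neg-involutive = solve 1 (λ p → :- (:- p) := p) refl
    swap : ∀ p q → - (p - q) ≡ q - p
    swap = solve 2 (λ p q → :- (p :- q) := q :- p) refl
    drop≤0 : ∀ k → v p (m ℕ.+ k) - v p (suc (m ℕ.+ k)) ≤ 0ℚ
    drop≤0 zero    = subst (λ i → v p i - v p (suc i) ≤ 0ℚ) (sym (ℕ.+-identityʳ m))
      (subst (_≤ 0ℚ) (swap (v p (suc m)) (v p m)) (ℚ.neg-antimono-≤ (p≤q⇒0≤q-p h)))
    drop≤0 (suc k) = subst (λ i → v p i - v p (suc i) ≤ 0ℚ) (sym (ℕ.+-suc m k))
      (ℚ.≤-trans (drop-antitone p (m ℕ.+ k)) (drop≤0 k))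
    constant : ∀ k → v p m ≤ v p (m ℕ.+ k)
    constant zero    = ℚ.≤-reflexive (cong (v p) (sym (ℕ.+-identityʳ m)))
    constant (suc k) = ℚ.≤-trans (constant k) (subst (λ i → v p (m ℕ.+ k) ≤ v p i) (sym (ℕ.+-suc m k))
      (0≤q-p⇒p≤q (subst (0ℚ ≤_) (swap (v p (m ℕ.+ k)) (v p (suc (m ℕ.+ k)))) (ℚ.neg-antimono-≤ (drop≤0 k)))))

  v-antitone : ∀ p m → v p (suc m) ≤ v p m
  v-antitone p m = 0≤q-p⇒p≤q (0≤drop p m)

  v-strict : ∀ p m → ¬ (v p (suc m) ≡ 0ℚ × v p m ≡ 0ℚ) → v p (suc m) < v p m
  v-strict p m nonzero = ℚ.≰⇒> λ h → nonzero
    ( ℚ.≤-antisym (ℚ.≤-trans (v-antitone p m) (no-drop⇒≤0 p m h)) (0≤v p (suc m))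
    , ℚ.≤-antisym (no-drop⇒≤0 p m h) (0≤v p m))

  -- `e` tests for row 1, where no further digit `d` is to be placed: `suc k ∸ c` is 1 exactly for
  -- `c = k`, and every `c > k` lands in row 0.
  if-≟ : ∀ c k q → (if does (c ℕ.≟ k) then q else 0ℚ) ≡ e (suc k ∸ c) * q
  if-≟ zero    zero    q = sym (ℚ.*-identityˡ q)
  if-≟ zero    (suc k) q = sym (ℚ.*-zeroˡ q)
  if-≟ (suc c) zero    q = sym (trans (cong (λ p → e p * q) (ℕ.0∸n≡0 c)) (ℚ.*-zeroˡ q))
  if-≟ (suc c) (suc k) q = if-≟ c k q

  -- Truncated subtraction reaches row 0 exactly when `c ≤ k` fails, so a sequence vanishing there
  -- makes the test redundant.
  if-≤? : ∀ c k (x : ℕ → ℚ) → x 0 ≡ 0ℚ → (if does (c ℕ.≤? k) then x (suc (k ∸ c)) else 0ℚ) ≡ x (suc k ∸ c)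
  if-≤? c k x x₀≡0 = by-cases (c ℕ.≤? k)
    where
    by-cases : Dec (c ℕ.≤ k) → (if does (c ℕ.≤? k) then x (suc (k ∸ c)) else 0ℚ) ≡ x (suc k ∸ c)
    by-cases (yes c≤k) = trans (cong (if_then x (suc (k ∸ c)) else 0ℚ) (dec-true (c ℕ.≤? k) c≤k))
      (cong x (sym (ℕ.+-∸-assoc 1 c≤k)))
    by-cases (no c≰k) = trans (cong (if_then x (suc (k ∸ c)) else 0ℚ) (dec-false (c ℕ.≤? k) c≰k))
      (sym (trans (cong x (ℕ.m≤n⇒m∸n≡0 (ℕ.≰⇒> c≰k))) x₀≡0))

  #d-/% : ∀ n .{{_ : NonZero n}} → #d n ≡ (if does (n % b ℕ.≟ toℕ d) then suc (#d (n ℕ./ b)) else #d (n ℕ./ b))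
  #d-/% n@(suc n-1) = trans (cong (length ∘ filter (Fin._≟ d)) (digits-suc n-1))
    (trans (length-filter (n mod b) (digits (n ℕ./ b)))
      (cong (λ r → if does (r ℕ.≟ toℕ d) then suc (#d (n ℕ./ b)) else #d (n ℕ./ b)) (Fin.toℕ-fromℕ< (m%n<n n b))))
    where
    length-filter : ∀ x xs → length (filter (Fin._≟ d) (x ∷ xs)) ≡
      (if does (toℕ x ℕ.≟ toℕ d) then suc (length (filter (Fin._≟ d) xs)) else length (filter (Fin._≟ d) xs))
    length-filter x xs with x Fin.≟ d
    ... | yes x≡d rewrite dec-true (toℕ x ℕ.≟ toℕ d) (cong toℕ x≡d) = refl
    ... | no  x≢d rewrite dec-false (toℕ x ℕ.≟ toℕ d) (x≢d ∘ Fin.toℕ-injective) = refl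

  n*b+a≢0 : ∀ n a .{{_ : NonZero n}} → NonZero (n ℕ.* b ℕ.+ a)
  n*b+a≢0 n a = ℕ.>-nonZero (ℕ.<-≤-trans (ℕ.>-nonZero⁻¹ (n ℕ.* b) {{ℕ.m*n≢0 n b}}) (ℕ.m≤m+n (n ℕ.* b) a))

  -- For `n = 0` and `a = 0` the minimal representation would gain no digit; this is why `n` is
  -- nonzero.
  #d-append : ∀ n {a} .{{_ : NonZero n}} → a ℕ.< b →
    #d (n ℕ.* b ℕ.+ a) ≡ (if does (a ℕ.≟ toℕ d) then suc (#d n) else #d n)
  #d-append n {a} a<b = trans (#d-/% (n ℕ.* b ℕ.+ a) {{n*b+a≢0 n a}})
    (cong₂ (λ r q → if does (r ℕ.≟ toℕ d) then suc (#d q) else #d q) remainder quotient)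
    where
    open ≡-Reasoning
    remainder : (n ℕ.* b ℕ.+ a) % b ≡ a
    remainder = trans (cong (_% b) (ℕ.+-comm (n ℕ.* b) a)) (trans ([m+kn]%n≡m%n a n b) (m<n⇒m%n≡m a<b))
    quotient : (n ℕ.* b ℕ.+ a) ℕ./ b ≡ n
    quotient = begin
      (n ℕ.* b ℕ.+ a) ℕ./ b          ≡⟨ cong (ℕ._/ b) (ℕ.+-comm (n ℕ.* b) a) ⟩
      (a ℕ.+ n ℕ.* b) ℕ./ b          ≡⟨ +-distrib-/-∣ʳ a {n ℕ.* b} {b} (n∣m*n n) ⟩
      a ℕ./ b ℕ.+ n ℕ.* b ℕ./ b      ≡⟨ cong₂ ℕ._+_ (m<n⇒m/n≡0 a<b) (m*n/n≡m n b) ⟩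
      n                              ∎

  -- The Irwin series as a sum over appended strings

  module Fixed (k : ℕ) where

    h : ℕ → ℚ
    h = irwinTerm k

    -- One more than the number of further digits d allowed after n, or 0
    -- if n already has too many
    row : ℕ → ℕ
    row n = suc k ∸ #d n

    h≡ : ∀ n → h n ≡ e (row n) * ι⁻¹ n
    h≡ n = trans (if-≟ (#d n) k (1/ n)) (cong (e (row n) *_) (sym (ι⁻¹≡1/ n)))

    0≤h : ∀ n → 0ℚ ≤ h n
    0≤h n = subst (0ℚ ≤_) (sym (h≡ n)) (*-nonneg (0≤e (row n)) (0≤ι⁻¹ n))

    row-append : ∀ n {a} .{{_ : NonZero n}} → a ℕ.< b → row (n ℕ.* b ℕ.+ a) ≡ row n ⊖ a
    row-append n {a} a<b = trans (cong (suc k ∸_) (#d-append n a<b)) (float (does (a ℕ.≟ toℕ d)) (#d n))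
      where
      float : ∀ t c → suc k ∸ (if t then suc c else c) ≡ (if t then ℕ.pred (suc k ∸ c) else suc k ∸ c)
      float true  c = sym (ℕ.pred[m∸n]≡m∸[1+n] (suc k) c)
      float false c = refl

    -- The part of the series carried by n and by the numbers obtained from n by
    -- appending fewer than L digits
    S : ℕ → ℕ → ℚ
    S zero    n = 0ℚ
    S (suc L) n = h n + ∑< b (λ a → S L (n ℕ.* b ℕ.+ a))

    -- Appending `X` to `n` gives the integer `b^|X| (n + 0.X)`, so `S L n` is the truncated
    -- integral of `1/(n + x)`, and the hypothesis reads `g x ≤ σ/(n + x)`. Since `σ` may have
    -- either sign, lower and upper bounds for `S` both follow.
    A≤S : ∀ L n {σ g} .{{_ : NonZero n}} → (∀ x → 0ℚ ≤ x → x ≤ 1ℚ → (ι n + x) * g x ≤ σ) → A L (row n) g ≤ σ * S L n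
    A≤S zero    n {σ}     bound = ℚ.≤-reflexive (sym (ℚ.*-zeroʳ σ))
    A≤S (suc L) n {σ} {g} bound = begin
      e (row n) * g 0ℚ + t * ∑< b (λ a → A L (row n ⊖ a) (λ x → g (a ◂ x)))
        ≡⟨ cong (_+_ (e (row n) * g 0ℚ)) (trans (sym (*-distribˡ-∑< b t _)) (∑<-cong b λ a _ → sym (A-* L (row n ⊖ a) t (λ x → g (a ◂ x))))) ⟩
      e (row n) * g 0ℚ + ∑< b (λ a → A L (row n ⊖ a) (λ x → t * g (a ◂ x)))
        ≤⟨ ℚ.+-mono-≤ (*-monoʳ-≤ (0≤e (row n)) g₀≤) (∑<-mono-≤ b digit) ⟩
      e (row n) * (σ * ι⁻¹ n) + ∑< b (λ a → σ * S L (n ℕ.* b ℕ.+ a))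
        ≡⟨ cong₂ _+_ (trans (eq₁ (e (row n)) σ (ι⁻¹ n)) (cong (σ *_) (sym (h≡ n)))) (*-distribˡ-∑< b σ (λ a → S L (n ℕ.* b ℕ.+ a))) ⟩
      σ * h n + σ * ∑< b (λ a → S L (n ℕ.* b ℕ.+ a))
        ≡⟨ ℚ.*-distribˡ-+ σ (h n) _ ⟨
      σ * S (suc L) n ∎
      where
      open ℚ.≤-Reasoning
      open ℚ-Solver
      t = ι⁻¹ b
      eq₁ : ∀ p q r → p * (q * r) ≡ q * (p * r)
      eq₁ = solve 3 (λ p q r → p :* (q :* r) := q :* (p :* r)) refl
      eq₂ : ∀ n b t y g → (n * b + y) * (t * g) ≡ (n * (b * t) + y * t) * g
      eq₂ = solve 5 (λ n b t y g → (n :* b :+ y) :* (t :* g) := (n :* (b :* t) :+ y :* t) :* g) refl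
      g₀≤ : g 0ℚ ≤ σ * ι⁻¹ n
      g₀≤ = *-cancelˡ-≤ (0<ι n) (begin
        ι n * g 0ℚ               ≡⟨ cong (_* g 0ℚ) (ℚ.+-identityʳ (ι n)) ⟨
        (ι n + 0ℚ) * g 0ℚ        ≤⟨ bound 0ℚ ℚ.≤-refl (ℚ.nonNegative⁻¹ 1ℚ) ⟩
        σ                        ≡⟨ trans (sym (ℚ.*-identityʳ σ)) (cong (σ *_) (sym (ι-ι⁻¹ n))) ⟩
        σ * (ι n * ι⁻¹ n)        ≡⟨ eq₁ σ (ι n) (ι⁻¹ n) ⟩
        ι n * (σ * ι⁻¹ n)        ∎)
      digit : ∀ a → a ℕ.< b → A L (row n ⊖ a) (λ x → t * g (a ◂ x)) ≤ σ * S L (n ℕ.* b ℕ.+ a)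
      digit a a<b = subst (λ p → A L p (λ x → t * g (a ◂ x)) ≤ σ * S L (n ℕ.* b ℕ.+ a)) (row-append n a<b)
        -- With `n b + a` for `n` and `t * g (a ◂ x)` for `g x`, the product in the hypothesis is
        -- unchanged: `n b + a + x = b (n + (a ◂ x))`.
        (A≤S L (n ℕ.* b ℕ.+ a) {{n*b+a≢0 n a}} λ x 0≤x x≤1 → begin
          (ι (n ℕ.* b ℕ.+ a) + x) * (t * g (a ◂ x))          ≡⟨ cong (λ z → (z + x) * (t * g (a ◂ x))) (trans (ι-+ (n ℕ.* b) a) (cong (_+ ι a) (ι-* n b))) ⟩
          (ι n * ι b + ι a + x) * (t * g (a ◂ x))            ≡⟨ cong (_* (t * g (a ◂ x))) (ℚ.+-assoc (ι n * ι b) (ι a) x) ⟩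
          (ι n * ι b + (ι a + x)) * (t * g (a ◂ x))          ≡⟨ eq₂ (ι n) (ι b) t (ι a + x) (g (a ◂ x)) ⟩
          (ι n * (ι b * t) + (a ◂ x)) * g (a ◂ x)            ≡⟨ cong (λ z → (z + (a ◂ x)) * g (a ◂ x)) (trans (cong (ι n *_) (ι-ι⁻¹ b)) (ℚ.*-identityʳ (ι n))) ⟩
          (ι n + (a ◂ x)) * g (a ◂ x)                        ≤⟨ bound (a ◂ x) (0≤◂ a 0≤x) (◂≤1 a<b x≤1) ⟩
          σ                                                  ∎)

    -- Expansion of 1/(n + x) for a fixed leading part n

    module Expansion (n : ℕ) .{{_ : NonZero n}} where

      c : ℕ → ℚ
      c m = (- 1ℚ) ^ℚ m * ι⁻¹ n ^ℚ suc m

      -- The first `M` terms of the geometric series of `1/(n + x)` in powers of `x/n`.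
      G : ℕ → ℚ → ℚ
      G M x = ∑< M (λ m → c m * x ^ℚ m)

      remainder : ℕ → ℚ → ℚ
      remainder M x = (- 1ℚ) ^ℚ M * (ι⁻¹ n ^ℚ M * x ^ℚ M)

      [n+x]*G : ∀ M x → (ι n + x) * G M x ≡ 1ℚ - remainder M x
      [n+x]*G zero    x = ℚ.*-zeroʳ (ι n + x)
      [n+x]*G (suc M) x = begin
        (ι n + x) * G (suc M) x                                         ≡⟨ cong ((ι n + x) *_) (∑<-last M (λ m → c m * x ^ℚ m)) ⟩
        (ι n + x) * (G M x + c M * x ^ℚ M)                              ≡⟨ ℚ.*-distribˡ-+ (ι n + x) _ _ ⟩
        (ι n + x) * G M x + (ι n + x) * (c M * x ^ℚ M)                  ≡⟨ cong₂ _+_ ([n+x]*G M x) (eq₁ (ι n) x ((- 1ℚ) ^ℚ M) (ι⁻¹ n) (ι⁻¹ n ^ℚ M) (x ^ℚ M)) ⟩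
        (1ℚ - remainder M x) + (ι n * ι⁻¹ n * remainder M x - remainder (suc M) x)
          ≡⟨ cong (λ z → (1ℚ - remainder M x) + (z * remainder M x - remainder (suc M) x)) (ι-ι⁻¹ n) ⟩
        (1ℚ - remainder M x) + (1ℚ * remainder M x - remainder (suc M) x)
          ≡⟨ eq₂ (remainder M x) (remainder (suc M) x) ⟩
        1ℚ - remainder (suc M) x                                        ∎
        where
        open ≡-Reasoning
        open ℚ-Solver
        eq₁ : ∀ n x s t T X → (n + x) * (s * (t * T) * X) ≡ n * t * (s * (T * X)) - (- 1ℚ) * s * (t * T * (x * X))
        eq₁ = solve 6 (λ n x s t T X → (n :+ x) :* (s :* (t :* T) :* X)
          := n :* t :* (s :* (T :* X)) :- con (- 1ℚ) :* s :* (t :* T :* (x :* X))) refl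
        eq₂ : ∀ r s → (1ℚ - r) + (1ℚ * r - s) ≡ 1ℚ - s
        eq₂ = solve 2 (λ r s → (con 1ℚ :- r) :+ (con 1ℚ :* r :- s) := con 1ℚ :- s) refl

      -- `(x/n)^M ≤ x^M ≤ (n + x) x^M` because `n ≥ 1`. The decay of `n^-M` is given up, since it is
      -- absent for `n = 1`.
      ∣remainder∣≤ : ∀ M {x} → 0ℚ ≤ x → ∣ remainder M x ∣ ≤ (ι n + x) * x ^ℚ M
      ∣remainder∣≤ M {x} 0≤x = begin
        ∣ remainder M x ∣                                 ≡⟨ ℚ.∣p*q∣≡∣p∣*∣q∣ ((- 1ℚ) ^ℚ M) _ ⟩
        ∣ (- 1ℚ) ^ℚ M ∣ * ∣ ι⁻¹ n ^ℚ M * x ^ℚ M ∣         ≡⟨ trans (cong (_* ∣ ι⁻¹ n ^ℚ M * x ^ℚ M ∣) (∣-1^m∣≡1 M)) (ℚ.*-identityˡ _) ⟩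
        ∣ ι⁻¹ n ^ℚ M * x ^ℚ M ∣                           ≡⟨ ℚ.0≤p⇒∣p∣≡p (*-nonneg (^ℚ-nonneg (0≤ι⁻¹ n) M) 0≤xᴹ) ⟩
        ι⁻¹ n ^ℚ M * x ^ℚ M                               ≤⟨ ℚ.*-monoʳ-≤-nonNeg (x ^ℚ M) {{nonNegative 0≤xᴹ}} (ℚ.≤-trans (^ℚ-≤1 (0≤ι⁻¹ n) (ι⁻¹≤1 n) M) 1≤n+x) ⟩
        (ι n + x) * x ^ℚ M                                ∎
        where
        open ℚ.≤-Reasoning
        0≤xᴹ = ^ℚ-nonneg 0≤x M
        1≤n+x : 1ℚ ≤ ι n + x
        1≤n+x = ℚ.≤-trans (subst (_≤ ι n) ι-one (ι-mono-≤ (ℕ.>-nonZero⁻¹ n))) (p≤p+q 0≤x)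

      A-G : ∀ L p M → A L p (G M) ≡ ∑< M (λ m → c m * U L p m)
      A-G L p M = A-∑< L p M c (λ m x → x ^ℚ m)

      -- `A≤S` with `σ = 1` and the minorant `G M x - x^M` of `1/(n + x)`.
      lower : ∀ L M → A L (row n) (G M) - U L (row n) M ≤ S L n
      lower L M = subst₂ _≤_ (A-- L (row n) (G M) (_^ℚ M)) (ℚ.*-identityˡ (S L n)) (A≤S L n λ x 0≤x x≤1 → begin
        (ι n + x) * (G M x - x ^ℚ M)                    ≡⟨ p*[q-r]≡p*q-p*r (ι n + x) (G M x) (x ^ℚ M) ⟩
        (ι n + x) * G M x - (ι n + x) * x ^ℚ M          ≡⟨ cong (_- (ι n + x) * x ^ℚ M) ([n+x]*G M x) ⟩
        1ℚ - remainder M x - (ι n + x) * x ^ℚ M         ≤⟨ ℚ.+-monoˡ-≤ _ (ℚ.+-monoʳ-≤ 1ℚ (ℚ.≤-trans (-p≤∣p∣ (remainder M x)) (∣remainder∣≤ M 0≤x))) ⟩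
        1ℚ + (ι n + x) * x ^ℚ M - (ι n + x) * x ^ℚ M    ≡⟨ eq ((ι n + x) * x ^ℚ M) ⟩
        1ℚ                                              ∎)
        where
        open ℚ.≤-Reasoning
        open ℚ-Solver
        eq : ∀ p → 1ℚ + p - p ≡ 1ℚ
        eq = solve 1 (λ p → con 1ℚ :+ p :- p := con 1ℚ) refl

      -- `A≤S` with `σ = -1` and the negative of the majorant `G M x + x^M`.
      upper : ∀ L M → S L n ≤ A L (row n) (G M) + U L (row n) M
      upper L M = subst₂ _≤_ (eq₃ (S L n)) (trans (cong ((- 1ℚ) *_) (trans (A-* L (row n) (- 1ℚ) (λ x → G M x + x ^ℚ M))
            (cong ((- 1ℚ) *_) (A-+ L (row n) (G M) (_^ℚ M))))) (eq₄ (A L (row n) (G M)) (U L (row n) M)))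
          (ℚ.*-monoˡ-≤-nonPos (- 1ℚ) (A≤S L n λ x 0≤x x≤1 → begin
        (ι n + x) * (- 1ℚ * (G M x + x ^ℚ M))               ≡⟨ eq₁ (ι n + x) (G M x) (x ^ℚ M) ⟩
        - ((ι n + x) * G M x + (ι n + x) * x ^ℚ M)          ≡⟨ cong (λ z → - (z + (ι n + x) * x ^ℚ M)) ([n+x]*G M x) ⟩
        - (1ℚ - remainder M x + (ι n + x) * x ^ℚ M)         ≤⟨ ℚ.neg-antimono-≤ (ℚ.+-monoʳ-≤ (1ℚ - remainder M x) (ℚ.≤-trans (p≤∣p∣ (remainder M x)) (∣remainder∣≤ M 0≤x))) ⟩
        - (1ℚ - remainder M x + remainder M x)              ≡⟨ eq₂ (remainder M x) ⟩
        - 1ℚ                                                ∎))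
        where
        open ℚ.≤-Reasoning
        open ℚ-Solver
        eq₁ : ∀ y g z → y * (- 1ℚ * (g + z)) ≡ - (y * g + y * z)
        eq₁ = solve 3 (λ y g z → y :* (con (- 1ℚ) :* (g :+ z)) := :- (y :* g :+ y :* z)) refl
        eq₂ : ∀ r → - (1ℚ - r + r) ≡ - 1ℚ
        eq₂ = solve 1 (λ r → :- (con 1ℚ :- r :+ r) := con (- 1ℚ)) refl
        eq₃ : ∀ s → - 1ℚ * (- 1ℚ * s) ≡ s
        eq₃ = solve 1 (λ s → con (- 1ℚ) :* (con (- 1ℚ) :* s) := s) refl
        eq₄ : ∀ p q → - 1ℚ * (- 1ℚ * (p + q)) ≡ p + q
        eq₄ = solve 2 (λ p q → con (- 1ℚ) :* (con (- 1ℚ) :* (p :+ q)) := p :+ q) refl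

      expand : ℕ → ℚ
      expand M = ∑< M (λ m → c m * v (row n) m)

      defect : ℕ → ℕ → ℚ
      defect M L = ∑< M (λ m → c m * err L (row n) m)

      Null-defect : ∀ M → Null (defect M)
      Null-defect M = Null-∑< M λ m _ → Null-* (c m) (Null-err (row n) m)

      expand≡ : ∀ L M → expand M ≡ A L (row n) (G M) + defect M L
      expand≡ L M = trans (∑<-cong M λ m _ → eq (c m) (v (row n) m) (U L (row n) m))
        (trans (∑<-distrib-+ M (λ m → c m * U L (row n) m) (λ m → c m * err L (row n) m))
          (cong (_+ defect M L) (sym (A-G L (row n) M))))
        where
        open ℚ-Solver
        eq : ∀ c v u → c * v ≡ c * u + c * (v - u)
        eq = solve 3 (λ c v u → c :* v := c :* u :+ c :* (v :- u)) refl

      -- Two errors are kept separate: cutting the geometric series costs `lebesgue M`, uniformly in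
      -- `L`; cutting the strings costs `defect M L`, null in `L` for fixed `M`.
      ∣S-expand∣≤ : ∀ L M → ∣ S L n - expand M ∣ ≤ lebesgue M + ∣ defect M L ∣
      ∣S-expand∣≤ L M = begin
        ∣ S L n - expand M ∣                                ≤⟨ ∣-∣-triangle (S L n) a (expand M) ⟩
        ∣ S L n - a ∣ + ∣ a - expand M ∣                    ≤⟨ ℚ.+-mono-≤ ∣S-a∣≤ (ℚ.≤-reflexive ∣a-expand∣≡) ⟩
        lebesgue M + ∣ defect M L ∣                         ∎
        where
        open ℚ.≤-Reasoning
        open ℚ-Solver
        a = A L (row n) (G M)
        neg : ∀ p q → - (p - q) ≡ q - p
        neg = solve 2 (λ p q → :- (p :- q) := q :- p) refl
        cancel : ∀ p q → p + q - p ≡ q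
        cancel = solve 2 (λ p q → p :+ q :- p := q) refl
        swap : ∀ p q → p - (p - q) ≡ q
        swap = solve 2 (λ p q → p :- (p :- q) := q) refl
        ∣a-expand∣≡ : ∣ a - expand M ∣ ≡ ∣ defect M L ∣
        ∣a-expand∣≡ = trans (∣p-q∣≡∣q-p∣ a (expand M)) (cong ∣_∣ (trans (cong (_- a) (expand≡ L M)) (cancel a (defect M L))))
        ∣S-a∣≤ : ∣ S L n - a ∣ ≤ lebesgue M
        ∣S-a∣≤ = ℚ.≤-trans (∣p∣≤q
          (subst (S L n - a ≤_) (cancel a (U L (row n) M)) (ℚ.+-monoˡ-≤ (- a) (upper L M)))
          (subst₂ _≤_ (sym (neg (S L n) a)) (swap a (U L (row n) M)) (ℚ.+-monoʳ-≤ a (ℚ.neg-antimono-≤ (lower L M)))))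
          (U≤lebesgue L (row n) M)

    -- Regrouping the series by leading digits

    extent : ℕ → ℕ → ℕ
    extent zero    P = 0
    extent (suc L) P = P ℕ.* (b ∸ 1) ℕ.+ extent L (P ℕ.* b)

    P*[b∸1]+P : ∀ P → P ℕ.+ P ℕ.* (b ∸ 1) ≡ P ℕ.* b
    P*[b∸1]+P P = trans (sym (ℕ.*-suc P (b ∸ 1))) (cong (P ℕ.*_) (ℕ.m+[n∸m]≡n (ℕ.<⇒≤ 1<b)))

    P+extent : ∀ L P → P ℕ.+ extent L P ≡ P ℕ.* b ^ L
    P+extent zero    P = trans (ℕ.+-identityʳ P) (sym (ℕ.*-identityʳ P))
    P+extent (suc L) P = begin
      P ℕ.+ (P ℕ.* (b ∸ 1) ℕ.+ extent L (P ℕ.* b))   ≡⟨ ℕ.+-assoc P (P ℕ.* (b ∸ 1)) _ ⟨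
      P ℕ.+ P ℕ.* (b ∸ 1) ℕ.+ extent L (P ℕ.* b)     ≡⟨ cong (ℕ._+ extent L (P ℕ.* b)) (P*[b∸1]+P P) ⟩
      P ℕ.* b ℕ.+ extent L (P ℕ.* b)                 ≡⟨ P+extent L (P ℕ.* b) ⟩
      P ℕ.* b ℕ.* b ^ L                              ≡⟨ ℕ.*-assoc P b (b ^ L) ⟩
      P ℕ.* b ^ suc L                                ∎
      where open ≡-Reasoning

    -- Appending fewer than `L` digits to the integers from `P` to `P b - 1` reaches every integer
    -- from `P` to `P b^L - 1` exactly once. One appended digit carries the block at `P` to the
    -- block at `P b`.
    ∑-S : ∀ L P → ∑< (P ℕ.* (b ∸ 1)) (λ i → S L (P ℕ.+ i)) ≡ ∑< (extent L P) (λ i → h (P ℕ.+ i))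
    ∑-S zero    P = ∑<-zero (P ℕ.* (b ∸ 1))
    ∑-S (suc L) P = begin
      ∑< W (λ i → h (P ℕ.+ i) + ∑< b (λ a → S L ((P ℕ.+ i) ℕ.* b ℕ.+ a)))
        ≡⟨ ∑<-distrib-+ W (λ i → h (P ℕ.+ i)) (λ i → ∑< b (λ a → S L ((P ℕ.+ i) ℕ.* b ℕ.+ a))) ⟩
      ∑< W (λ i → h (P ℕ.+ i)) + ∑< W (λ i → ∑< b (λ a → S L ((P ℕ.+ i) ℕ.* b ℕ.+ a)))
        ≡⟨ cong (_+_ (∑< W (λ i → h (P ℕ.+ i)))) (begin
             ∑< W (λ i → ∑< b (λ a → S L ((P ℕ.+ i) ℕ.* b ℕ.+ a)))
               ≡⟨ ∑<-cong W (λ i _ → ∑<-cong b λ a _ → cong (S L) (index i a)) ⟩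
             ∑< W (λ i → ∑< b (λ a → S L (P ℕ.* b ℕ.+ (i ℕ.* b ℕ.+ a))))
               ≡⟨ ∑<-* W b (λ i → S L (P ℕ.* b ℕ.+ i)) ⟨
             ∑< (W ℕ.* b) (λ i → S L (P ℕ.* b ℕ.+ i))
               ≡⟨ cong (λ n → ∑< n (λ i → S L (P ℕ.* b ℕ.+ i))) (width P (b ∸ 1)) ⟩
             ∑< (P ℕ.* b ℕ.* (b ∸ 1)) (λ i → S L (P ℕ.* b ℕ.+ i))
               ≡⟨ ∑-S L (P ℕ.* b) ⟩
             ∑< (extent L (P ℕ.* b)) (λ i → h (P ℕ.* b ℕ.+ i))
               ≡⟨ ∑<-cong (extent L (P ℕ.* b)) (λ i _ → cong h (sym (trans (sym (ℕ.+-assoc P W i)) (cong (ℕ._+ i) (P*[b∸1]+P P))))) ⟩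
             ∑< (extent L (P ℕ.* b)) (λ i → h (P ℕ.+ (W ℕ.+ i))) ∎) ⟩
      ∑< W (λ i → h (P ℕ.+ i)) + ∑< (extent L (P ℕ.* b)) (λ i → h (P ℕ.+ (W ℕ.+ i)))
        ≡⟨ ∑<-++ W (extent L (P ℕ.* b)) (λ i → h (P ℕ.+ i)) ⟨
      ∑< (extent (suc L) P) (λ i → h (P ℕ.+ i)) ∎
      where
      open ≡-Reasoning
      open ℕ-Solver
      W = P ℕ.* (b ∸ 1)
      index : ∀ i a → (P ℕ.+ i) ℕ.* b ℕ.+ a ≡ P ℕ.* b ℕ.+ (i ℕ.* b ℕ.+ a)
      index i a = trans (cong (ℕ._+ a) (ℕ.*-distribʳ-+ b P i)) (ℕ.+-assoc (P ℕ.* b) (i ℕ.* b) a)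
      width : ∀ P c → P ℕ.* c ℕ.* b ≡ P ℕ.* b ℕ.* c
      width P c = solve 3 (λ p q r → p :* q :* r := p :* r :* q) refl P c b

    H : ℕ → ℚ
    H = partialSum h

    H≡ : ∀ N → H N ≡ ∑< N (h ∘ suc)
    H≡ N = ∑-applyUpTo (1 ℕ.+_) N h

    H-mono : ∀ {m n} → m ℕ.≤ n → H m ≤ H n
    H-mono {m} {n} m≤n = subst₂ _≤_ (sym (H≡ m)) (sym (trans (H≡ n)
        (trans (cong (λ n → ∑< n (h ∘ suc)) (sym (ℕ.m+[n∸m]≡n m≤n))) (∑<-++ m (n ∸ m) (h ∘ suc)))))
      (p≤p+q (∑<-nonneg (n ∸ m) λ i _ → 0≤h (suc (m ℕ.+ i))))

    -- The expansion over one block of leading parts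

    module Level (P′ Q : ℕ) (width : Q ∸ suc P′ ≡ suc P′ ℕ.* (b ∸ 1)) where

      P W : ℕ
      P = suc P′
      W = P ℕ.* (b ∸ 1)

      level : List ℕ
      level = filter (λ n → #d n ℕ.≤? k) [ P ⋯ Q ⟩

      term : ℕ → ℚ
      term m = ((- 1ℚ) ^ℚ m) * ∑ level (λ n → u (k ∸ #d n) m * (1/ (n ^ suc m)))

      head : ℚ
      head = ∑ (filter (λ n → #d n ℕ.≟ k) [ 1 ⋯ P ⟩) (λ n → 1/ n) + fromℕ b * ∑ level (λ n → 1/ n)

      T : ℕ → ℚ
      T M = head + partialSum term M

      -- The condition `#d n ≤ k` is absorbed into the row index because `x n` vanishes at 0.
      ∑-level : ∀ f (x : ℕ → ℕ → ℚ) → (∀ n → x n 0 ≡ 0ℚ) →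
        (∀ n .{{_ : NonZero n}} → f n ≡ x n (suc (k ∸ #d n))) → ∑ level f ≡ ∑< W (λ i → x (P ℕ.+ i) (row (P ℕ.+ i)))
      ∑-level f x x₀≡0 f≡x = begin
        ∑ level f                                                               ≡⟨ ∑-filter (λ n → #d n ℕ.≤? k) [ P ⋯ Q ⟩ f ⟩
        ∑ [ P ⋯ Q ⟩ (λ n → if does (#d n ℕ.≤? k) then f n else 0ℚ)              ≡⟨ ∑-applyUpTo (P ℕ.+_) (Q ∸ P) (λ n → if does (#d n ℕ.≤? k) then f n else 0ℚ) ⟩
        ∑< (Q ∸ P) (λ i → if does (#d (P ℕ.+ i) ℕ.≤? k) then f (P ℕ.+ i) else 0ℚ) ≡⟨ cong (λ n → ∑< n (λ i → if does (#d (P ℕ.+ i) ℕ.≤? k) then f (P ℕ.+ i) else 0ℚ)) width ⟩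
        ∑< W (λ i → if does (#d (P ℕ.+ i) ℕ.≤? k) then f (P ℕ.+ i) else 0ℚ)
          ≡⟨ ∑<-cong W (λ i _ → trans (cong (if does (#d (P ℕ.+ i) ℕ.≤? k) then_else 0ℚ) (f≡x (P ℕ.+ i)))
               (if-≤? (#d (P ℕ.+ i)) k (x (P ℕ.+ i)) (x₀≡0 (P ℕ.+ i)))) ⟩
        ∑< W (λ i → x (P ℕ.+ i) (row (P ℕ.+ i)))                                ∎
        where open ≡-Reasoning

      open Expansion using (c; expand; defect; Null-defect; ∣S-expand∣≤)

      Q-term : ℕ → ℚ
      Q-term m = ∑< W (λ i → c (P ℕ.+ i) m * v (row (P ℕ.+ i)) m)

      term≡ : ∀ m → term m ≡ Q-term m
      term≡ m = trans (cong ((- 1ℚ) ^ℚ m *_) (∑-level _ (λ n p → v p m * ι⁻¹ n ^ℚ suc m)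
          (λ n → trans (cong (_* ι⁻¹ n ^ℚ suc m) (v-zero m)) (ℚ.*-zeroˡ (ι⁻¹ n ^ℚ suc m)))
          λ n → cong₂ _*_ (sym (v-suc (k ∸ #d n) m)) (trans (sym (ι⁻¹≡1/ (n ^ suc m))) (ι⁻¹-^ n (suc m)))))
        (trans (sym (*-distribˡ-∑< W ((- 1ℚ) ^ℚ m) (λ i → v (row (P ℕ.+ i)) m * ι⁻¹ (P ℕ.+ i) ^ℚ suc m)))
          (∑<-cong W λ i _ → eq ((- 1ℚ) ^ℚ m) (v (row (P ℕ.+ i)) m) (ι⁻¹ (P ℕ.+ i) ^ℚ suc m)))
        where
        open ℚ-Solver
        eq : ∀ s v t → s * (v * t) ≡ s * t * v
        eq = solve 3 (λ s v t → s :* (v :* t) := s :* t :* v) refl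

      -- As every u_{j;0} equals `b`, the middle sum of the formula is the `m = 0` term of the
      -- series.
      b*∑level≡ : fromℕ b * ∑ level (λ n → 1/ n) ≡ Q-term 0
      b*∑level≡ = trans (trans (cong (_* ∑ level (λ n → 1/ n)) (sym (ι≡fromℕ b))) (sym (*-distribˡ-∑ level)))
        (trans (∑-level (λ n → ι b * (1/ n)) (λ n p → v p 0 * ι⁻¹ n)
          (λ n → trans (cong (_* ι⁻¹ n) (v-zero 0)) (ℚ.*-zeroˡ (ι⁻¹ n)))
          λ n → cong₂ _*_ (sym (v-0 (k ∸ #d n))) (sym (ι⁻¹≡1/ n)))
          (∑<-cong W λ i _ → eq (v (row (P ℕ.+ i)) 0) (ι⁻¹ (P ℕ.+ i))))
        where
        open ℚ-Solver
        eq : ∀ v t → v * t ≡ 1ℚ * (t * 1ℚ) * v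
        eq = solve 2 (λ v t → v :* t := con 1ℚ :* (t :* con 1ℚ) :* v) refl
        *-distribˡ-∑ : ∀ ns → ∑ ns (λ n → ι b * (1/ n)) ≡ ι b * ∑ ns (λ n → 1/ n)
        *-distribˡ-∑ []       = sym (ℚ.*-zeroʳ (ι b))
        *-distribˡ-∑ (n ∷ ns) = trans (cong (_+_ (ι b * (1/ n))) (*-distribˡ-∑ ns)) (sym (ℚ.*-distribˡ-+ (ι b) (1/ n) _))

      -- `T M` holds `M` terms of the series and the term `m = 0`, whence `suc M` on the right.
      T≡ : ∀ M → T M ≡ ∑< P′ (h ∘ suc) + ∑< W (λ i → expand (P ℕ.+ i) (suc M))
      T≡ M = begin
        T M                                                          ≡⟨ ℚ.+-assoc (∑ (filter (λ n → #d n ℕ.≟ k) [ 1 ⋯ P ⟩) (λ n → 1/ n)) _ _ ⟩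
        ∑ (filter (λ n → #d n ℕ.≟ k) [ 1 ⋯ P ⟩) (λ n → 1/ n) + (fromℕ b * ∑ level (λ n → 1/ n) + partialSum term M)
          ≡⟨ cong₂ _+_ (trans (∑-filter (λ n → #d n ℕ.≟ k) [ 1 ⋯ P ⟩ (λ n → 1/ n)) (∑-applyUpTo (1 ℕ.+_) P′ h))
               (cong₂ _+_ b*∑level≡ (trans (∑-applyUpTo (1 ℕ.+_) M term) (∑<-cong M λ m _ → term≡ (suc m)))) ⟩
        ∑< P′ (h ∘ suc) + ∑< (suc M) Q-term
          ≡⟨ cong (_+_ (∑< P′ (h ∘ suc))) (∑<-swap (suc M) W (λ m i → c (P ℕ.+ i) m * v (row (P ℕ.+ i)) m)) ⟩
        ∑< P′ (h ∘ suc) + ∑< W (λ i → expand (P ℕ.+ i) (suc M))      ∎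
        where open ≡-Reasoning

      -- Equal to `P b^L - 1`, the last integer reached by appending fewer than `L` digits.
      ν : ℕ → ℕ
      ν L = P′ ℕ.+ extent L P

      n≤ν : ∀ L → L ℕ.≤ ν L
      n≤ν L = ℕ.≤-pred (begin
        suc L                 ≤⟨ n<m^n b 1<b L ⟩
        b ^ L                 ≤⟨ ℕ.m≤n*m (b ^ L) P ⟩
        P ℕ.* b ^ L           ≡⟨ P+extent L P ⟨
        suc (ν L)             ∎)
        where open ℕ.≤-Reasoning

      H-ν : ∀ L → H (ν L) ≡ ∑< P′ (h ∘ suc) + ∑< W (λ i → S L (P ℕ.+ i))
      H-ν L = trans (H≡ (ν L)) (trans (∑<-++ P′ (extent L P) (h ∘ suc)) (cong (_+_ (∑< P′ (h ∘ suc))) (sym (∑-S L P))))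

      E : ℕ → ℚ
      E M = ∑< W (λ _ → lebesgue (suc M))

      δ : ℕ → ℕ → ℚ
      δ M L = ∑< W (λ i → ∣ defect (P ℕ.+ i) (suc M) L ∣)

      ∣H-T∣≤ : ∀ M L → ∣ H (ν L) - T M ∣ ≤ E M + ∣ δ M L ∣
      ∣H-T∣≤ M L = begin
        ∣ H (ν L) - T M ∣
          ≡⟨ cong ∣_∣ (trans (cong₂ _-_ (H-ν L) (T≡ M)) (eq (∑< P′ (h ∘ suc)) _ _)) ⟩
        ∣ ∑< W (λ i → S L (P ℕ.+ i)) - ∑< W (λ i → expand (P ℕ.+ i) (suc M)) ∣
          ≡⟨ cong ∣_∣ (∑<-distrib-- W (λ i → S L (P ℕ.+ i)) (λ i → expand (P ℕ.+ i) (suc M))) ⟨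
        ∣ ∑< W (λ i → S L (P ℕ.+ i) - expand (P ℕ.+ i) (suc M)) ∣
          ≤⟨ ∣∑<∣≤∑<∣∣ W _ ⟩
        ∑< W (λ i → ∣ S L (P ℕ.+ i) - expand (P ℕ.+ i) (suc M) ∣)
          ≤⟨ ∑<-mono-≤ W (λ i _ → ∣S-expand∣≤ (P ℕ.+ i) L (suc M)) ⟩
        ∑< W (λ i → lebesgue (suc M) + ∣ defect (P ℕ.+ i) (suc M) L ∣)
          ≡⟨ ∑<-distrib-+ W (λ _ → lebesgue (suc M)) (λ i → ∣ defect (P ℕ.+ i) (suc M) L ∣) ⟩
        E M + δ M L
          ≤⟨ ℚ.+-monoʳ-≤ (E M) (p≤∣p∣ (δ M L)) ⟩
        E M + ∣ δ M L ∣ ∎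
        where
        open ℚ.≤-Reasoning
        open ℚ-Solver
        eq : ∀ p q r → (p + q) - (p + r) ≡ q - r
        eq = solve 3 (λ p q r → (p :+ q) :- (p :+ r) := q :- r) refl

      H-close-T : ∀ ε → 0ℚ < ε → ∃ λ M₀ → ∀ M → M₀ ℕ.≤ M → ∃ λ N → ∀ n → N ℕ.≤ n → ∣ H n - T M ∣ < ε
      H-close-T = squeeze ν H-mono n≤ν (Null-∑< W λ _ _ → Null-suc Null-lebesgue)
        λ M → δ M , Null-∑< W (λ i _ → Null-∣∣ (Null-defect (P ℕ.+ i) (suc M))) , ∣H-T∣≤ M

  -- Assembling the statement

  u-limit : ∀ m → (λ j → u j (suc m)) ⟶ (+ b / suc (suc m))
  u-limit m ε 0<ε = shift (Null-suc (Null-w (suc m)) ε 0<ε)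
    where
    shift : (∃ λ N → ∀ j → N ℕ.≤ j → ∣ w (suc j) (suc m) ∣ < ε) →
      ∃ λ N → ∀ j → N ℕ.≤ j → ∣ u j (suc m) - (+ b / suc (suc m)) ∣ < ε
    shift (N , h) = N , λ j N≤j → subst (_< ε) (trans (∣p-q∣≡∣q-p∣ (lebesgue (suc m)) (v (suc j) (suc m)))
      (cong₂ (λ y z → ∣ y - z ∣) (v-suc j (suc m)) (sym (/≡ι*ι⁻¹ b (suc (suc m)))))) (h j N≤j)

  u-nonneg : ∀ j m → 0ℚ ≤ u j m
  u-nonneg j m = subst (0ℚ ≤_) (v-suc j m) (0≤v (suc j) m)

  u-zero⇒exceptional : ∀ j m → u j (suc m) ≡ 0ℚ → j ≡ 0 × b ≡ 2 × toℕ d ≡ 1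
  u-zero⇒exceptional j m u≡0 = v≡0⇒exceptional j m (trans (v-suc j (suc m)) u≡0)

  u-antitone : ∀ j m → u j (suc m) ≤ u j m
  u-antitone j m = subst₂ _≤_ (v-suc j (suc m)) (v-suc j m) (v-antitone (suc j) m)

  u-strict : ∀ j m → ¬ (u j (suc m) ≡ 0ℚ × u j m ≡ 0ℚ) → u j (suc m) < u j m
  u-strict j m nonzero = subst₂ _<_ (v-suc j (suc m)) (v-suc j m) (v-strict (suc j) m λ (eq , eq′) →
    nonzero (trans (sym (v-suc j (suc m))) eq , trans (sym (v-suc j m)) eq′))

  u-increasing : ∀ m i j → i ℕ.< j → u i (suc m) < u j (suc m)
  u-increasing m i j i<j = subst₂ _<_ (v-suc i (suc m)) (v-suc j (suc m)) (v-mono-< m i<j)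

  -- Any block would do; `P = 1` is fixed so that the sum of the Irwin series is the same for all
  -- `l`.
  irwin-converges : ∀ k → Converges (irwinTerm k)
  irwin-converges k = close⇒cauchyˡ {H} {T} H-close-T
    where
    open Fixed k
    open Level 0 b (sym (ℕ.*-identityˡ (b ∸ 1)))

  -- `P` and `Q` are left free because `Level` needs `P` in successor form, which `b ^ l` has only
  -- propositionally.
  Expansion-at : ℕ → ℕ → ℕ → Set
  Expansion-at k P Q =
    let level = filter (λ n → #d n ≤? k) [ P ⋯ Q ⟩
        term  = λ m → ((- 1ℚ) ^ℚ m) * ∑ level (λ n → u (k ∸ #d n) m * (1/ (n ^ suc m)))
    in
    Σ[ converges ∈ Converges term ]
      ∑∞ (irwinTerm k) (irwin-converges k)
        ≃ fromℚ (∑ (filter (λ n → #d n ≟ k) [ 1 ⋯ P ⟩) (λ n → 1/ n))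
          +ᴿ fromℚ (fromℕ b * ∑ level (λ n → 1/ n))
          +ᴿ ∑∞ term converges

  expansion-suc : ∀ k P′ Q → Q ∸ suc P′ ≡ suc P′ ℕ.* (b ∸ 1) → Expansion-at k (suc P′) Q
  expansion-suc k P′ Q width =
    cauchy-cancel-+ head {partialSum term} (close⇒cauchyʳ {H} {T} H-close-T) , close⇒≃ {H} {T} H-close-T
    where
    open Fixed k
    open Level P′ Q width

  -- The index is shifted: `l` here is one less than the number of leading digits.
  expansion : ∀ k l → Expansion-at k (b ^ l) (b ^ suc l)
  expansion k l = subst (λ P → Expansion-at k P (b ^ suc l)) suc-pred
    (expansion-suc k (ℕ.pred (b ^ l)) (b ^ suc l) (begin
      b ^ suc l ∸ suc (ℕ.pred (b ^ l))           ≡⟨ cong (b ^ suc l ∸_) suc-pred ⟩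
      b ℕ.* b ^ l ∸ b ^ l                        ≡⟨ cong₂ _∸_ (ℕ.*-comm b (b ^ l)) (sym (ℕ.*-identityʳ (b ^ l))) ⟩
      b ^ l ℕ.* b ∸ b ^ l ℕ.* 1                  ≡⟨ ℕ.*-distribˡ-∸ (b ^ l) b 1 ⟨
      b ^ l ℕ.* (b ∸ 1)                          ≡⟨ cong (ℕ._* (b ∸ 1)) suc-pred ⟨
      suc (ℕ.pred (b ^ l)) ℕ.* (b ∸ 1)           ∎))
    where
    open ≡-Reasoning
    suc-pred : suc (ℕ.pred (b ^ l)) ≡ b ^ l
    suc-pred = ℕ.suc-pred (b ^ l) {{ℕ.m^n≢0 b l}}

mainTheorem1 :
  (b : ℕ) .{{_ : NonTrivial b}} (d : Fin b) → let open Irwin b d in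
    ((k : ℕ) →
      Σ[ H-converges ∈ Converges (irwinTerm k) ]
        ((l : ℕ) → 1 ℕ.≤ l →
          let level = filter (λ n → #d n ≤? k) [ b ^ (l ∸ 1) ⋯ b ^ l ⟩
              term  = λ m → ((- 1ℚ) ^ℚ m) * ∑ level (λ n → u (k ∸ #d n) m * (1/ (n ^ suc m)))
          in
          Σ[ converges ∈ Converges term ]
            ∑∞ (irwinTerm k) H-converges
              ≃ fromℚ (∑ (filter (λ n → #d n ≟ k) [ 1 ⋯ b ^ (l ∸ 1) ⟩) (λ n → 1/ n))
                +ᴿ fromℚ (fromℕ b * ∑ level (λ n → 1/ n))
                +ᴿ ∑∞ term converges))
    × ((j m : ℕ) → 1 ℕ.≤ m →
        0ℚ ≤ u j m × (u j m ≡ 0ℚ → j ≡ 0 × b ≡ 2 × toℕ d ≡ 1))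
    × ((j m : ℕ) →
        u j (suc m) ≤ u j m
        × (¬ (u j (suc m) ≡ 0ℚ × u j m ≡ 0ℚ) → u j (suc m) < u j m))
    × ((m : ℕ) → 1 ℕ.≤ m →
        ((i j : ℕ) → i ℕ.< j → u i m < u j m)
        × ((λ j → u j m) ⟶ (+ b / suc m)))
mainTheorem1 b d =
    (λ k → irwin-converges k , λ { (suc l) _ → expansion k l })
  , (λ { j (suc m) _ → u-nonneg j (suc m) , u-zero⇒exceptional j m })
  , (λ j m → u-antitone j m , u-strict j m)
  , (λ { (suc m) _ → u-increasing m , u-limit m })
  where open Rows b d
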